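{- Let $s \ge 3$ and suppose there exist an $(n, d(F), \lambda(F))$-graph $F$ and an $(n, d(G), \lambda(G))$-graph $G$ on the same vertex set $V$ such that the pair $(F,G)$ is $H_s$-free. Let \[ \eta = \max\left\{ \frac{\lambda(G)^2}{d(G)^2}, \frac{\lambda(F)\lambda(G)}{d(F)d(G)} \right\}, \qquad w = \frac{4 n \log n}{d(G)}. \] Then for every positive integer $k$ with $w \le k \le \eta\, d(F)\, n$, \[ r(s,k) \ge \frac{1}{50} k\, \eta^{\frac{w-k}{k}} - 1. \] In particular, if $\eta\, d(F)\, n \ge k \ge 100 n (\log n)^2 / d(G)$, then \[ r(s,k) \ge \frac{k}{100\eta} - 1. \]
   Context: Graphs may have loops (at most one per vertex); in the adjacency matrix a loop is a $1$ on the diagonal and contributes one to the degree. A graph is an $(n,d,\lambda)$-graph if it has $n$ vertices, is $d$-regular, and all eigenvalues of its adjacency matrix other than the largest one (which equals $d$) are at most $\lambda$ in absolute value. An ordered pair of graphs $(F,G)$ on the same vertex set is $H_s$-free if there is no $2s$-tuple of (not necessarily distinct) vertices $(a_1,b_1,\dots,a_s,b_s)$ with $a_ib_i \in E(F)$ for all $i\in[s]$ and $a_ib_j \in E(G)$ for all $1 \le i < j \le s$ (an edge $aa$ means a loop). The Ramsey number $r(s,k)$ is the minimum $N$ such that every graph on $N$ vertices contains a clique of size $s$ or an independent set of size $k$. $\log$ is the natural logarithm. -}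

module Defs where

open import Algebra.Bundles using (CommutativeRing; Semiring)
import Algebra.Construct.NaturalChoice.Max as Max
import Algebra.Definitions.RawSemiring as RawSemiringDefs
open import Data.Bool using (Bool; T; if_then_else_)
open import Data.Fin using (Fin; toℕ; _<_)
open import Data.Fin.Subset using (Subset; ∣_∣)
open import Data.Nat as ℕ using (ℕ; _!)
open import Data.Product using (Σ-syntax; ∃; ∃-syntax; _×_)
open import Data.Sum using (_⊎_)
open import Data.Vec using (tabulate)
open import Function.Definitions using (Injective)
open import Level using (0ℓ; suc)
open import Relation.Binary using (Rel; IsDecTotalOrder; TotalOrder)
open import Relation.Binary.PropositionalEquality using (_≡_; _≢_)
open import Relation.Nullary using (¬_)
open import Relation.Unary using (Pred)

-- A Dedekind-complete ordered field.  Up to isomorphism ℝ is the only one, so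
-- a statement about all of them is a statement about ℝ.  Equality is a setoid
-- equality.
record CompleteOrderedField : Set (suc 0ℓ) where
  infix  4 _≤_
  infixl 7 _/_
  infix  8 _⁻¹

  field
    commutativeRing : CommutativeRing 0ℓ 0ℓ

  open CommutativeRing commutativeRing public

  field
    _≤_             : Rel Carrier 0ℓ
    isDecTotalOrder : IsDecTotalOrder _≈_ _≤_
    +-monoʳ-≤       : ∀ x {y z} → y ≤ z → x + y ≤ x + z
    *-nonNegative   : ∀ {x y} → 0# ≤ x → 0# ≤ y → 0# ≤ x * y
    1≉0             : ¬ (1# ≈ 0#)
    _⁻¹             : Carrier → Carrier
    ⁻¹-cong         : ∀ {x y} → x ≈ y → x ⁻¹ ≈ y ⁻¹
    ⁻¹-inverseʳ     : ∀ {x} → ¬ (x ≈ 0#) → x * x ⁻¹ ≈ 1#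
    -- Totalisation convention only.
    0⁻¹≈0           : 0# ⁻¹ ≈ 0#

  UpperBound : Pred Carrier 0ℓ → Pred Carrier 0ℓ
  UpperBound P u = ∀ x → P x → x ≤ u

  field
    complete : (P : Pred Carrier 0ℓ) → ∃ P → ∃ (UpperBound P) →
               ∃[ u ] (UpperBound P u × (∀ v → UpperBound P v → u ≤ v))

  totalOrder : TotalOrder 0ℓ 0ℓ 0ℓ
  totalOrder = record
    { isTotalOrder = IsDecTotalOrder.isTotalOrder isDecTotalOrder }

  open Max totalOrder public using (_⊔_)
  open RawSemiringDefs (Semiring.rawSemiring semiring) public using (sum; _^_)
  private module RawDefs = RawSemiringDefs (Semiring.rawSemiring semiring)

  fromℕ : ℕ → Carrier
  fromℕ n = n RawDefs.× 1#

  _/_ : Carrier → Carrier → Carrier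
  x / y = x * y ⁻¹

  abs : Carrier → Carrier
  abs x = x ⊔ (- x)

  Positive : Pred Carrier 0ℓ
  Positive x = ¬ (x ≤ 0#)

  _ConvergesTo_ : (ℕ → Carrier) → Carrier → Set
  a ConvergesTo l =
    ∀ ε → Positive ε → ∃[ N ] (∀ m → N ℕ.≤ m → abs (a m - l) ≤ ε)

  expPartialSum : Carrier → ℕ → Carrier
  expPartialSum x m = sum {m} (λ i → x ^ toℕ i / fromℕ (toℕ i !))

-- The real numbers together with exp, given by its power series, and the
-- natural logarithm, its inverse.  These properties determine exp everywhere
-- and log on the positive reals.
record RealNumbers : Set (suc 0ℓ) where
  infixr 8 _^ʳ_

  field
    completeOrderedField : CompleteOrderedField

  open CompleteOrderedField completeOrderedField public

  field
    exp        : Carrier → Carrier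
    exp-series : ∀ x → expPartialSum x ConvergesTo exp x
    log        : Carrier → Carrier
    exp-log    : ∀ x → Positive x → exp (log x) ≈ x

  -- Meaningful for a positive base only.
  _^ʳ_ : Carrier → Carrier → Carrier
  x ^ʳ t = exp (t * log x)

-- Finite graphs, loops allowed.
record Graph (n : ℕ) : Set where
  field
    adj     : Fin n → Fin n → Bool
    adj-sym : ∀ u v → adj u v ≡ adj v u

  Edge : Fin n → Fin n → Set
  Edge u v = T (adj u v)

  -- A loop puts u into its own neighbourhood, hence adds one to its degree.
  neighbourhood : Fin n → Subset n
  neighbourhood u = tabulate (adj u)

  degree : Fin n → ℕ
  degree u = ∣ neighbourhood u ∣

open Graph

Regular : ∀ {n} → Graph n → ℕ → Set
Regular G d = ∀ u → degree G u ≡ d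

HFree : ∀ {n} → ℕ → Graph n → Graph n → Set
HFree {n} s F G =
  ¬ (Σ[ a ∈ (Fin s → Fin n) ] Σ[ b ∈ (Fin s → Fin n) ]
       ((∀ i → Edge F (a i) (b i)) × (∀ i j → i < j → Edge G (a i) (b j))))

Loopless : ∀ {n} → Graph n → Set
Loopless G = ∀ u → ¬ Edge G u u

HasClique : ∀ {N} → ℕ → Graph N → Set
HasClique {N} s G =
  Σ[ f ∈ (Fin s → Fin N) ]
    (Injective _≡_ _≡_ f × (∀ i j → i ≢ j → Edge G (f i) (f j)))

HasIndependentSet : ∀ {N} → ℕ → Graph N → Set
HasIndependentSet {N} k G =
  Σ[ f ∈ (Fin k → Fin N) ]
    (Injective _≡_ _≡_ f × (∀ i j → i ≢ j → ¬ Edge G (f i) (f j)))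

RamseyProperty : ℕ → ℕ → ℕ → Set
RamseyProperty s k N =
  (G : Graph N) → Loopless G → HasClique s G ⊎ HasIndependentSet k G

-- r is r(s,k), the least N with the Ramsey property.
IsRamseyNumber : ℕ → ℕ → ℕ → Set
IsRamseyNumber s k r =
  RamseyProperty s k r × (∀ N → RamseyProperty s k N → r ℕ.≤ N)

module Spectral (𝓡 : RealNumbers) where
  open RealNumbers 𝓡

  Matrix : ℕ → Set
  Matrix n = Fin n → Fin n → Carrier

  adjacencyMatrix : ∀ {n} → Graph n → Matrix n
  adjacencyMatrix G u v = if adj G u v then 1# else 0#

  InEigenspace : ∀ {n} → Matrix n → Carrier → (Fin n → Carrier) → Set
  InEigenspace A μ x = ∀ u → sum (λ v → A u v * x v) ≈ μ * x u

  LinearlyIndependent : ∀ {m n} → (Fin m → Fin n → Carrier) → Set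
  LinearlyIndependent {m} xs =
    (c : Fin m → Carrier) →
    (∀ u → sum (λ i → c i * xs i u) ≈ 0#) → ∀ i → c i ≈ 0#

  -- The eigenspace of μ has dimension at least m.
  MultiplicityAtLeast : ∀ {n} → ℕ → Matrix n → Carrier → Set
  MultiplicityAtLeast {n} m A μ =
    Σ[ xs ∈ (Fin m → Fin n → Carrier) ]
      (LinearlyIndependent xs × (∀ i → InEigenspace A μ (xs i)))

  -- μ remains in the spectrum, counted with multiplicity, once a single copy
  -- of ρ has been removed.
  EigenvalueOtherThan : ∀ {n} → Matrix n → Carrier → Carrier → Set
  EigenvalueOtherThan A ρ μ =
    (¬ (μ ≈ ρ) × MultiplicityAtLeast 1 A μ) ⊎
    (μ ≈ ρ × MultiplicityAtLeast 2 A μ)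

  -- (n,d,λ)-graphs; the largest eigenvalue of a d-regular graph is d.
  record IsNDΛGraph {n : ℕ} (d : ℕ) (λ′ : Carrier) (G : Graph n) : Set where
    field
      regular     : Regular G d
      eigenvalues : ∀ μ → EigenvalueOtherThan (adjacencyMatrix G) (fromℕ d) μ →
                    abs μ ≤ λ′

  η : (dF dG : ℕ) (λF λG : Carrier) → Carrier
  η dF dG λF λG =
    (λG ^ 2 / fromℕ dG ^ 2) ⊔ ((λF * λG) / (fromℕ dF * fromℕ dG))

  w : (n dG : ℕ) → Carrier
  w n dG = (fromℕ 4 * fromℕ n * log (fromℕ n)) / fromℕ dG

{-# OPTIONS --safe #-}
-- Draw r ordered edges (a₁ , b₁), …, (aᵣ , bᵣ) of F independently at random and join i < j when aᵢ bⱼ is an edge of G.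
-- Since (F , G) is H_s-free, the resulting graph on r vertices has no clique of size s.  An independent set of size k is
-- a subsequence of length k each of whose bⱼ lies in the set S of vertices adjacent in G to no earlier aᵢ.  Call the
-- next choice (a , b) sparse if a has at most half of the expected number d(G)|S|/n of G-neighbours in S.  By the
-- expander mixing lemma for G and for F at most a 6η fraction of all edges (a , b) of F are sparse with b in S, while
-- every other choice multiplies |S| by at most 1 - d(G)/2n, so at most about w/2 choices are not sparse.  Hence a fixed
-- k-subset is independent with probability at most (7η)ᵏ η⁻ʷ, and for r below the bound the expected number of
-- independent k-sets is less than one.
--
-- The mixing lemma needs only that the quadratic form of A on vectors of sum zero lies between -λ and λ times the
-- squared norm.  The supremum μ of the Rayleigh quotient exists by completeness, and μ - A is semidefinite but not
-- coercive; elimination by Schur complements shows that such a form has a kernel, so μ is an eigenvalue.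
module Submission where

open import Defs
open import Algebra.Bundles using (CommutativeRing)
import Algebra.Construct.NaturalChoice.Max as Max
import Algebra.Construct.NaturalChoice.MaxOp as MaxOp
import Algebra.Properties.CommutativeSemiring.Exp as SemiringExp
import Algebra.Properties.Ring as RingProperties
import Algebra.Properties.Semiring.Mult as SemiringMult
import Algebra.Properties.Semiring.Sum as SemiringSum
import Algebra.Solver.Ring
open import Algebra.Solver.Ring.AlmostCommutativeRing using (_-Raw-AlmostCommutative⟶_; fromCommutativeRing)
open import Data.Bool using (Bool; true; false; T; if_then_else_; _∧_; _∨_; not)
open import Data.Bool.Properties using (∨-comm; T-∧; T-∨)
open import Data.Empty using (⊥; ⊥-elim)
open import Data.Fin as Fin using (Fin; zero; suc; toℕ; punchIn)
import Data.Fin.Properties as Fin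
open import Data.Fin.Subset using (∣_∣)
open import Data.Fin.Subset.Properties using (∣p∣≤n)
open import Data.Integer as ℤ using (ℤ; +_; -[1+_])
import Data.Integer.Properties as ℤ
open import Data.Maybe using (Maybe; just; nothing)
open import Data.Nat as ℕ using (ℕ; zero; suc; z≤n; s≤s; _∸_; _!)
import Data.Nat.Properties as ℕ
open import Data.Product using (_×_; _,_; proj₁; proj₂; ∃; ∃-syntax)
import Data.Sign as Sign
open import Data.Sum as Sum using (_⊎_; inj₁; inj₂)
open import Data.Unit using (tt)
open import Data.Vec using (Vec; []; _∷_; lookup; tabulate)
open import Data.Vec.Relation.Unary.All as All using (All; []; _∷_)
import Data.Vec.Relation.Unary.All.Properties as All
open import Function using (_∘_; _⟨_⟩_)
open import Function.Bundles using (Equivalence)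
open import Function.Definitions using (Injective)
open import Relation.Binary using (IsDecTotalOrder; Poset)
open import Relation.Binary.PropositionalEquality as ≡ using (_≡_; _≢_)
import Relation.Binary.Reasoning.PartialOrder as PartialOrderReasoning
import Relation.Binary.Reasoning.Setoid as SetoidReasoning
open import Relation.Nullary using (¬_; yes; no; contradiction; does; Dec; ¬?; _×-dec_)
open import Relation.Nullary.Decidable using (dec-true; dec-false)

-- Independent `k`-subsets are never enumerated. With `y` the inverse of `η`, the quantity
-- `N ^ k * (7 * η) ^ k * y ^ t` bounds `k!` times the probability that `k` independent entries
-- occur among `N` draws, as long as at most `t` dense choices remain. Sparse choices have mass at
-- most `6 * η`. A dense one lowers `t`, and since `η * y = 1` it can be charged a flat `η`; hence
-- `7 = 6 + 1`. Then `k ^ k ≤ 4 ^ k * k!` brings in a factor `4`, and `4 * 7 = 28 < 50` gives the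
-- contradiction. On the spectral side the hypothesis speaks of eigenvalues, while the estimates
-- need the form on vectors of sum zero, and the proof does not diagonalise. Maximising over all
-- vectors could find `d` itself; subtracting a multiple of the all-ones matrix removes this
-- competitor. The lower bound on the form is the upper bound for `-A`. Both need a nonzero vector
-- of sum zero, hence two vertices.

-- Ring identities with integer coefficients over an abstract commutative ring.

module IntegerSolver {c ℓ} (R : CommutativeRing c ℓ) where
  open CommutativeRing R
  open RingProperties ring using (-0#≈0#; -‿involutive; -‿distribˡ-*; -‿distribʳ-*; -‿+-comm)
  open SemiringMult semiring using (×-homo-+; ×1-homo-*) renaming (_×_ to _•_)
  open SetoidReasoning setoid

  private
    natural : ℕ → Carrier
    natural n = n • 1#

    -- The case 1 makes the coefficient 1 denote 1# on the nose.
    ⟦_⟧ : ℤ → Carrier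
    ⟦ + 1 ⟧      = 1#
    ⟦ + n ⟧      = natural n
    ⟦ -[1+ n ] ⟧ = - natural (suc n)

    ⟦+⟧ : ∀ n → ⟦ + n ⟧ ≈ natural n
    ⟦+⟧ 0             = refl
    ⟦+⟧ 1             = sym (+-identityʳ 1#)
    ⟦+⟧ (suc (suc n)) = refl

    ⟦-⟧ : ∀ n → ⟦ ℤ.- (+ n) ⟧ ≈ - natural n
    ⟦-⟧ zero    = sym -0#≈0#
    ⟦-⟧ (suc n) = refl

    cancelˡ : ∀ x y z → (x + y) - (x + z) ≈ y - z
    cancelˡ x y z = begin
      (x + y) + - (x + z)     ≈⟨ +-congˡ (-‿+-comm x z) ⟨
      (x + y) + (- x + - z)   ≈⟨ +-congʳ (+-comm x y) ⟩
      (y + x) + (- x + - z)   ≈⟨ +-assoc y x _ ⟩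
      y + (x + (- x + - z))   ≈⟨ +-congˡ (+-assoc x (- x) (- z)) ⟨
      y + (x + - x + - z)     ≈⟨ +-congˡ (+-congʳ (-‿inverseʳ x)) ⟩
      y + (0# + - z)          ≈⟨ +-congˡ (+-identityˡ _) ⟩
      y + - z                 ∎

    ⟦⊖⟧ : ∀ m n → ⟦ m ℤ.⊖ n ⟧ ≈ natural m - natural n
    ⟦⊖⟧ zero zero = sym (-‿inverseʳ 0#)
    ⟦⊖⟧ zero (suc n) = sym (+-identityˡ _)
    ⟦⊖⟧ (suc m) zero = trans (⟦+⟧ (suc m)) (sym (trans (+-congˡ -0#≈0#) (+-identityʳ _)))
    ⟦⊖⟧ (suc m) (suc n) = begin
      ⟦ suc m ℤ.⊖ suc n ⟧                ≡⟨ ≡.cong ⟦_⟧ (ℤ.[1+m]⊖[1+n]≡m⊖n m n) ⟩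
      ⟦ m ℤ.⊖ n ⟧                        ≈⟨ ⟦⊖⟧ m n ⟩
      natural m - natural n              ≈⟨ cancelˡ 1# (natural m) (natural n) ⟨
      natural (suc m) - natural (suc n)  ∎

    +-homo : ∀ i j → ⟦ i ℤ.+ j ⟧ ≈ ⟦ i ⟧ + ⟦ j ⟧
    +-homo (+ m) (+ n) = trans (⟦+⟧ (m ℕ.+ n)) (trans (×-homo-+ 1# m n) (sym (+-cong (⟦+⟧ m) (⟦+⟧ n))))
    +-homo (+ m) -[1+ n ] = trans (⟦⊖⟧ m (suc n)) (sym (+-congʳ (⟦+⟧ m)))
    +-homo -[1+ m ] (+ n) = trans (⟦⊖⟧ n (suc m)) (trans (+-comm _ _) (+-congˡ (sym (⟦+⟧ n))))
    +-homo -[1+ m ] -[1+ n ] = begin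
      - natural (suc (suc (m ℕ.+ n)))        ≡⟨ ≡.cong (λ k → - natural (suc k)) (≡.sym (ℕ.+-suc m n)) ⟩
      - natural (suc m ℕ.+ suc n)            ≈⟨ -‿cong (×-homo-+ 1# (suc m) (suc n)) ⟩
      - (natural (suc m) + natural (suc n))  ≈⟨ -‿+-comm _ _ ⟨
      - natural (suc m) + - natural (suc n)  ∎

    -‿homo : ∀ i → ⟦ ℤ.- i ⟧ ≈ - ⟦ i ⟧
    -‿homo (+ n) = trans (⟦-⟧ n) (-‿cong (sym (⟦+⟧ n)))
    -‿homo -[1+ n ] = trans (⟦+⟧ (suc n)) (sym (-‿involutive _))

    *-homo⁺ : ∀ m n → ⟦ + (m ℕ.* n) ⟧ ≈ natural m * natural n
    *-homo⁺ m n = trans (⟦+⟧ (m ℕ.* n)) (×1-homo-* m n)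

    *-homo : ∀ i j → ⟦ i ℤ.* j ⟧ ≈ ⟦ i ⟧ * ⟦ j ⟧
    *-homo (+ m) (+ n) = begin
      ⟦ Sign.+ ℤ.◃ m ℕ.* n ⟧  ≡⟨ ≡.cong ⟦_⟧ (ℤ.+◃n≡+n (m ℕ.* n)) ⟩
      ⟦ + (m ℕ.* n) ⟧         ≈⟨ *-homo⁺ m n ⟩
      natural m * natural n   ≈⟨ *-cong (⟦+⟧ m) (⟦+⟧ n) ⟨
      ⟦ + m ⟧ * ⟦ + n ⟧       ∎
    *-homo (+ m) -[1+ n ] = begin
      ⟦ Sign.- ℤ.◃ m ℕ.* suc n ⟧     ≡⟨ ≡.cong ⟦_⟧ (ℤ.-◃n≡-n (m ℕ.* suc n)) ⟩
      ⟦ ℤ.- (+ (m ℕ.* suc n)) ⟧      ≈⟨ ⟦-⟧ (m ℕ.* suc n) ⟩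
      - natural (m ℕ.* suc n)        ≈⟨ -‿cong (×1-homo-* m (suc n)) ⟩
      - (natural m * natural (suc n)) ≈⟨ -‿distribʳ-* _ _ ⟩
      natural m * - natural (suc n)  ≈⟨ *-congʳ (⟦+⟧ m) ⟨
      ⟦ + m ⟧ * - natural (suc n)    ∎
    *-homo -[1+ m ] (+ n) = begin
      ⟦ Sign.- ℤ.◃ suc m ℕ.* n ⟧     ≡⟨ ≡.cong ⟦_⟧ (ℤ.-◃n≡-n (suc m ℕ.* n)) ⟩
      ⟦ ℤ.- (+ (suc m ℕ.* n)) ⟧      ≈⟨ ⟦-⟧ (suc m ℕ.* n) ⟩
      - natural (suc m ℕ.* n)        ≈⟨ -‿cong (×1-homo-* (suc m) n) ⟩
      - (natural (suc m) * natural n) ≈⟨ -‿distribˡ-* _ _ ⟩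
      - natural (suc m) * natural n  ≈⟨ *-congˡ (⟦+⟧ n) ⟨
      - natural (suc m) * ⟦ + n ⟧    ∎
    *-homo -[1+ m ] -[1+ n ] = begin
      ⟦ + (suc m ℕ.* suc n) ⟧                   ≈⟨ *-homo⁺ (suc m) (suc n) ⟩
      natural (suc m) * natural (suc n)         ≈⟨ -‿involutive _ ⟨
      - - (natural (suc m) * natural (suc n))   ≈⟨ -‿cong (-‿distribˡ-* _ _) ⟩
      - (- natural (suc m) * natural (suc n))   ≈⟨ -‿distribʳ-* _ _ ⟩
      - natural (suc m) * - natural (suc n)     ∎

    morphism : ℤ.+-*-rawRing -Raw-AlmostCommutative⟶ fromCommutativeRing R
    morphism = record
      { ⟦_⟧ = ⟦_⟧ ; +-homo = +-homo ; *-homo = *-homo ; -‿homo = -‿homo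
      ; 0-homo = refl ; 1-homo = refl }

    -- A semi-decision is enough: distinct integers may have equal images in `R`, so nothing is
    -- claimed for them.
    decide : ∀ i j → Maybe (⟦ i ⟧ ≈ ⟦ j ⟧)
    decide i j with i ℤ.≟ j
    ... | yes i≡j = just (reflexive (≡.cong ⟦_⟧ i≡j))
    ... | no  _   = nothing

  open Algebra.Solver.Ring ℤ.+-*-rawRing (fromCommutativeRing R) morphism decide public
    using (solve; _:=_; _:+_; _:*_; _:-_; :-_; con)

-- Order, inverses, natural numbers, powers and finite sums in an ordered field.

module OrderedField (K : CompleteOrderedField) where
  open CompleteOrderedField K hiding (zero)
  open IntegerSolver commutativeRing public

  open IsDecTotalOrder isDecTotalOrder public
    using (_≟_; _≤?_; isPartialOrder)
    renaming (refl to ≤-refl; reflexive to ≤-reflexive; trans to ≤-trans;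
              antisym to ≤-antisym; total to ≤-total;
              ≤-respˡ-≈ to ≤-respˡ; ≤-respʳ-≈ to ≤-respʳ)

  poset : Poset _ _ _
  poset = record { isPartialOrder = isPartialOrder }

  module ≤-Reasoning = PartialOrderReasoning poset

  open SemiringExp commutativeSemiring public using (^-distrib-*; ^-congˡ; ^-congʳ)
  private module Sums = SemiringSum semiring
  open MaxOp (Max.maxOperator totalOrder) public
    using (x≤x⊔y; x≤y⊔x; ⊔-lub)

  infix 4 _<_

  -- With this encoding `0# < x` unfolds to `Positive x`, so positivity proofs can be handed
  -- directly to `exp-log` and to statements about limits.
  _<_ : Carrier → Carrier → Set
  x < y = ¬ (y ≤ x)

  <⇒≤ : ∀ {x y} → x < y → x ≤ y
  <⇒≤ {x} {y} x<y with ≤-total x y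
  ... | inj₁ x≤y = x≤y
  ... | inj₂ y≤x = contradiction y≤x x<y

  <-≤-trans : ∀ {x y z} → x < y → y ≤ z → x < z
  <-≤-trans x<y y≤z z≤x = x<y (≤-trans y≤z z≤x)

  ≤-<-trans : ∀ {x y z} → x ≤ y → y < z → x < z
  ≤-<-trans x≤y y<z z≤x = y<z (≤-trans z≤x x≤y)

  x≤y⇒0≤y-x : ∀ {x y} → x ≤ y → 0# ≤ y - x
  x≤y⇒0≤y-x {x} {y} x≤y =
    ≤-respˡ (-‿inverseˡ x) (≤-respʳ (+-comm (- x) y) (+-monoʳ-≤ (- x) x≤y))

  -- An inequality x ≤ y is certified by writing y - x as a visibly nonnegative expression.
  ≤-certificate : ∀ {x y e} → 0# ≤ e → y - x ≈ e → x ≤ y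
  ≤-certificate {x} {y} 0≤e y-x≈e =
    ≤-respˡ (+-identityʳ x)
      (≤-respʳ (solve 2 (λ x y → x :+ (y :- x) := y) refl x y)
        (+-monoʳ-≤ x (≤-respʳ (sym y-x≈e) 0≤e)))

  +-nonNegative : ∀ {x y} → 0# ≤ x → 0# ≤ y → 0# ≤ x + y
  +-nonNegative {x} 0≤x 0≤y = ≤-trans 0≤x (≤-respˡ (+-identityʳ x) (+-monoʳ-≤ x 0≤y))

  +-mono-≤ : ∀ {x y u v} → x ≤ y → u ≤ v → x + u ≤ y + v
  +-mono-≤ {x} {y} {u} {v} x≤y u≤v =
    ≤-certificate (+-nonNegative (x≤y⇒0≤y-x x≤y) (x≤y⇒0≤y-x u≤v))
      (solve 4 (λ x y u v → (y :+ v) :- (x :+ u) := (y :- x) :+ (v :- u)) refl x y u v)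

  neg-mono-≤ : ∀ {x y} → x ≤ y → - y ≤ - x
  neg-mono-≤ {x} {y} x≤y =
    ≤-certificate (x≤y⇒0≤y-x x≤y) (solve 2 (λ x y → (:- x) :- (:- y) := y :- x) refl x y)

  x≤0⇒0≤-x : ∀ {x} → x ≤ 0# → 0# ≤ - x
  x≤0⇒0≤-x {x} x≤0 = ≤-respʳ (+-identityˡ (- x)) (x≤y⇒0≤y-x x≤0)

  x*x-nonNegative : ∀ x → 0# ≤ x * x
  x*x-nonNegative x with ≤-total 0# x
  ... | inj₁ 0≤x = *-nonNegative 0≤x 0≤x
  ... | inj₂ x≤0 =
    ≤-respʳ (solve 1 (λ x → (:- x) :* (:- x) := x :* x) refl x)
      (*-nonNegative (x≤0⇒0≤-x x≤0) (x≤0⇒0≤-x x≤0))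

  *-monoˡ-≤ : ∀ {x y} z → 0# ≤ z → x ≤ y → z * x ≤ z * y
  *-monoˡ-≤ {x} {y} z 0≤z x≤y =
    ≤-certificate (*-nonNegative 0≤z (x≤y⇒0≤y-x x≤y))
      (solve 3 (λ x y z → z :* y :- z :* x := z :* (y :- x)) refl x y z)

  *-monoʳ-≤ : ∀ {x y} z → 0# ≤ z → x ≤ y → x * z ≤ y * z
  *-monoʳ-≤ {x} {y} z 0≤z x≤y = ≤-respˡ (*-comm z x) (≤-respʳ (*-comm z y) (*-monoˡ-≤ z 0≤z x≤y))

  *-mono-≤ : ∀ {x y u v} → 0# ≤ x → x ≤ y → 0# ≤ u → u ≤ v → x * u ≤ y * v
  *-mono-≤ {x} {y} {u} {v} 0≤x x≤y 0≤u u≤v =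
    ≤-trans (*-monoˡ-≤ x 0≤x u≤v) (*-monoʳ-≤ v (≤-trans 0≤u u≤v) x≤y)

  0≤1 : 0# ≤ 1#
  0≤1 = ≤-respʳ (*-identityʳ 1#) (x*x-nonNegative 1#)

  0<1 : 0# < 1#
  0<1 1≤0 = 1≉0 (≤-antisym 1≤0 0≤1)

  0<x⇒x≉0 : ∀ {x} → 0# < x → ¬ (x ≈ 0#)
  0<x⇒x≉0 0<x x≈0 = 0<x (≤-reflexive x≈0)

  0≤x∧x≉0⇒0<x : ∀ {x} → 0# ≤ x → ¬ (x ≈ 0#) → 0# < x
  0≤x∧x≉0⇒0<x 0≤x x≉0 x≤0 = x≉0 (≤-antisym x≤0 0≤x)

  +-positive : ∀ {x y} → 0# < x → 0# ≤ y → 0# < x + y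
  +-positive {x} {y} 0<x 0≤y = <-≤-trans 0<x (≤-respˡ (+-identityʳ x) (+-monoʳ-≤ x 0≤y))

  ⁻¹-inverseˡ : ∀ {x} → ¬ (x ≈ 0#) → x ⁻¹ * x ≈ 1#
  ⁻¹-inverseˡ x≉0 = trans (*-comm _ _) (⁻¹-inverseʳ x≉0)

  ⁻¹-nonNegative : ∀ {x} → 0# < x → 0# ≤ x ⁻¹
  ⁻¹-nonNegative {x} 0<x with ≤-total 0# (x ⁻¹)
  ... | inj₁ 0≤x⁻¹ = 0≤x⁻¹
  ... | inj₂ x⁻¹≤0 =
    contradiction
      (≤-respˡ (⁻¹-inverseʳ (0<x⇒x≉0 0<x)) (≤-respʳ (zeroʳ x) (*-monoˡ-≤ x (<⇒≤ 0<x) x⁻¹≤0))) 0<1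

  *-cancelˡ-≤ : ∀ {x y} z → 0# < z → z * x ≤ z * y → x ≤ y
  *-cancelˡ-≤ {x} {y} z 0<z zx≤zy =
    ≤-respˡ (cancel x) (≤-respʳ (cancel y) (*-monoˡ-≤ (z ⁻¹) (⁻¹-nonNegative 0<z) zx≤zy))
    where
    cancel : ∀ x → z ⁻¹ * (z * x) ≈ x
    cancel x = trans (sym (*-assoc _ _ _))
      (trans (*-congʳ (⁻¹-inverseˡ (0<x⇒x≉0 0<z))) (*-identityˡ x))

  *-positive : ∀ {x y} → 0# < x → 0# < y → 0# < x * y
  *-positive {x} {y} 0<x 0<y xy≤0 = 0<y (*-cancelˡ-≤ x 0<x (≤-respʳ (sym (zeroʳ x)) xy≤0))

  *-cancelˡ-≈0 : ∀ {x y} → ¬ (x ≈ 0#) → x * y ≈ 0# → y ≈ 0#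
  *-cancelˡ-≈0 {x} {y} x≉0 xy≈0 = begin-equality
    y               ≈⟨ *-identityˡ y ⟨
    1# * y          ≈⟨ *-congʳ (⁻¹-inverseˡ x≉0) ⟨
    x ⁻¹ * x * y    ≈⟨ *-assoc _ _ _ ⟩
    x ⁻¹ * (x * y)  ≈⟨ *-congˡ xy≈0 ⟩
    x ⁻¹ * 0#       ≈⟨ zeroʳ _ ⟩
    0#              ∎
    where open ≤-Reasoning

  ⁻¹-positive : ∀ {x} → 0# < x → 0# < x ⁻¹
  ⁻¹-positive {x} 0<x = 0≤x∧x≉0⇒0<x (⁻¹-nonNegative 0<x)
    (λ x⁻¹≈0 → 1≉0 (trans (sym (⁻¹-inverseʳ (0<x⇒x≉0 0<x))) (trans (*-congˡ x⁻¹≈0) (zeroʳ x))))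

  x/y*y≈x : ∀ x {y} → ¬ (y ≈ 0#) → x / y * y ≈ x
  x/y*y≈x x y≉0 = trans (*-assoc _ _ _) (trans (*-congˡ (⁻¹-inverseˡ y≉0)) (*-identityʳ x))

  x≤z*y⇒x/y≤z : ∀ {x y z} → 0# < y → x ≤ z * y → x / y ≤ z
  x≤z*y⇒x/y≤z {x} {y} {z} 0<y x≤zy =
    *-cancelˡ-≤ y 0<y (≤-respˡ (sym (trans (*-comm _ _) (x/y*y≈x x (0<x⇒x≉0 0<y)))) (≤-respʳ (*-comm z y) x≤zy))

  z*y≤x⇒z≤x/y : ∀ {x y z} → 0# < y → z * y ≤ x → z ≤ x / y
  z*y≤x⇒z≤x/y {x} {y} {z} 0<y zy≤x =
    *-cancelˡ-≤ y 0<y (≤-respʳ (sym (trans (*-comm _ _) (x/y*y≈x x (0<x⇒x≉0 0<y)))) (≤-respˡ (*-comm z y) zy≤x))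

  x/y≤z⇒x≤z*y : ∀ {x y z} → 0# < y → x / y ≤ z → x ≤ z * y
  x/y≤z⇒x≤z*y {x} {y} 0<y x/y≤z = ≤-respˡ (x/y*y≈x x (0<x⇒x≉0 0<y)) (*-monoʳ-≤ y (<⇒≤ 0<y) x/y≤z)

  private module FromNat = SemiringMult semiring

  fromℕ-+ : ∀ m n → fromℕ (m ℕ.+ n) ≈ fromℕ m + fromℕ n
  fromℕ-+ = FromNat.×-homo-+ 1#

  fromℕ-* : ∀ m n → fromℕ (m ℕ.* n) ≈ fromℕ m * fromℕ n
  fromℕ-* = FromNat.×1-homo-*

  fromℕ-^ : ∀ m n → fromℕ (m ℕ.^ n) ≈ fromℕ m ^ n
  fromℕ-^ m zero    = +-identityʳ 1#
  fromℕ-^ m (suc n) = trans (fromℕ-* m (m ℕ.^ n)) (*-congˡ (fromℕ-^ m n))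

  fromℕ-nonNegative : ∀ n → 0# ≤ fromℕ n
  fromℕ-nonNegative zero    = ≤-refl
  fromℕ-nonNegative (suc n) = +-nonNegative 0≤1 (fromℕ-nonNegative n)

  fromℕ-suc-positive : ∀ n → 0# < fromℕ (suc n)
  fromℕ-suc-positive n = +-positive 0<1 (fromℕ-nonNegative n)

  fromℕ-positive : ∀ {n} → 1 ℕ.≤ n → 0# < fromℕ n
  fromℕ-positive {suc n} _ = fromℕ-suc-positive n

  fromℕ-mono-≤ : ∀ {m n} → m ℕ.≤ n → fromℕ m ≤ fromℕ n
  fromℕ-mono-≤ {n = n} z≤n = fromℕ-nonNegative n
  fromℕ-mono-≤ (s≤s m≤n) = +-monoʳ-≤ 1# (fromℕ-mono-≤ m≤n)

  fromℕ-cancel-≤ : ∀ {m n} → fromℕ m ≤ fromℕ n → m ℕ.≤ n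
  fromℕ-cancel-≤ {m} {n} m≤n with m ℕ.≤? n
  ... | yes p = p
  ... | no ¬p = contradiction
    (≤-certificate (x≤y⇒0≤y-x (≤-trans (fromℕ-mono-≤ (ℕ.≰⇒> ¬p)) m≤n))
      (solve 1 (λ x → con (+ 0) :- con (+ 1) := x :- (con (+ 1) :+ x)) refl (fromℕ n))) 0<1

  ^-nonNegative : ∀ {x} n → 0# ≤ x → 0# ≤ x ^ n
  ^-nonNegative zero    0≤x = 0≤1
  ^-nonNegative (suc n) 0≤x = *-nonNegative 0≤x (^-nonNegative n 0≤x)

  ^-positive : ∀ {x} n → 0# < x → 0# < x ^ n
  ^-positive zero    0<x = 0<1
  ^-positive (suc n) 0<x = *-positive 0<x (^-positive n 0<x)

  ^-monoˡ-≤ : ∀ {x y} n → 0# ≤ x → x ≤ y → x ^ n ≤ y ^ n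
  ^-monoˡ-≤ zero    0≤x x≤y = ≤-refl
  ^-monoˡ-≤ (suc n) 0≤x x≤y = *-mono-≤ 0≤x x≤y (^-nonNegative n 0≤x) (^-monoˡ-≤ n 0≤x x≤y)

  1^n≈1 : ∀ n → 1# ^ n ≈ 1#
  1^n≈1 zero    = refl
  1^n≈1 (suc n) = trans (*-identityˡ _) (1^n≈1 n)

  opaque
    -- Opaque, so that unification solves for the summand instead of unfolding the sum.
    ∑ : ∀ {n} → (Fin n → Carrier) → Carrier
    ∑ = sum

    ∑≈sum : ∀ {n} (f : Fin n → Carrier) → ∑ f ≈ sum f
    ∑≈sum f = refl

    ∑-zero : (f : Fin 0 → Carrier) → ∑ f ≈ 0#
    ∑-zero f = refl

    ∑-suc : ∀ {n} (f : Fin (suc n) → Carrier) → ∑ f ≈ f zero + ∑ (λ i → f (suc i))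
    ∑-suc f = refl

    ∑-cong : ∀ {n} {f g : Fin n → Carrier} → (∀ i → f i ≈ g i) → ∑ f ≈ ∑ g
    ∑-cong = Sums.sum-cong-≋

    ∑-+ : ∀ {n} (f g : Fin n → Carrier) → ∑ (λ i → f i + g i) ≈ ∑ f + ∑ g
    ∑-+ = Sums.∑-distrib-+

    ∑-*ˡ : ∀ {n} c (f : Fin n → Carrier) → ∑ (λ i → c * f i) ≈ c * ∑ f
    ∑-*ˡ c f = sym (Sums.*-distribˡ-sum c f)

    ∑-*ʳ : ∀ {n} c (f : Fin n → Carrier) → ∑ (λ i → f i * c) ≈ ∑ f * c
    ∑-*ʳ c f = sym (Sums.*-distribʳ-sum c f)

    ∑-comm : ∀ {m n} (f : Fin m → Fin n → Carrier) →
      ∑ (λ i → ∑ (λ j → f i j)) ≈ ∑ (λ j → ∑ (λ i → f i j))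
    ∑-comm = Sums.∑-comm

    ∑-mono-≤ : ∀ {n} {f g : Fin n → Carrier} → (∀ i → f i ≤ g i) → ∑ f ≤ ∑ g
    ∑-mono-≤ {zero}  f≤g = ≤-refl
    ∑-mono-≤ {suc n} f≤g = +-mono-≤ (f≤g zero) (∑-mono-≤ (λ i → f≤g (suc i)))

    ∑-0 : ∀ {n} → ∑ {n} (λ _ → 0#) ≈ 0#
    ∑-0 {n} = Sums.sum-replicate-zero n

  ∑-nonNegative : ∀ {n} {f : Fin n → Carrier} → (∀ i → 0# ≤ f i) → 0# ≤ ∑ f
  ∑-nonNegative 0≤f = ≤-respˡ ∑-0 (∑-mono-≤ 0≤f)

  ∑-≈0 : ∀ {n} {f : Fin n → Carrier} → (∀ i → f i ≈ 0#) → ∑ f ≈ 0#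
  ∑-≈0 f≈0 = trans (∑-cong f≈0) ∑-0

  ∑-const : ∀ n x → ∑ {n} (λ _ → x) ≈ fromℕ n * x
  ∑-const zero    x = trans (∑-zero _) (sym (zeroˡ x))
  ∑-const (suc n) x = trans (∑-suc _) (trans (+-congˡ (∑-const n x))
    (solve 2 (λ x m → x :+ m :* x := (con (+ 1) :+ m) :* x) refl x (fromℕ n)))

  ∑-neg : ∀ {n} (f : Fin n → Carrier) → ∑ (λ i → - f i) ≈ - ∑ f
  ∑-neg f = trans (∑-cong (λ i → solve 1 (λ x → :- x := (:- con (+ 1)) :* x) refl (f i)))
    (trans (∑-*ˡ (- 1#) f) (solve 1 (λ x → (:- con (+ 1)) :* x := :- x) refl (∑ f)))

  x≤abs : ∀ x → x ≤ abs x
  x≤abs x = x≤x⊔y x (- x)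

  -x≤abs : ∀ x → - x ≤ abs x
  -x≤abs x = x≤y⊔x x (- x)

-- Quadratic forms and the alternative between singular and coercive.

module QuadraticForms (K : CompleteOrderedField) where
  open CompleteOrderedField K hiding (zero)
  open OrderedField K
  open ≤-Reasoning

  Vector : ℕ → Set
  Vector n = Fin n → Carrier

  SquareMatrix : ℕ → Set
  SquareMatrix n = Fin n → Fin n → Carrier

  dot : ∀ {n} → Vector n → Vector n → Carrier
  dot x y = ∑ (λ u → x u * y u)

  normSq : ∀ {n} → Vector n → Carrier
  normSq x = dot x x

  apply : ∀ {n} → SquareMatrix n → Vector n → Vector n
  apply A x u = dot (A u) x

  form : ∀ {n} → SquareMatrix n → Vector n → Carrier
  form A x = dot x (apply A x)

  Symmetric : ∀ {n} → SquareMatrix n → Set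
  Symmetric A = ∀ u v → A u v ≈ A v u

  dot-cong : ∀ {n} {x x′ y y′ : Vector n} → (∀ u → x u ≈ x′ u) → (∀ u → y u ≈ y′ u) → dot x y ≈ dot x′ y′
  dot-cong x≈x′ y≈y′ = ∑-cong (λ u → *-cong (x≈x′ u) (y≈y′ u))

  dot-comm : ∀ {n} (x y : Vector n) → dot x y ≈ dot y x
  dot-comm x y = ∑-cong (λ u → *-comm (x u) (y u))

  dot-+ʳ : ∀ {n} (x y z : Vector n) → dot x (λ u → y u + z u) ≈ dot x y + dot x z
  dot-+ʳ x y z = trans (∑-cong (λ u → distribˡ (x u) (y u) (z u))) (∑-+ _ _)

  dot-*ʳ : ∀ {n} (x : Vector n) c (y : Vector n) → dot x (λ u → c * y u) ≈ c * dot x y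
  dot-*ʳ x c y =
    trans (∑-cong (λ u → solve 3 (λ x c y → x :* (c :* y) := c :* (x :* y)) refl (x u) c (y u)))
      (∑-*ˡ c _)

  dot-zeroʳ : ∀ {n} (x : Vector n) → dot x (λ _ → 0#) ≈ 0#
  dot-zeroʳ x = ∑-≈0 (λ u → zeroʳ (x u))

  normSq-nonNegative : ∀ {n} (x : Vector n) → 0# ≤ normSq x
  normSq-nonNegative x = ∑-nonNegative (λ u → x*x-nonNegative (x u))

  normSq-positive : ∀ {n} (x : Vector n) u → ¬ (x u ≈ 0#) → 0# < normSq x
  normSq-positive {suc n} x zero x≉0 =
    +-positive (0≤x∧x≉0⇒0<x (x*x-nonNegative (x zero)) (λ xx≈0 → x≉0 (*-cancelˡ-≈0 x≉0 xx≈0)))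
      (normSq-nonNegative (λ u → x (suc u))) ∘ ≤-respˡ (∑-suc _)
  normSq-positive {suc n} x (suc u) x≉0 =
    <-≤-trans (normSq-positive (λ u → x (suc u)) u x≉0)
      (≤-respʳ (sym (∑-suc _)) (≤-respˡ (+-identityˡ _) (+-mono-≤ (x*x-nonNegative (x zero)) ≤-refl)))

  normSq≈0⇒≈0 : ∀ {n} (x : Vector n) → normSq x ≈ 0# → ∀ u → x u ≈ 0#
  normSq≈0⇒≈0 x N≈0 u with x u ≟ 0#
  ... | yes x≈0 = x≈0
  ... | no  x≉0 = contradiction N≈0 (0<x⇒x≉0 (normSq-positive x u x≉0))

  cons : ∀ {n} → Carrier → Vector n → Vector (suc n)
  cons x₀ x zero    = x₀
  cons x₀ x (suc u) = x u

  -- A crude substitute for the Cauchy-Schwarz inequality. Only the existence of some constant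
  -- matters, and `(p + q)² ≤ 2 p² + 2 q²` supplies one by induction on the dimension.
  functional-bounded : ∀ {n} (b : Vector n) →
    ∃[ L ] (0# ≤ L × (∀ x → dot b x * dot b x ≤ L * normSq x))
  functional-bounded {zero} b = 0# , ≤-refl , λ x → ≤-reflexive (trans (*-congʳ (∑-zero _)) (trans (zeroˡ _) (sym (zeroˡ _))))
  functional-bounded {suc n} b = L , 0≤L , bound
    where
    rec = functional-bounded (λ u → b (suc u))
    L′ = proj₁ rec
    0≤L′ = proj₁ (proj₂ rec)
    b₀ = b zero
    L = fromℕ 2 * (b₀ * b₀) + fromℕ 2 * L′
    0≤L = +-nonNegative (*-nonNegative (fromℕ-nonNegative 2) (x*x-nonNegative b₀))
                        (*-nonNegative (fromℕ-nonNegative 2) 0≤L′)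
    bound : ∀ x → dot b x * dot b x ≤ L * normSq x
    bound x = ≤-respˡ (sym (*-cong (∑-suc _) (∑-suc _))) (≤-respʳ (*-congˡ (sym (∑-suc _))) (≤-certificate
      (+-nonNegative (x*x-nonNegative (b₀ * x₀ - d))
        (+-nonNegative (*-nonNegative (fromℕ-nonNegative 2) (x≤y⇒0≤y-x (proj₂ (proj₂ rec) x′)))
          (+-nonNegative (*-nonNegative (*-nonNegative (fromℕ-nonNegative 2) (x*x-nonNegative b₀)) (normSq-nonNegative x′))
            (*-nonNegative (*-nonNegative (fromℕ-nonNegative 2) 0≤L′) (x*x-nonNegative x₀)))))
      (solve 5 (λ b x d L N →
         (con (+ 2) :* (b :* b) :+ con (+ 2) :* L) :* (x :* x :+ N) :- (b :* x :+ d) :* (b :* x :+ d)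
         := (b :* x :- d) :* (b :* x :- d) :+ (con (+ 2) :* (L :* N :- d :* d) :+
              (con (+ 2) :* (b :* b) :* N :+ con (+ 2) :* L :* (x :* x))))
        refl b₀ x₀ d L′ (normSq x′))))
      where
      x₀ = x zero
      x′ = λ u → x (suc u)
      d = dot (λ u → b (suc u)) x′

  -- Provides the upper bound for Rayleigh quotients that completeness asks for.
  form-bounded : ∀ {n} (A : SquareMatrix n) → ∃[ C ] (∀ x → form A x ≤ C * normSq x)
  form-bounded A = 1# + ∑ L , bound
    where
    L = λ u → proj₁ (functional-bounded (A u))
    bound : ∀ x → form A x ≤ (1# + ∑ L) * normSq x
    bound x = begin
      ∑ (λ u → x u * apply A x u)
        ≤⟨ ∑-mono-≤ (λ u → ≤-trans (product≤ (x u) (apply A x u)) (+-mono-≤ ≤-refl (proj₂ (proj₂ (functional-bounded (A u))) x))) ⟩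
      ∑ (λ u → x u * x u + L u * normSq x)         ≈⟨ ∑-+ _ _ ⟩
      normSq x + ∑ (λ u → L u * normSq x)          ≈⟨ +-congˡ (∑-*ʳ (normSq x) L) ⟩
      normSq x + ∑ L * normSq x
        ≈⟨ solve 2 (λ N L → N :+ L :* N := (con (+ 1) :+ L) :* N) refl (normSq x) (∑ L) ⟩
      (1# + ∑ L) * normSq x                        ∎
      where
      product≤ : ∀ x y → x * y ≤ x * x + y * y
      product≤ x y = *-cancelˡ-≤ (fromℕ 2) (fromℕ-suc-positive 1) (≤-certificate
        (+-nonNegative (x*x-nonNegative (x - y)) (+-nonNegative (x*x-nonNegative x) (x*x-nonNegative y)))
        (solve 2 (λ x y → con (+ 2) :* (x :* x :+ y :* y) :- con (+ 2) :* (x :* y) :=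
           (x :- y) :* (x :- y) :+ (x :* x :+ y :* y)) refl x y))

  form-cons : ∀ {n} (Q : SquareMatrix (suc n)) → Symmetric Q → ∀ x₀ (x : Vector n) →
    form Q (cons x₀ x) ≈
      Q zero zero * (x₀ * x₀) + fromℕ 2 * (x₀ * dot (λ v → Q zero (suc v)) x) + form (λ u v → Q (suc u) (suc v)) x
  form-cons Q sym-Q x₀ x = begin-equality
    form Q (cons x₀ x)
      ≈⟨ ∑-suc _ ⟩
    x₀ * apply Q (cons x₀ x) zero + dot x (λ u → apply Q (cons x₀ x) (suc u))
      ≈⟨ +-cong (*-congˡ (∑-suc _)) (dot-cong (λ _ → refl) (λ u → ∑-suc _)) ⟩
    x₀ * (a * x₀ + β) + dot x (λ u → Q (suc u) zero * x₀ + apply Q′ x u)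
      ≈⟨ +-congˡ (dot-+ʳ x _ _) ⟩
    x₀ * (a * x₀ + β) + (dot x (λ u → Q (suc u) zero * x₀) + form Q′ x)
      ≈⟨ +-congˡ (+-congʳ (dot-cong (λ _ → refl) (λ u → trans (*-comm _ _) (*-congˡ (sym-Q (suc u) zero))))) ⟩
    x₀ * (a * x₀ + β) + (dot x (λ u → x₀ * b u) + form Q′ x)
      ≈⟨ +-congˡ (+-congʳ (trans (dot-*ʳ x x₀ b) (*-congˡ (dot-comm x b)))) ⟩
    x₀ * (a * x₀ + β) + (x₀ * β + form Q′ x)
      ≈⟨ solve 4 (λ x a β f → x :* (a :* x :+ β) :+ (x :* β :+ f) :=
          a :* (x :* x) :+ con (+ 2) :* (x :* β) :+ f) refl x₀ a β (form Q′ x) ⟩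
    a * (x₀ * x₀) + fromℕ 2 * (x₀ * β) + form Q′ x  ∎
    where
    a = Q zero zero
    b = λ v → Q zero (suc v)
    β = dot b x
    Q′ = λ u v → Q (suc u) (suc v)

  PositiveSemidefinite : ∀ {n} → SquareMatrix n → Set
  PositiveSemidefinite Q = ∀ x → 0# ≤ form Q x

  Singular : ∀ {n} → SquareMatrix n → Set
  Singular Q = ∃[ x ] ((∃[ u ] ¬ (x u ≈ 0#)) × (∀ u → apply Q x u ≈ 0#))

  -- The uniform version of positive definiteness. Compactness of the unit sphere would deduce it
  -- from strict positivity; here elimination produces the constant.
  Coercive : ∀ {n} → SquareMatrix n → Set
  Coercive Q = ∃[ c ] (0# < c × (∀ x → normSq x ≤ c * form Q x))

  form-cong : ∀ {n} (Q : SquareMatrix n) {x y : Vector n} → (∀ u → x u ≈ y u) → form Q x ≈ form Q y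
  form-cong Q x≈y = dot-cong x≈y (λ u → dot-cong (λ _ → refl) x≈y)

  -- Schur complement of the corner entry; its form is the minimum of the original one over the first coordinate.
  schur : ∀ {n} → SquareMatrix (suc n) → SquareMatrix n
  schur Q u v = Q (suc u) (suc v) - Q zero zero ⁻¹ * Q zero (suc u) * Q zero (suc v)

  apply-schur : ∀ {n} (Q : SquareMatrix (suc n)) x u →
    apply (schur Q) x u ≈
      apply (λ u v → Q (suc u) (suc v)) x u - Q zero zero ⁻¹ * dot (λ v → Q zero (suc v)) x * Q zero (suc u)
  apply-schur Q x u = begin-equality
    dot (schur Q u) x
      ≈⟨ ∑-cong (λ v → solve 5 (λ q i b c x → (q :- i :* b :* c) :* x :=
          q :* x :+ (:- (i :* b)) :* (c :* x)) refl (Q (suc u) (suc v)) i (b u) (b v) (x v)) ⟩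
    ∑ (λ v → Q (suc u) (suc v) * x v + - (i * b u) * (b v * x v))
                                          ≈⟨ ∑-+ _ _ ⟩
    apply Q′ x u + ∑ (λ v → - (i * b u) * (b v * x v)) ≈⟨ +-congˡ (∑-*ˡ _ _) ⟩
    apply Q′ x u + - (i * b u) * dot b x
      ≈⟨ solve 4 (λ f i b d → f :+ (:- (i :* b)) :* d := f :- i :* d :* b) refl (apply Q′ x u) i (b u) (dot b x) ⟩
    apply Q′ x u - i * dot b x * b u      ∎
    where
    i = Q zero zero ⁻¹
    b = λ v → Q zero (suc v)
    Q′ = λ u v → Q (suc u) (suc v)

  form-schur : ∀ {n} (Q : SquareMatrix (suc n)) x →
    form (schur Q) x ≈
      form (λ u v → Q (suc u) (suc v)) x - Q zero zero ⁻¹ * (dot (λ v → Q zero (suc v)) x * dot (λ v → Q zero (suc v)) x)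
  form-schur Q x = begin-equality
    dot x (apply (schur Q) x)                       ≈⟨ dot-cong (λ _ → refl) (apply-schur Q x) ⟩
    dot x (λ u → apply Q′ x u - i * β * b u)
      ≈⟨ dot-cong {x = x} (λ _ → refl) (λ u → +-congˡ (solve 3 (λ i β b → :- (i :* β :* b) :=
          (:- (i :* β)) :* b) refl i β (b u))) ⟩
    dot x (λ u → apply Q′ x u + - (i * β) * b u)    ≈⟨ trans (dot-+ʳ x _ _) (+-congˡ (dot-*ʳ x _ b)) ⟩
    form Q′ x + - (i * β) * dot x b                 ≈⟨ +-congˡ (*-congˡ (dot-comm x b)) ⟩
    form Q′ x + - (i * β) * β
      ≈⟨ solve 3 (λ f i β → f :+ (:- (i :* β)) :* β := f :- i :* (β :* β)) refl (form Q′ x) i β ⟩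
    form Q′ x - i * (β * β)                         ∎
    where
    i = Q zero zero ⁻¹
    b = λ v → Q zero (suc v)
    β = dot b x
    Q′ = λ u v → Q (suc u) (suc v)

  -- Completing the square in the first coordinate.
  form-cons-schur : ∀ {n} (Q : SquareMatrix (suc n)) → Symmetric Q → ¬ (Q zero zero ≈ 0#) → ∀ x₀ (x : Vector n) →
    let y = x₀ + Q zero zero ⁻¹ * dot (λ v → Q zero (suc v)) x in
    form Q (cons x₀ x) ≈ Q zero zero * (y * y) + form (schur Q) x
  form-cons-schur Q sym-Q a≉0 x₀ x = begin-equality
    form Q (cons x₀ x)                                              ≈⟨ form-cons Q sym-Q x₀ x ⟩
    a * (x₀ * x₀) + fromℕ 2 * (x₀ * β) + f
      ≈⟨ +-congʳ (+-congˡ (trans (sym (*-identityˡ _)) (*-congʳ (sym a*i≈1)))) ⟩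
    a * (x₀ * x₀) + a * i * (fromℕ 2 * (x₀ * β)) + f
      ≈⟨ solve 5 (λ a i x β f → a :* (x :* x) :+ a :* i :* (con (+ 2) :* (x :* β)) :+ f :=
                                                                          a :* ((x :+ i :* β) :* (x :+ i :* β)) :+ (f :- a :* i :* (i :* (β :* β)))) refl a i x₀ β f ⟩
    a * ((x₀ + i * β) * (x₀ + i * β)) + (f - a * i * (i * (β * β)))
      ≈⟨ +-congˡ (+-congˡ (-‿cong (trans (*-congʳ a*i≈1) (*-identityˡ _)))) ⟩
    a * ((x₀ + i * β) * (x₀ + i * β)) + (f - i * (β * β))           ≈⟨ +-congˡ (form-schur Q x) ⟨
    a * ((x₀ + i * β) * (x₀ + i * β)) + form (schur Q) x            ∎
    where
    a = Q zero zero
    i = a ⁻¹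
    β = dot (λ v → Q zero (suc v)) x
    f = form (λ u v → Q (suc u) (suc v)) x
    a*i≈1 = ⁻¹-inverseʳ a≉0

  cons-η : ∀ {n} (x : Vector (suc n)) u → x u ≈ cons (x zero) (λ u → x (suc u)) u
  cons-η x zero    = refl
  cons-η x (suc u) = refl

  module _ {n : ℕ} (Q : SquareMatrix (suc n)) (sym-Q : Symmetric Q) where

    -- On the vector `cons t b`, with `b` the rest of the first row, the form is affine in `t` with
    -- slope `2 * normSq b`. Being nonnegative for all `t` it has slope zero, so `b` vanishes and
    -- the first basis vector lies in the kernel.
    zero-corner⇒singular : PositiveSemidefinite Q → Q zero zero ≈ 0# → Singular Q
    zero-corner⇒singular psd a≈0 = cons 1# (λ _ → 0#) , (zero , 1≉0) , kernel
      where
      a = Q zero zero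
      b = λ v → Q zero (suc v)
      f = form (λ u v → Q (suc u) (suc v)) b
      B = normSq b
      0≤2tB+f : ∀ t → 0# ≤ fromℕ 2 * (t * B) + f
      0≤2tB+f t = ≤-respʳ (begin-equality
        form Q (cons t b)                           ≈⟨ form-cons Q sym-Q t b ⟩
        a * (t * t) + fromℕ 2 * (t * B) + f         ≈⟨ +-congʳ (+-congʳ (trans (*-congʳ a≈0) (zeroˡ _))) ⟩
        0# + fromℕ 2 * (t * B) + f                  ≈⟨ +-congʳ (+-identityˡ _) ⟩
        fromℕ 2 * (t * B) + f                       ∎) (psd (cons t b))
      0≤f : 0# ≤ f
      0≤f = ≤-respʳ (solve 2 (λ B f → con (+ 2) :* (con (+ 0) :* B) :+ f := f) refl B f) (0≤2tB+f 0#)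
      B≤0 : ¬ (0# < B)
      -- The choice `t = - (f + 1) / B` brings the form down to `- f - 2`; adding the nonnegative
      -- `f + 1` leaves `-1`.
      B≤0 0<B = 0<1 (≤-certificate (+-nonNegative (0≤2tB+f (- (f + 1#) * B ⁻¹)) (+-nonNegative 0≤f 0≤1)) (begin-equality
        0# - 1#
          ≈⟨ solve 1 (λ f → con (+ 0) :- con (+ 1) :=
              con (+ 2) :* ((:- (f :+ con (+ 1))) :* con (+ 1)) :+ f :+ (f :+ con (+ 1))) refl f ⟩
        fromℕ 2 * (- (f + 1#) * 1#) + f + (f + 1#)
          ≈⟨ +-congʳ (+-congʳ (*-congˡ (trans (*-congˡ (sym (⁻¹-inverseˡ (0<x⇒x≉0 0<B)))) (sym (*-assoc _ _ _))))) ⟩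
        fromℕ 2 * (- (f + 1#) * B ⁻¹ * B) + f + (f + 1#) ∎))
      b≈0 : ∀ v → b v ≈ 0#
      b≈0 with B ≟ 0#
      ... | yes B≈0 = normSq≈0⇒≈0 b B≈0
      ... | no  B≉0 = contradiction (0≤x∧x≉0⇒0<x (normSq-nonNegative b) B≉0) B≤0
      column : ∀ u → Q u zero ≈ 0#
      column zero    = a≈0
      column (suc u) = trans (sym-Q (suc u) zero) (b≈0 u)
      kernel : ∀ u → apply Q (cons 1# (λ _ → 0#)) u ≈ 0#
      kernel u = trans (∑-suc _) (trans (+-cong (trans (*-identityʳ _) (column u)) (dot-zeroʳ (λ v → Q u (suc v)))) (+-identityˡ 0#))

    schur-symmetric : Symmetric (schur Q)
    schur-symmetric u v = +-cong (sym-Q (suc u) (suc v)) (-‿cong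
      (solve 3 (λ i b c → i :* b :* c := i :* c :* b) refl (Q zero zero ⁻¹) (Q zero (suc u)) (Q zero (suc v))))

    -- The first coordinate is chosen so that the completed square vanishes.
    schur-semidefinite : PositiveSemidefinite Q → ¬ (Q zero zero ≈ 0#) → PositiveSemidefinite (schur Q)
    schur-semidefinite psd a≉0 x = ≤-respʳ (trans (form-cons-schur Q sym-Q a≉0 _ x)
      (solve 3 (λ a y s → a :* ((:- y :+ y) :* (:- y :+ y)) :+ s := s) refl (Q zero zero)
        (Q zero zero ⁻¹ * dot (λ v → Q zero (suc v)) x) (form (schur Q) x)))
      (psd (cons (- (Q zero zero ⁻¹ * dot (λ v → Q zero (suc v)) x)) x))

    -- Back substitution: the first row of the system determines the missing coordinate `- (i * β)`.
    schur-singular : ¬ (Q zero zero ≈ 0#) → Singular (schur Q) → Singular Q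
    schur-singular a≉0 (x , (u , x≉0) , kernel) = cons (- (i * β)) x , (suc u , x≉0) , kernel′
      where
      i = Q zero zero ⁻¹
      β = dot (λ v → Q zero (suc v)) x
      kernel′ : ∀ u → apply Q (cons (- (i * β)) x) u ≈ 0#
      kernel′ zero = begin-equality
        apply Q (cons (- (i * β)) x) zero  ≈⟨ ∑-suc _ ⟩
        Q zero zero * - (i * β) + β
          ≈⟨ solve 3 (λ a i β → a :* (:- (i :* β)) :+ β := (con (+ 1) :- a :* i) :* β) refl (Q zero zero) i β ⟩
        (1# - Q zero zero * i) * β         ≈⟨ *-congʳ (+-congˡ (-‿cong (⁻¹-inverseʳ a≉0))) ⟩
        (1# - 1#) * β                      ≈⟨ solve 1 (λ β → (con (+ 1) :- con (+ 1)) :* β := con (+ 0)) refl β ⟩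
        0#                                 ∎
      kernel′ (suc u) = begin-equality
        apply Q (cons (- (i * β)) x) (suc u) ≈⟨ ∑-suc _ ⟩
        Q (suc u) zero * - (i * β) + f     ≈⟨ +-congʳ (*-congʳ (sym-Q (suc u) zero)) ⟩
        Q zero (suc u) * - (i * β) + f
          ≈⟨ solve 3 (λ b y f → b :* (:- y) :+ f := f :- y :* b) refl (Q zero (suc u)) (i * β) f ⟩
        f - i * β * Q zero (suc u)         ≈⟨ apply-schur Q x u ⟨
        apply (schur Q) x u                ≈⟨ kernel u ⟩
        0#                                 ∎
        where f = apply (λ u v → Q (suc u) (suc v)) x u

    -- Write `x₀ = y - z`, where `y` is the base of the completed square and `z = i * β` depends on
    -- the other coordinates only. Then `x₀² ≤ 2 y² + 2 z²`; the form controls `y²` through `a`, and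
    -- `z²` is at most a multiple of `N`, which the Schur complement controls.
    schur-coercive : PositiveSemidefinite Q → ¬ (Q zero zero ≈ 0#) → Coercive (schur Q) → Coercive Q
    schur-coercive psd a≉0 (c , 0<c , coercive) = C , 0<C , bound
      where
      a = Q zero zero
      i = a ⁻¹
      b = λ v → Q zero (suc v)
      0<a : 0# < a
      0<a = 0≤x∧x≉0⇒0<x (≤-respʳ (begin-equality
        form Q (cons 1# (λ _ → 0#))
          ≈⟨ form-cons Q sym-Q 1# (λ _ → 0#) ⟩
        a * (1# * 1#) + fromℕ 2 * (1# * dot b (λ _ → 0#)) + dot (λ _ → 0#) (apply (λ u v → Q (suc u) (suc v)) (λ _ → 0#))
          ≈⟨ +-cong (+-congˡ (*-congˡ (*-congˡ (dot-zeroʳ b)))) (∑-≈0 {n} (λ u → zeroˡ _)) ⟩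
        a * (1# * 1#) + fromℕ 2 * (1# * 0#) + 0#
          ≈⟨ solve 1 (λ a → a :* (con (+ 1) :* con (+ 1)) :+ con (+ 2) :* (con (+ 1) :* con (+ 0)) :+ con (+ 0) := a) refl a ⟩
        a ∎) (psd (cons 1# (λ _ → 0#)))) a≉0
      L = proj₁ (functional-bounded b)
      0≤L = proj₁ (proj₂ (functional-bounded b))
      0≤i = ⁻¹-nonNegative 0<a
      E = 1# + fromℕ 2 * (i * i * L)
      D = E * c
      C = fromℕ 2 * i + D
      0≤E : 0# ≤ E
      0≤E = +-nonNegative 0≤1 (*-nonNegative (fromℕ-nonNegative 2) (*-nonNegative (*-nonNegative 0≤i 0≤i) 0≤L))
      0≤D : 0# ≤ D
      0≤D = *-nonNegative 0≤E (<⇒≤ 0<c)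
      0<C : 0# < C
      0<C = +-positive (*-positive (fromℕ-suc-positive 1) (⁻¹-positive 0<a)) 0≤D
      bound : ∀ x → normSq x ≤ C * form Q x
      bound x = begin
        normSq x
          ≈⟨ ∑-suc _ ⟩
        x₀ * x₀ + N
          ≤⟨ +-mono-≤ (≤-certificate (x*x-nonNegative (x₀ + fromℕ 2 * z))
               (solve 2 (λ x z → con (+ 2) :* ((x :+ z) :* (x :+ z)) :+ con (+ 2) :* (z :* z) :- x :* x :=
                  (x :+ con (+ 2) :* z) :* (x :+ con (+ 2) :* z)) refl x₀ z)) ≤-refl ⟩
        fromℕ 2 * (y * y) + fromℕ 2 * (z * z) + N
          ≈⟨ +-congʳ (+-congˡ (*-congˡ (solve 2 (λ i β → i :* β :* (i :* β) := i :* i :* (β :* β)) refl i β))) ⟩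
        fromℕ 2 * (y * y) + fromℕ 2 * (i * i * (β * β)) + N
          ≤⟨ +-mono-≤ (+-mono-≤ ≤-refl (*-monoˡ-≤ _ (fromℕ-nonNegative 2) (*-monoˡ-≤ _ (*-nonNegative 0≤i 0≤i) (proj₂ (proj₂ (functional-bounded b)) x′)))) ≤-refl ⟩
        fromℕ 2 * (y * y) + fromℕ 2 * (i * i * (L * N)) + N
          ≈⟨ solve 4 (λ q j L N → con (+ 2) :* q :+ con (+ 2) :* (j :* (L :* N)) :+ N :=
              con (+ 2) :* q :+ (con (+ 1) :+ con (+ 2) :* (j :* L)) :* N) refl (y * y) (i * i) L N ⟩
        fromℕ 2 * (y * y) + E * N
          ≤⟨ +-mono-≤ ≤-refl (*-monoˡ-≤ E 0≤E (coercive x′)) ⟩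
        fromℕ 2 * (y * y) + E * (c * S)
          ≈⟨ +-cong (*-congʳ (trans (sym (*-identityʳ _)) (*-congˡ (sym (⁻¹-inverseˡ a≉0))))) (sym (*-assoc _ _ _)) ⟩
        fromℕ 2 * (i * a) * (y * y) + D * S
          ≤⟨ ≤-certificate
               (+-nonNegative (*-nonNegative (*-nonNegative (fromℕ-nonNegative 2) 0≤i) 0≤S)
                 (*-nonNegative 0≤D (*-nonNegative (<⇒≤ 0<a) (x*x-nonNegative y))))
               (solve 5 (λ i a q D S → (con (+ 2) :* i :+ D) :* (a :* q :+ S) :- (con (+ 2) :* (i :* a) :* q :+ D :* S) :=
                  con (+ 2) :* i :* S :+ D :* (a :* q)) refl i a (y * y) D S) ⟩
        C * (a * (y * y) + S)
          ≈⟨ *-congˡ (trans (form-cong Q (cons-η x)) (form-cons-schur Q sym-Q a≉0 x₀ x′)) ⟨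
        C * form Q x ∎
        where
        x₀ = x zero
        x′ = λ u → x (suc u)
        N = normSq x′
        S = form (schur Q) x′
        β = dot b x′
        z = i * β
        y = x₀ + z
        0≤S : 0# ≤ S
        0≤S = *-cancelˡ-≤ c 0<c (≤-respˡ (sym (zeroʳ c)) (≤-trans (normSq-nonNegative x′) (coercive x′)))

  -- Elimination stops either at a zero corner, whose kernel vector is carried back up, or in
  -- dimension zero, where coercivity is trivial and its constant is carried back up.
  singular⊎coercive : ∀ {n} (Q : SquareMatrix n) → Symmetric Q → PositiveSemidefinite Q → Singular Q ⊎ Coercive Q
  singular⊎coercive {zero} Q _ _ = inj₂ (1# , 0<1 , λ x → ≤-reflexive (trans (∑-zero _) (sym (trans (*-congˡ (∑-zero _)) (zeroʳ 1#)))))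
  singular⊎coercive {suc n} Q sym-Q psd with Q zero zero ≟ 0#
  ... | yes a≈0 = inj₁ (zero-corner⇒singular Q sym-Q psd a≈0)
  ... | no  a≉0 = Sum.map (schur-singular Q sym-Q a≉0) (schur-coercive Q sym-Q psd a≉0)
    (singular⊎coercive (schur Q) (schur-symmetric Q sym-Q) (schur-semidefinite Q sym-Q psd a≉0))

-- The top eigenvalue of a symmetric matrix, and its restriction to vectors of sum zero.

module RayleighQuotient (K : CompleteOrderedField) where
  open CompleteOrderedField K hiding (zero)
  open OrderedField K
  open QuadraticForms K
  open ≤-Reasoning

  identity : ∀ {n} → SquareMatrix n
  identity zero    zero    = 1#
  identity zero    (suc v) = 0#
  identity (suc u) zero    = 0#
  identity (suc u) (suc v) = identity u v

  identity-symmetric : ∀ {n} → Symmetric (identity {n})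
  identity-symmetric zero    zero    = refl
  identity-symmetric zero    (suc v) = refl
  identity-symmetric (suc u) zero    = refl
  identity-symmetric (suc u) (suc v) = identity-symmetric u v

  apply-identity : ∀ {n} (x : Vector n) u → apply identity x u ≈ x u
  apply-identity {suc n} x zero = trans (∑-suc _)
    (trans (+-cong (*-identityˡ _) (∑-≈0 (λ v → zeroˡ _))) (+-identityʳ _))
  apply-identity {suc n} x (suc u) = trans (∑-suc _)
    (trans (+-cong (zeroˡ _) (apply-identity (λ v → x (suc v)) u)) (+-identityˡ _))

  combine : ∀ {n} → Carrier → SquareMatrix n → Carrier → SquareMatrix n → SquareMatrix n
  combine s A t B u v = s * A u v + t * B u v

  combine-symmetric : ∀ {n} s {A : SquareMatrix n} t {B} → Symmetric A → Symmetric B → Symmetric (combine s A t B)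
  combine-symmetric s t sym-A sym-B u v = +-cong (*-congˡ (sym-A u v)) (*-congˡ (sym-B u v))

  apply-combine : ∀ {n} s (A : SquareMatrix n) t B x u →
    apply (combine s A t B) x u ≈ s * apply A x u + t * apply B x u
  apply-combine s A t B x u = begin-equality
    ∑ (λ v → (s * A u v + t * B u v) * x v)
      ≈⟨ ∑-cong (λ v → solve 5 (λ s a t b x → (s :* a :+ t :* b) :* x :=
          s :* (a :* x) :+ t :* (b :* x)) refl s (A u v) t (B u v) (x v)) ⟩
    ∑ (λ v → s * (A u v * x v) + t * (B u v * x v))        ≈⟨ ∑-+ _ _ ⟩
    ∑ (λ v → s * (A u v * x v)) + ∑ (λ v → t * (B u v * x v)) ≈⟨ +-cong (∑-*ˡ s _) (∑-*ˡ t _) ⟩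
    s * apply A x u + t * apply B x u                      ∎

  form-combine : ∀ {n} s (A : SquareMatrix n) t B x →
    form (combine s A t B) x ≈ s * form A x + t * form B x
  form-combine s A t B x = begin-equality
    dot x (apply (combine s A t B) x)                         ≈⟨ dot-cong (λ _ → refl) (apply-combine s A t B x) ⟩
    dot x (λ u → s * apply A x u + t * apply B x u)           ≈⟨ dot-+ʳ x _ _ ⟩
    dot x (λ u → s * apply A x u) + dot x (λ u → t * apply B x u) ≈⟨ +-cong (dot-*ʳ x s _) (dot-*ʳ x t _) ⟩
    s * form A x + t * form B x                               ∎

  NonZeroVector : ∀ {n} → Vector n → Set
  NonZeroVector x = ∃[ u ] ¬ (x u ≈ 0#)

  Eigenvector : ∀ {n} → SquareMatrix n → Carrier → Vector n → Set
  Eigenvector A μ x = NonZeroVector x × (∀ u → apply A x u ≈ μ * x u)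

  rayleigh-supremum : ∀ {n} (A : SquareMatrix (suc n)) →
    ∃[ μ ] ((∀ y → form A y ≤ μ * normSq y) × (∀ v → (∀ y → form A y ≤ v * normSq y) → μ ≤ v))
  rayleigh-supremum {n} A = fromSupremum
    (complete P (_ , ratio∈P (cons 1# (λ _ → 0#)) (normSq-positive _ zero 1≉0))
      (proj₁ (form-bounded A) , bounded (proj₂ (form-bounded A))))
    where
    -- Everything below some Rayleigh quotient. The upper bounds are those of the quotients
    -- themselves, and membership is stated without division.
    P : Carrier → Set
    P t = ∃[ x ] (0# < normSq x × t * normSq x ≤ form A x)

    ratio∈P : ∀ x → 0# < normSq x → P (form A x / normSq x)
    ratio∈P x 0<N = x , 0<N , ≤-reflexive (x/y*y≈x _ (0<x⇒x≉0 0<N))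

    bounded : ∀ {v} → (∀ y → form A y ≤ v * normSq y) → UpperBound P v
    bounded form≤ t (x , 0<N , tN≤) = *-cancelˡ-≤ (normSq x) 0<N
      (≤-respˡ (*-comm _ _) (≤-respʳ (*-comm _ _) (≤-trans tN≤ (form≤ x))))

    dominates : ∀ {μ} → UpperBound P μ → ∀ y → form A y ≤ μ * normSq y
    dominates {μ} upper y with normSq y ≤? 0#
    ... | no  0<N = x/y≤z⇒x≤z*y 0<N (upper _ (ratio∈P y 0<N))
    -- A vector of norm zero has no quotient; there the bound `C * 0` equals `μ * 0`.
    ... | yes N≤0 = ≤-trans (proj₂ (form-bounded A) y)
      (≤-reflexive (trans (*-congˡ N≈0) (trans (zeroʳ _) (sym (trans (*-congˡ N≈0) (zeroʳ μ))))))
      where N≈0 = ≤-antisym N≤0 (normSq-nonNegative y)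

    fromSupremum : ∃[ μ ] (UpperBound P μ × (∀ v → UpperBound P v → μ ≤ v)) →
      ∃[ μ ] ((∀ y → form A y ≤ μ * normSq y) × (∀ v → (∀ y → form A y ≤ v * normSq y) → μ ≤ v))
    fromSupremum (μ , upper , least) = μ , dominates upper , λ v form≤ → least v (bounded form≤)

  module _ {n : ℕ} (A : SquareMatrix n) (μ : Carrier) where

    characteristic : SquareMatrix n
    characteristic = combine μ identity (- 1#) A

    apply-characteristic : ∀ x u → apply characteristic x u ≈ μ * x u - apply A x u
    apply-characteristic x u = trans (apply-combine μ identity (- 1#) A x u)
      (+-cong (*-congˡ (apply-identity x u)) (solve 1 (λ f → (:- con (+ 1)) :* f := :- f) refl (apply A x u)))

    form-characteristic : ∀ x → form characteristic x ≈ μ * normSq x - form A x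
    form-characteristic x = trans (form-combine μ identity (- 1#) A x)
      (+-cong (*-congˡ (dot-cong (λ _ → refl) (apply-identity x))) (solve 1 (λ f → (:- con (+ 1)) :* f := :- f) refl (form A x)))

    -- Coercivity with constant `c` would let `μ` be lowered by `c ⁻¹` and still dominate the form,
    -- against its minimality.
    supremum-not-coercive : (∀ v → (∀ y → form A y ≤ v * normSq y) → μ ≤ v) → ¬ Coercive characteristic
    supremum-not-coercive least (c , 0<c , N≤cQ) = ⁻¹-positive 0<c
      (≤-certificate (x≤y⇒0≤y-x (least (μ - c ⁻¹) smaller)) (solve 2 (λ i μ → con (+ 0) :- i := μ :- i :- μ) refl (c ⁻¹) μ))
      where
      smaller : ∀ x → form A x ≤ (μ - c ⁻¹) * normSq x
      smaller x = begin
        form A x                          ≈⟨ solve 2 (λ f m → f := m :- (m :- f)) refl (form A x) (μ * N) ⟩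
        μ * N - (μ * N - form A x)        ≈⟨ +-congˡ (-‿cong (form-characteristic x)) ⟨
        μ * N - form characteristic x     ≤⟨ +-monoʳ-≤ _ (neg-mono-≤ (x≤z*y⇒x/y≤z 0<c (≤-respʳ (*-comm _ _) (N≤cQ x)))) ⟩
        μ * N - N / c                     ≈⟨ solve 3 (λ μ N i → μ :* N :- N :* i := (μ :- i) :* N) refl μ N (c ⁻¹) ⟩
        (μ - c ⁻¹) * N                    ∎
        where N = normSq x

    singular⇒eigenvector : Singular characteristic → ∃ (Eigenvector A μ)
    singular⇒eigenvector (x , x≉0 , kernel) = x , x≉0 , λ u → begin-equality
      apply A x u                        ≈⟨ solve 2 (λ f m → f := m :- (m :- f)) refl (apply A x u) (μ * x u) ⟩
      μ * x u - (μ * x u - apply A x u)  ≈⟨ +-congˡ (-‿cong (trans (sym (apply-characteristic x u)) (kernel u))) ⟩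
      μ * x u - 0#                       ≈⟨ solve 1 (λ m → m :- con (+ 0) := m) refl (μ * x u) ⟩
      μ * x u                            ∎

  -- The supremum μ of the Rayleigh quotient makes μ - A semidefinite but not coercive, hence singular.
  top-eigenvector : ∀ {n} (A : SquareMatrix (suc n)) → Symmetric A →
    ∃[ μ ] (∃ (Eigenvector A μ) × (∀ y → form A y ≤ μ * normSq y))
  top-eigenvector {n} A sym-A = fromSupremum (rayleigh-supremum A)
    where
    fromSupremum : ∃[ μ ] ((∀ y → form A y ≤ μ * normSq y) × (∀ v → (∀ y → form A y ≤ v * normSq y) → μ ≤ v)) →
      ∃[ μ ] (∃ (Eigenvector A μ) × (∀ y → form A y ≤ μ * normSq y))
    fromSupremum (μ , form≤ , least) = μ ,
      Sum.[ singular⇒eigenvector A μ , (λ coercive → contradiction coercive (supremum-not-coercive A μ least)) ]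
        (singular⊎coercive (characteristic A μ) (combine-symmetric μ (- 1#) identity-symmetric sym-A)
          (λ x → ≤-respʳ (sym (form-characteristic A μ x)) (x≤y⇒0≤y-x (form≤ x)))) ,
      form≤

  ones : ∀ {n} → SquareMatrix n
  ones u v = 1#

  -- Vectors of sum zero do not feel the shift. Two values of `c` occur: `c * n = d + 2` puts the
  -- eigenvalue of the constants at `-2`, and `c * n = d` removes the main term in the mixing lemma.
  shift : ∀ {n} → SquareMatrix n → Carrier → SquareMatrix n
  shift A c = combine 1# A (- c) ones

  apply-shift : ∀ {n} (A : SquareMatrix n) c x u → apply (shift A c) x u ≈ apply A x u - c * ∑ x
  apply-shift A c x u = trans (apply-combine 1# A (- c) ones x u)
    (trans (+-congˡ (*-congˡ (∑-cong (λ v → *-identityˡ (x v)))))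
      (solve 3 (λ f c s → con (+ 1) :* f :+ (:- c) :* s := f :- c :* s) refl (apply A x u) c (∑ x)))

  form-shift : ∀ {n} (A : SquareMatrix n) c x → form (shift A c) x ≈ form A x - c * (∑ x * ∑ x)
  form-shift A c x = begin-equality
    form (shift A c) x                          ≈⟨ form-combine 1# A (- c) ones x ⟩
    1# * form A x + - c * form ones x
      ≈⟨ +-congˡ (*-congˡ (trans (∑-cong (λ u → *-congˡ (∑-cong (λ v → *-identityˡ (x v))))) (∑-*ʳ (∑ x) x))) ⟩
    1# * form A x + - c * (∑ x * ∑ x)
      ≈⟨ solve 3 (λ f c s → con (+ 1) :* f :+ (:- c) :* s := f :- c :* s) refl (form A x) c (∑ x * ∑ x) ⟩
    form A x - c * (∑ x * ∑ x)                  ∎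

  ∑-apply : ∀ {n} (A : SquareMatrix n) → Symmetric A → ∀ {d} → (∀ u → ∑ (A u) ≈ d) → ∀ x → ∑ (apply A x) ≈ d * ∑ x
  ∑-apply A sym-A {d} rows x = begin-equality
    ∑ (λ u → ∑ (λ v → A u v * x v))      ≈⟨ ∑-comm _ ⟩
    ∑ (λ v → ∑ (λ u → A u v * x v))      ≈⟨ ∑-cong (λ v → ∑-*ʳ (x v) (λ u → A u v)) ⟩
    ∑ (λ v → ∑ (λ u → A u v) * x v)      ≈⟨ ∑-cong (λ v → *-congʳ (trans (∑-cong (λ u → sym-A u v)) (rows v))) ⟩
    ∑ (λ v → d * x v)                    ≈⟨ ∑-*ˡ d x ⟩
    d * ∑ x                              ∎

  -- A nonzero test vector of sum zero. It is the reason why at least two vertices are required.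
  e₀-e₁ : ∀ {m} → Vector (suc (suc m))
  e₀-e₁ = cons 1# (cons (- 1#) (λ _ → 0#))

  ∑-e₀-e₁ : ∀ {m} → ∑ (e₀-e₁ {m}) ≈ 0#
  ∑-e₀-e₁ {m} = trans (∑-suc (e₀-e₁ {m})) (trans (+-congˡ (trans (∑-suc (λ u → e₀-e₁ {m} (suc u))) (+-congˡ ∑-0)))
    (solve 0 (con (+ 1) :+ (:- con (+ 1) :+ con (+ 0)) := con (+ 0)) refl))

  normSq-e₀-e₁ : ∀ {m} → normSq (e₀-e₁ {m}) ≈ fromℕ 2
  normSq-e₀-e₁ {m} = trans (∑-suc _) (trans (+-congˡ (trans (∑-suc _) (+-congˡ (∑-≈0 {m} (λ _ → zeroˡ 0#)))))
    (solve 0 (con (+ 1) :* con (+ 1) :+ ((:- con (+ 1)) :* (:- con (+ 1)) :+ con (+ 0)) := con (+ 2)) refl))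

  form-e₀-e₁ : ∀ {m} (A : SquareMatrix (suc (suc m))) → Symmetric A →
    form A e₀-e₁ ≈ A zero zero + A (suc zero) (suc zero) - fromℕ 2 * A zero (suc zero)
  form-e₀-e₁ {m} A sym-A = begin-equality
    form A e₀-e₁
      ≈⟨ form-cons A sym-A 1# (cons (- 1#) O) ⟩
    a * (1# * 1#) + fromℕ 2 * (1# * dot (λ v → A zero (suc v)) (cons (- 1#) O)) + form (λ u v → A (suc u) (suc v)) (cons (- 1#) O)
      ≈⟨ +-cong (+-congˡ (*-congˡ (*-congˡ (trans (∑-suc _) (+-congˡ (dot-zeroʳ (λ v → A zero (suc (suc v)))))))))
                (form-cons (λ u v → A (suc u) (suc v)) (λ u v → sym-A (suc u) (suc v)) (- 1#) O) ⟩
    a * (1# * 1#) + fromℕ 2 * (1# * (b * - 1# + 0#)) + (c * (- 1# * - 1#) + fromℕ 2 * (- 1# * dot (λ v → A (suc zero) (suc (suc v))) O) + form (λ u v → A (suc (suc u)) (suc (suc v))) O)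
      ≈⟨ +-congˡ (+-cong (+-congˡ (*-congˡ (*-congˡ (dot-zeroʳ (λ v → A (suc zero) (suc (suc v))))))) (∑-≈0 {m} (λ u → zeroˡ _))) ⟩
    a * (1# * 1#) + fromℕ 2 * (1# * (b * - 1# + 0#)) + (c * (- 1# * - 1#) + fromℕ 2 * (- 1# * 0#) + 0#)
      ≈⟨ solve 3 (λ a b c → let one = con (+ 1); nil = con (+ 0); two = con (+ 2) in
           a :* (one :* one) :+ two :* (one :* (b :* (:- one) :+ nil)) :+ (c :* ((:- one) :* (:- one)) :+ two :* ((:- one) :* nil) :+ nil)
           := a :+ c :- two :* b) refl a b c ⟩
    a + c - fromℕ 2 * b ∎
    where
    O : Vector m
    O _ = 0#
    a = A zero zero
    b = A zero (suc zero)
    c = A (suc zero) (suc zero)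

  module _ {m : ℕ} (A : SquareMatrix (suc (suc m))) (sym-A : Symmetric A) where
    private
      n : ℕ
      n = suc (suc m)

    form-shift-on-sum-zero : ∀ c z → ∑ z ≈ 0# → form (shift A c) z ≈ form A z
    form-shift-on-sum-zero c z ∑z≈0 = trans (form-shift A c z) (trans (+-congˡ (-‿cong (*-congˡ (*-congʳ ∑z≈0))))
      (solve 3 (λ f c s → f :- c :* (con (+ 0) :* s) := f) refl (form A z) c (∑ z)))

    -- The condition on the entries says that the form is at least `-2` at `e₀-e₁`, whose squared
    -- norm is `2`. It is satisfied by an adjacency matrix and by its negative alike.
    -1≤top : - fromℕ 2 ≤ A zero zero + A (suc zero) (suc zero) - fromℕ 2 * A zero (suc zero) →
      ∀ c μ → (∀ y → form (shift A c) y ≤ μ * normSq y) → - 1# ≤ μ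
    -1≤top entries c μ form≤ = *-cancelˡ-≤ (fromℕ 2) (fromℕ-suc-positive 1) (begin
      fromℕ 2 * - 1#        ≈⟨ solve 0 (con (+ 2) :* (:- con (+ 1)) := :- con (+ 2)) refl ⟩
      - fromℕ 2             ≤⟨ entries ⟩
      A zero zero + A (suc zero) (suc zero) - fromℕ 2 * A zero (suc zero) ≈⟨ form-e₀-e₁ A sym-A ⟨
      form A e₀-e₁            ≈⟨ form-shift-on-sum-zero c e₀-e₁ ∑-e₀-e₁ ⟨
      form (shift A c) e₀-e₁   ≤⟨ form≤ e₀-e₁ ⟩
      μ * normSq e₀-e₁         ≈⟨ trans (*-congˡ normSq-e₀-e₁) (*-comm _ _) ⟩
      fromℕ 2 * μ           ∎)

    -- Sum the eigenvector equation over all coordinates: every column of the shifted matrix sums to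
    -- `d - c * n = -2`. Combined with `-1 ≤ μ`, it forces the sum of the eigenvector to vanish.
    ∑-shift-eigenvector : ∀ {d} → (∀ u → ∑ (A u) ≈ d) → ∀ c → c * fromℕ n ≈ d + fromℕ 2 →
      ∀ μ x → (∀ u → apply (shift A c) x u ≈ μ * x u) → (μ + fromℕ 2) * ∑ x ≈ 0#
    ∑-shift-eigenvector {d} rows c cn≈d+2 μ x eigen = begin-equality
      (μ + fromℕ 2) * ∑ x                                     ≈⟨ distribʳ _ _ _ ⟩
      μ * ∑ x + fromℕ 2 * ∑ x                                 ≈⟨ +-congʳ (∑-*ˡ μ x) ⟨
      ∑ (λ u → μ * x u) + fromℕ 2 * ∑ x                       ≈⟨ +-congʳ (∑-cong eigen) ⟨
      ∑ (apply (shift A c) x) + fromℕ 2 * ∑ x                 ≈⟨ +-congʳ (∑-cong (apply-shift A c x)) ⟩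
      ∑ (λ u → apply A x u - c * ∑ x) + fromℕ 2 * ∑ x
        ≈⟨ +-congʳ (trans (∑-+ _ _) (+-cong (∑-apply A sym-A rows x) (∑-const n _))) ⟩
      d * ∑ x + fromℕ n * - (c * ∑ x) + fromℕ 2 * ∑ x
        ≈⟨ solve 4 (λ d n c s → d :* s :+ n :* (:- (c :* s)) :+ con (+ 2) :* s :=
            (d :+ con (+ 2)) :* s :- (c :* n) :* s) refl d (fromℕ n) c (∑ x) ⟩
      (d + fromℕ 2) * ∑ x - (c * fromℕ n) * ∑ x               ≈⟨ +-congˡ (-‿cong (*-congʳ cn≈d+2)) ⟩
      (d + fromℕ 2) * ∑ x - (d + fromℕ 2) * ∑ x               ≈⟨ -‿inverseʳ _ ⟩
      0#                                                      ∎

    -- Shifting by a multiple of the all-ones matrix moves the eigenvalue of the constant vectors to -2, below the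
    -- Rayleigh quotient of e₀ - e₁; the top eigenvector of the shifted matrix is then orthogonal to the constants.
    form≤-on-sum-zero : ∀ {d} → (∀ u → ∑ (A u) ≈ d) →
      - fromℕ 2 ≤ A zero zero + A (suc zero) (suc zero) - fromℕ 2 * A zero (suc zero) →
      ∀ {λ′} → (∀ μ x → Eigenvector A μ x → ∑ x ≈ 0# → μ ≤ λ′) →
      ∀ y → ∑ y ≈ 0# → form A y ≤ λ′ * normSq y
    form≤-on-sum-zero {d} rows entries {λ′} eigen≤ y ∑y≈0 =
      withShift ((d + fromℕ 2) / fromℕ n) (x/y*y≈x (d + fromℕ 2) n≉0)
      where
      n≉0 : ¬ (fromℕ n ≈ 0#)
      n≉0 = 0<x⇒x≉0 (fromℕ-suc-positive (suc m))

      withShift : ∀ c → c * fromℕ n ≈ d + fromℕ 2 → form A y ≤ λ′ * normSq y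
      withShift c cn≈d+2 = fromTop (top-eigenvector (shift A c) (combine-symmetric 1# (- c) sym-A (λ _ _ → refl)))
        where
        fromTop : ∃[ μ ] (∃ (Eigenvector (shift A c) μ) × (∀ y → form (shift A c) y ≤ μ * normSq y)) → form A y ≤ λ′ * normSq y
        fromTop (μ , (x , x≉0 , eigen) , form≤) =
          ≤-trans (≤-respˡ (form-shift-on-sum-zero c y ∑y≈0) (form≤ y))
            (*-monoʳ-≤ (normSq y) (normSq-nonNegative y) (eigen≤ μ x (x≉0 , eigen-A) ∑x≈0))
          where
          ∑x≈0 : ∑ x ≈ 0#
          ∑x≈0 = *-cancelˡ-≈0 (0<x⇒x≉0 (<-≤-trans 0<1 (≤-certificate (x≤y⇒0≤y-x (-1≤top entries c μ form≤))
            (solve 1 (λ μ → μ :+ con (+ 2) :- con (+ 1) :=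
                μ :- (:- con (+ 1))) refl μ)))) (∑-shift-eigenvector rows c cn≈d+2 μ x eigen)

          eigen-A : ∀ u → apply A x u ≈ μ * x u
          eigen-A u = begin-equality
            apply A x u                ≈⟨ solve 2 (λ f c → f := f :- c :* con (+ 0)) refl (apply A x u) c ⟩
            apply A x u - c * 0#       ≈⟨ +-congˡ (-‿cong (*-congˡ ∑x≈0)) ⟨
            apply A x u - c * ∑ x      ≈⟨ apply-shift A c x u ⟨
            apply (shift A c) x u      ≈⟨ eigen u ⟩
            μ * x u                    ∎

-- The expander mixing lemma for vectors.

module Mixing (K : CompleteOrderedField) where
  open CompleteOrderedField K hiding (zero)
  open OrderedField K
  open QuadraticForms K
  open RayleighQuotient K
  open ≤-Reasoning

  linear : ∀ {n} → Carrier → Vector n → Carrier → Vector n → Vector n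
  linear s x t y u = s * x u + t * y u

  dot-linearʳ : ∀ {n} (z : Vector n) s x t y → dot z (linear s x t y) ≈ s * dot z x + t * dot z y
  dot-linearʳ z s x t y = trans (dot-+ʳ z _ _) (+-cong (dot-*ʳ z s x) (dot-*ʳ z t y))

  dot-linear : ∀ {n} s t (x y z w : Vector n) →
    dot (linear s x t y) (linear s z t w) ≈ s * s * dot x z + s * t * (dot x w + dot y z) + t * t * dot y w
  dot-linear s t x y z w = begin-equality
    dot l (linear s z t w)                                            ≈⟨ dot-linearʳ l s z t w ⟩
    s * dot l z + t * dot l w
      ≈⟨ +-cong (*-congˡ (dot-comm l z)) (*-congˡ (dot-comm l w)) ⟩
    s * dot z l + t * dot w l
      ≈⟨ +-cong (*-congˡ (dot-linearʳ z s x t y)) (*-congˡ (dot-linearʳ w s x t y)) ⟩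
    s * (s * dot z x + t * dot z y) + t * (s * dot w x + t * dot w y)
      ≈⟨ +-cong (*-congˡ (+-cong (*-congˡ (dot-comm z x)) (*-congˡ (dot-comm z y)))) (*-congˡ (+-cong (*-congˡ (dot-comm w x)) (*-congˡ (dot-comm w y)))) ⟩
    s * (s * dot x z + t * dot y z) + t * (s * dot x w + t * dot y w)
      ≈⟨ solve 6 (λ s t a b c d → s :* (s :* a :+ t :* b) :+ t :* (s :* c :+ t :* d) :=
          s :* s :* a :+ s :* t :* (c :+ b) :+ t :* t :* d) refl s t (dot x z) (dot y z) (dot x w) (dot y w) ⟩
    s * s * dot x z + s * t * (dot x w + dot y z) + t * t * dot y w   ∎
    where l = linear s x t y

  apply-linear : ∀ {n} (A : SquareMatrix n) s x t y u → apply A (linear s x t y) u ≈ linear s (apply A x) t (apply A y) u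
  apply-linear A s x t y u = dot-linearʳ (A u) s x t y

  dot-apply-symmetric : ∀ {n} (A : SquareMatrix n) → Symmetric A → ∀ x y → dot x (apply A y) ≈ dot y (apply A x)
  dot-apply-symmetric A sym-A x y = begin-equality
    ∑ (λ u → x u * ∑ (λ v → A u v * y v))    ≈⟨ ∑-cong (λ u → ∑-*ˡ (x u) _) ⟨
    ∑ (λ u → ∑ (λ v → x u * (A u v * y v)))  ≈⟨ ∑-comm _ ⟩
    ∑ (λ v → ∑ (λ u → x u * (A u v * y v)))
      ≈⟨ ∑-cong (λ v → ∑-cong (λ u → trans (*-congˡ (*-congʳ (sym-A u v))) (solve 3 (λ x a y → x :* (a :* y) :=
          y :* (a :* x)) refl (x u) (A v u) (y v)))) ⟩
    ∑ (λ v → ∑ (λ u → y v * (A v u * x u)))  ≈⟨ ∑-cong (λ v → ∑-*ˡ (y v) _) ⟩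
    dot y (apply A x)                        ∎

  form-linear : ∀ {n} (A : SquareMatrix n) → Symmetric A → ∀ s x t y →
    form A (linear s x t y) ≈ s * s * form A x + fromℕ 2 * (s * t * dot x (apply A y)) + t * t * form A y
  form-linear A sym-A s x t y = begin-equality
    dot l (apply A l)                                                ≈⟨ dot-cong (λ _ → refl) (apply-linear A s x t y) ⟩
    dot l (linear s (apply A x) t (apply A y))                       ≈⟨ dot-linear s t x y (apply A x) (apply A y) ⟩
    s * s * form A x + s * t * (p + dot y (apply A x)) + t * t * form A y
      ≈⟨ +-congʳ (+-congˡ (*-congˡ (+-congˡ (dot-apply-symmetric A sym-A y x)))) ⟩
    s * s * form A x + s * t * (p + p) + t * t * form A y
      ≈⟨ +-congʳ (+-congˡ (solve 2 (λ a p → a :* (p :+ p) := con (+ 2) :* (a :* p)) refl (s * t) p)) ⟩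
    s * s * form A x + fromℕ 2 * (s * t * p) + t * t * form A y      ∎
    where
    l = linear s x t y
    p = dot x (apply A y)

  normSq-linear : ∀ {n} s (x : Vector n) t y →
    normSq (linear s x t y) ≈ s * s * normSq x + fromℕ 2 * (s * t * dot x y) + t * t * normSq y
  normSq-linear s x t y = trans (dot-linear s t x y x y)
    (+-congʳ (+-congˡ (trans (*-congˡ (+-congˡ (dot-comm y x))) (solve 2 (λ a p → a :* (p :+ p) :=
        con (+ 2) :* (a :* p)) refl (s * t) (dot x y)))))

  -- The choice s = p, t = λX in the hypothesis replaces the usual optimisation, which would need a square root.
  discriminant : ∀ {λ′ X Y p} → 0# ≤ λ′ → 0# ≤ X → 0# ≤ Y →
    (∀ s t → fromℕ 2 * (s * t * p) ≤ λ′ * (s * s * X + t * t * Y)) → p * p ≤ λ′ * λ′ * (X * Y)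
  discriminant {λ′} {X} {Y} {p} 0≤λ 0≤X 0≤Y bound with λ′ * X ≤? 0#
  ... | no 0<λX = *-cancelˡ-≤ (λ′ * X) 0<λX (≤-certificate (x≤y⇒0≤y-x (bound p (λ′ * X)))
      (solve 4 (λ l X Y p → l :* X :* (l :* l :* (X :* Y)) :- l :* X :* (p :* p) :=
         l :* (p :* p :* X :+ l :* X :* (l :* X) :* Y) :- con (+ 2) :* (p :* (l :* X) :* p)) refl λ′ X Y p))
  ... | yes λX≤0 with p ≟ 0#
  ...   | yes p≈0 = ≤-trans (≤-reflexive (trans (*-congʳ p≈0) (zeroˡ p)))
                      (*-nonNegative (*-nonNegative 0≤λ 0≤λ) (*-nonNegative 0≤X 0≤Y))
  -- When `λ′ * X` vanishes, the left side is linear in `s` and the right side does not depend on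
  -- it; `s = (λ′ * Y + 1) / p` and `t = 1` violate the bound.
  ...   | no  p≉0 = contradiction
    (begin
      1#
        ≈⟨ solve 1 (λ y → con (+ 1) := (y :+ con (+ 1)) :* con (+ 1) :- y) refl (λ′ * Y) ⟩
      (λ′ * Y + 1#) * 1# - λ′ * Y
        ≤⟨ ≤-certificate (+-nonNegative (+-nonNegative (*-nonNegative 0≤λ 0≤Y) 0≤1) (x≤y⇒0≤y-x (bound ((λ′ * Y + 1#) * p ⁻¹) 1#)))
           (trans (+-congˡ (-‿cong (+-congʳ (*-congˡ (sym (⁻¹-inverseˡ p≉0))))))
             (solve 5 (λ l X Y p i → let one = con (+ 1); z = l :* Y :+ one; s = z :* i in
                l :* X :* (s :* s) :- (z :* (i :* p) :- l :* Y)
                := z :* (i :* p) :+ (l :* (s :* s :* X :+ one :* one :* Y) :- con (+ 2) :* (s :* one :* p))) refl λ′ X Y p (p ⁻¹))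
           ⟨ trans ⟩ +-congʳ (trans (*-congˡ (⁻¹-inverseˡ p≉0)) (*-identityʳ _))) ⟩
      λ′ * X * (((λ′ * Y + 1#) * p ⁻¹) * ((λ′ * Y + 1#) * p ⁻¹))
        ≈⟨ trans (*-congʳ (≤-antisym λX≤0 (*-nonNegative 0≤λ 0≤X))) (zeroˡ _) ⟩
      0#                                            ∎) 0<1

  module _ {n : ℕ} (B : SquareMatrix n) (sym-B : Symmetric B) {λ′ : Carrier} (0≤λ : 0# ≤ λ′)
           (form≤ : ∀ z → form B z ≤ λ′ * normSq z) (-form≤ : ∀ z → - form B z ≤ λ′ * normSq z) where

    -- Polarisation: the forms at `s x + t y` and `s x - t y` differ by `4 s t p`, and the
    -- parallelogram law adds up the two norms.
    polarised : ∀ x y s t → fromℕ 2 * (s * t * dot x (apply B y)) ≤ λ′ * (s * s * normSq x + t * t * normSq y)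
    polarised x y s t = *-cancelˡ-≤ (fromℕ 2) (fromℕ-suc-positive 1) (begin
      fromℕ 2 * (fromℕ 2 * (s * t * p))
        ≈⟨ solve 5 (λ s t p f g → con (+ 2) :* (con (+ 2) :* (s :* t :* p)) :=
             (s :* s :* f :+ con (+ 2) :* (s :* t :* p) :+ t :* t :* g) :-
             (s :* s :* f :+ con (+ 2) :* (s :* (:- t) :* p) :+ (:- t) :* (:- t) :* g)) refl s t p (form B x) (form B y) ⟩
      (s * s * form B x + fromℕ 2 * (s * t * p) + t * t * form B y) - (s * s * form B x + fromℕ 2 * (s * - t * p) + - t * - t * form B y)
        ≈⟨ +-cong (form-linear B sym-B s x t y) (-‿cong (form-linear B sym-B s x (- t) y)) ⟨
      form B (linear s x t y) - form B (linear s x (- t) y)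
        ≤⟨ +-mono-≤ (form≤ _) (-form≤ _) ⟩
      λ′ * normSq (linear s x t y) + λ′ * normSq (linear s x (- t) y)
        ≈⟨ +-cong (*-congˡ (normSq-linear s x t y)) (*-congˡ (normSq-linear s x (- t) y)) ⟩
      λ′ * (s * s * X + fromℕ 2 * (s * t * q) + t * t * Y) + λ′ * (s * s * X + fromℕ 2 * (s * - t * q) + - t * - t * Y)
        ≈⟨ solve 6 (λ l s t q X Y → l :* (s :* s :* X :+ con (+ 2) :* (s :* t :* q) :+ t :* t :* Y) :+
             l :* (s :* s :* X :+ con (+ 2) :* (s :* (:- t) :* q) :+ (:- t) :* (:- t) :* Y) :=
             con (+ 2) :* (l :* (s :* s :* X :+ t :* t :* Y))) refl λ′ s t q X Y ⟩
      fromℕ 2 * (λ′ * (s * s * X + t * t * Y)) ∎)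
      where
      p = dot x (apply B y)
      q = dot x y
      X = normSq x
      Y = normSq y

    bilinear≤ : ∀ x y → dot x (apply B y) * dot x (apply B y) ≤ λ′ * λ′ * (normSq x * normSq y)
    bilinear≤ x y = discriminant 0≤λ (normSq-nonNegative x) (normSq-nonNegative y) (polarised x y)

  module _ {n : ℕ} (A : SquareMatrix n) (sym-A : Symmetric A) {d : Carrier} (rows : ∀ u → ∑ (A u) ≈ d) {c : Carrier} (cn≈d : c * fromℕ n ≈ d)
           {i : Carrier} (in≈1 : i * fromℕ n ≈ 1#) (0≤i : 0# ≤ i) where

    private
      centre : Vector n → Vector n
      centre x u = x u - i * ∑ x

      nm≈∑ : ∀ (x : Vector n) → fromℕ n * (i * ∑ x) ≈ ∑ x
      nm≈∑ x = trans (sym (*-assoc _ _ _)) (trans (*-congʳ (trans (*-comm _ _) in≈1)) (*-identityˡ _))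

      ∑-minus-const : ∀ (x : Vector n) m → ∑ (λ u → x u - m) ≈ ∑ x - fromℕ n * m
      ∑-minus-const x m = trans (∑-+ _ _) (+-congˡ (trans (∑-const n (- m)) (solve 2 (λ n m → n :* (:- m) :=
          :- (n :* m)) refl (fromℕ n) m)))

      ∑-centre : ∀ x → ∑ (centre x) ≈ 0#
      ∑-centre x = trans (∑-minus-const x _) (trans (+-congˡ (-‿cong (nm≈∑ x))) (-‿inverseʳ _))

      dot-minus-constˡ : ∀ (x : Vector n) m y → dot (λ u → x u - m) y ≈ dot x y - m * ∑ y
      dot-minus-constˡ x m y = trans (∑-cong (λ u → solve 3 (λ x m y → (x :- m) :* y :=
          x :* y :+ (:- m) :* y) refl (x u) m (y u)))
        (trans (∑-+ _ _) (+-congˡ (trans (∑-*ˡ (- m) y) (solve 2 (λ m s → (:- m) :* s := :- (m :* s)) refl m (∑ y)))))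

      normSq-centre : ∀ x → normSq (centre x) ≤ normSq x
      normSq-centre x = ≤-certificate (*-nonNegative 0≤i (x*x-nonNegative (∑ x))) (begin-equality
        normSq x - normSq (centre x)                               ≈⟨ +-congˡ (-‿cong (dot-minus-constˡ x _ (centre x))) ⟩
        normSq x - (dot x (centre x) - i * ∑ x * ∑ (centre x))
          ≈⟨ +-congˡ (-‿cong (+-cong (trans (dot-comm x _) (dot-minus-constˡ x _ x)) (-‿cong (*-congˡ (∑-centre x))))) ⟩
        normSq x - (normSq x - i * ∑ x * ∑ x - i * ∑ x * 0#)
          ≈⟨ solve 3 (λ N i s → N :- (N :- i :* s :* s :- i :* s :* con (+ 0)) := i :* (s :* s)) refl (normSq x) i (∑ x) ⟩
        i * (∑ x * ∑ x)                                            ∎)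

      -- Equal row sums make `A` commute with the projection onto sum zero, so projecting the vector
      -- amounts to subtracting `c = d / n` times the all-ones matrix.
      form-centre : ∀ x → form A (centre x) ≈ form (shift A c) x
      form-centre x = begin-equality
        dot (centre x) (apply A (centre x))
          ≈⟨ dot-minus-constˡ x _ _ ⟩
        dot x (apply A (centre x)) - i * ∑ x * ∑ (apply A (centre x))
          ≈⟨ +-cong (dot-apply-symmetric A sym-A x (centre x)) (-‿cong (*-congˡ (trans (∑-apply A sym-A rows (centre x)) (*-congˡ (∑-centre x))))) ⟩
        dot (centre x) (apply A x) - i * ∑ x * (d * 0#)
          ≈⟨ +-congʳ (trans (dot-minus-constˡ x _ _) (+-congˡ (-‿cong (*-congˡ (trans (∑-apply A sym-A rows x) (*-congʳ (sym cn≈d))))))) ⟩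
        form A x - i * ∑ x * (c * fromℕ n * ∑ x) - i * ∑ x * (d * 0#)
          ≈⟨ solve 6 (λ f i s c n d → f :- i :* s :* (c :* n :* s) :- i :* s :* (d :* con (+ 0)) :=
              f :- i :* n :* (c :* (s :* s))) refl (form A x) i (∑ x) c (fromℕ n) d ⟩
        form A x - i * fromℕ n * (c * (∑ x * ∑ x))
          ≈⟨ +-congˡ (-‿cong (trans (*-congʳ in≈1) (*-identityˡ _))) ⟩
        form A x - c * (∑ x * ∑ x)
          ≈⟨ form-shift A c x ⟨
        form (shift A c) x ∎

    -- The form bounds are known on sum zero only. By `form-centre` they extend to all vectors for
    -- the shifted matrix, since projecting does not increase the norm; the discriminant inequality
    -- then gives the squared estimate.
    mixing : ∀ {λ′} → 0# ≤ λ′ → (∀ y → ∑ y ≈ 0# → form A y ≤ λ′ * normSq y) → (∀ y → ∑ y ≈ 0# → - form A y ≤ λ′ * normSq y) →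
      ∀ x y → let p = dot x (apply A y) - c * (∑ x * ∑ y) in p * p ≤ λ′ * λ′ * (normSq x * normSq y)
    mixing {λ′} 0≤λ form≤ -form≤ x y = ≤-respˡ (*-cong p≈ p≈) (bilinear≤ (shift A c) (combine-symmetric 1# (- c) sym-A (λ _ _ → refl)) 0≤λ
      (λ z → ≤-trans (≤-respˡ (form-centre z) (form≤ (centre z) (∑-centre z))) (*-monoˡ-≤ λ′ 0≤λ (normSq-centre z)))
      (λ z → ≤-trans (≤-respˡ (-‿cong (form-centre z)) (-form≤ (centre z) (∑-centre z))) (*-monoˡ-≤ λ′ 0≤λ (normSq-centre z))) x y)
      where
      p≈ : dot x (apply (shift A c) y) ≈ dot x (apply A y) - c * (∑ x * ∑ y)
      p≈ = begin-equality
        dot x (apply (shift A c) y)                  ≈⟨ dot-cong (λ _ → refl) (apply-shift A c y) ⟩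
        dot x (λ u → apply A y u - c * ∑ y)          ≈⟨ dot-comm x _ ⟩
        dot (λ u → apply A y u - c * ∑ y) x          ≈⟨ dot-minus-constˡ (apply A y) (c * ∑ y) x ⟩
        dot (apply A y) x - c * ∑ y * ∑ x
          ≈⟨ +-cong (dot-comm _ x) (-‿cong (solve 3 (λ c t s → c :* t :* s := c :* (s :* t)) refl c (∑ y) (∑ x))) ⟩
        dot x (apply A y) - c * (∑ x * ∑ y)          ∎

-- Partial sums of the exponential series, and limits.

module Series (K : CompleteOrderedField) where
  open CompleteOrderedField K hiding (zero)
  open OrderedField K
  open ≤-Reasoning

  -- Grows at the end, whereas `sum` recurses at the front; appending the next term of a series is
  -- then definitional.
  partial : (ℕ → Carrier) → ℕ → Carrier
  partial f zero    = 0#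
  partial f (suc m) = partial f m + f m

  partial-cong : ∀ {f g} m → (∀ i → i ℕ.< m → f i ≈ g i) → partial f m ≈ partial g m
  partial-cong zero    f≈g = refl
  partial-cong (suc m) f≈g = +-cong (partial-cong m (λ i i<m → f≈g i (ℕ.m<n⇒m<1+n i<m))) (f≈g m ℕ.≤-refl)

  partial-mono-≤ : ∀ {f g} m → (∀ i → i ℕ.< m → f i ≤ g i) → partial f m ≤ partial g m
  partial-mono-≤ zero    f≤g = ≤-refl
  partial-mono-≤ (suc m) f≤g = +-mono-≤ (partial-mono-≤ m (λ i i<m → f≤g i (ℕ.m<n⇒m<1+n i<m))) (f≤g m ℕ.≤-refl)

  partial-suc : ∀ f m → partial f (suc m) ≈ f 0 + partial (f ∘ suc) m
  partial-suc f zero    = +-comm _ _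
  partial-suc f (suc m) = trans (+-congʳ (partial-suc f m)) (+-assoc _ _ _)

  partial-+ : ∀ f g m → partial (λ i → f i + g i) m ≈ partial f m + partial g m
  partial-+ f g zero    = sym (+-identityˡ 0#)
  partial-+ f g (suc m) = trans (+-congʳ (partial-+ f g m))
    (solve 4 (λ F G f g → F :+ G :+ (f :+ g) := F :+ f :+ (G :+ g)) refl (partial f m) (partial g m) (f m) (g m))

  partial-*ˡ : ∀ c f m → partial (λ i → c * f i) m ≈ c * partial f m
  partial-*ˡ c f zero    = sym (zeroʳ c)
  partial-*ˡ c f (suc m) = trans (+-congʳ (partial-*ˡ c f m)) (sym (distribˡ c _ _))

  partial-*ʳ : ∀ c f m → partial (λ i → f i * c) m ≈ partial f m * c
  partial-*ʳ c f m = trans (partial-cong m (λ i _ → *-comm _ _)) (trans (partial-*ˡ c f m) (*-comm _ _))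

  partial-nonNegative : ∀ {f} m → (∀ i → 0# ≤ f i) → 0# ≤ partial f m
  partial-nonNegative zero    0≤f = ≤-refl
  partial-nonNegative (suc m) 0≤f = +-nonNegative (partial-nonNegative m 0≤f) (0≤f m)

  partial-monoʳ-≤ : ∀ {f m n} → (∀ i → 0# ≤ f i) → m ℕ.≤ n → partial f m ≤ partial f n
  partial-monoʳ-≤ {f} {m} {n} 0≤f m≤n = grow (ℕ.≤⇒≤′ m≤n)
    where
    grow : ∀ {n} → m ℕ.≤′ n → partial f m ≤ partial f n
    grow (ℕ.≤′-reflexive ≡.refl) = ≤-refl
    grow {suc n} (ℕ.≤′-step m≤′n) = ≤-trans (grow m≤′n) (≤-respˡ (+-identityʳ _) (+-monoʳ-≤ _ (0≤f n)))

  sum≈partial : ∀ f m → sum {m} (λ i → f (toℕ i)) ≈ partial f m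
  sum≈partial f zero    = refl
  sum≈partial f (suc m) = trans (+-congˡ (sum≈partial (f ∘ suc) m)) (sym (partial-suc f m))

  infix 4 _◁_

  -- The statement `|x| ≤ X` as two inequalities, a relation that is compatible with sums and
  -- products.
  _◁_ : Carrier → Carrier → Set
  x ◁ X = - X ≤ x × x ≤ X

  ◁-abs : ∀ x → x ◁ abs x
  ◁-abs x = ≤-respʳ (solve 1 (λ x → :- (:- x) := x) refl x) (neg-mono-≤ (-x≤abs x)) , x≤abs x

  abs≤⇒◁ : ∀ {x X} → abs x ≤ X → x ◁ X
  abs≤⇒◁ {x} x≤X = ≤-trans (neg-mono-≤ x≤X) (proj₁ (◁-abs x)) , ≤-trans (x≤abs x) x≤X

  ◁-respˡ : ∀ {x y X} → x ≈ y → x ◁ X → y ◁ X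
  ◁-respˡ x≈y (lo , hi) = ≤-respʳ x≈y lo , ≤-respˡ x≈y hi

  ◁-trans-≤ : ∀ {x X Y} → x ◁ X → X ≤ Y → x ◁ Y
  ◁-trans-≤ (lo , hi) X≤Y = ≤-trans (neg-mono-≤ X≤Y) lo , ≤-trans hi X≤Y

  ◁-neg : ∀ {x X} → x ◁ X → - x ◁ X
  ◁-neg {x} {X} (lo , hi) = neg-mono-≤ hi , ≤-respʳ (solve 1 (λ x → :- (:- x) := x) refl X) (neg-mono-≤ lo)

  ◁-+ : ∀ {x y X Y} → x ◁ X → y ◁ Y → x + y ◁ X + Y
  ◁-+ {X = X} {Y} (lo , hi) (lo′ , hi′) =
    ≤-respˡ (solve 2 (λ x y → :- x :+ (:- y) := :- (x :+ y)) refl X Y) (+-mono-≤ lo lo′) , +-mono-≤ hi hi′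

  ◁-* : ∀ {x y X Y} → x ◁ X → y ◁ Y → x * y ◁ X * Y
  ◁-* {x} {y} {X} {Y} (lo , hi) (lo′ , hi′) =
    *-cancelˡ-≤ (fromℕ 2) (fromℕ-suc-positive 1) (≤-certificate
      (+-nonNegative (*-nonNegative (x≤y⇒0≤y-x hi) (x≤y⇒0≤y-x hi′)) (*-nonNegative (x≤y⇒0≤y-x lo) (x≤y⇒0≤y-x lo′)))
      (solve 4 (λ x y X Y → con (+ 2) :* (x :* y) :- con (+ 2) :* (:- (X :* Y)) :=
          (X :- x) :* (Y :- y) :+ (x :- (:- X)) :* (y :- (:- Y))) refl x y X Y)) ,
    *-cancelˡ-≤ (fromℕ 2) (fromℕ-suc-positive 1) (≤-certificate
      (+-nonNegative (*-nonNegative (x≤y⇒0≤y-x hi) (x≤y⇒0≤y-x lo′)) (*-nonNegative (x≤y⇒0≤y-x lo) (x≤y⇒0≤y-x hi′)))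
      (solve 4 (λ x y X Y → con (+ 2) :* (X :* Y) :- con (+ 2) :* (x :* y) :=
          (X :- x) :* (y :- (:- Y)) :+ (x :- (:- X)) :* (Y :- y)) refl x y X Y))

  ◁-0≤ : ∀ {x X} → x ◁ X → 0# ≤ X
  ◁-0≤ {x} {X} (lo , hi) = *-cancelˡ-≤ (fromℕ 2) (fromℕ-suc-positive 1) (≤-certificate (x≤y⇒0≤y-x (≤-trans lo hi))
    (solve 1 (λ X → con (+ 2) :* X :- con (+ 2) :* con (+ 0) := X :- (:- X)) refl X))

  ◁-refl : ∀ {x} → 0# ≤ x → x ◁ x
  ◁-refl {x} 0≤x = ≤-certificate (+-nonNegative 0≤x 0≤x) (solve 1 (λ x → x :- (:- x) := x :+ x) refl x) , ≤-refl

  partial-◁ : ∀ {f g} m → (∀ i → i ℕ.< m → f i ◁ g i) → partial f m ◁ partial g m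
  partial-◁ zero    f◁g = ◁-refl ≤-refl
  partial-◁ (suc m) f◁g = ◁-+ (partial-◁ m (λ i i<m → f◁g i (ℕ.m<n⇒m<1+n i<m))) (f◁g m ℕ.≤-refl)

  -- The choice ε = d / (d + C) refutes d > 0.
  arbitrarily-small : ∀ {d C} → 0# ≤ C → (∀ ε → 0# < ε → ε ≤ 1# → d ≤ C * ε) → d ≤ 0#
  arbitrarily-small {d} {C} 0≤C small with d ≤? 0#
  ... | yes d≤0 = d≤0
  ... | no  0<d = *-cancelˡ-≤ d 0<d (≤-certificate (x≤y⇒0≤y-x (begin
      d * (d + C)                      ≤⟨ *-monoʳ-≤ (d + C) (<⇒≤ 0<d+C) (small ε (*-positive 0<d (⁻¹-positive 0<d+C)) ε≤1) ⟩
      C * (d / (d + C)) * (d + C)      ≈⟨ *-assoc _ _ _ ⟩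
      C * (d / (d + C) * (d + C))      ≈⟨ *-congˡ (x/y*y≈x d (0<x⇒x≉0 0<d+C)) ⟩
      C * d                            ∎))
      (solve 2 (λ d C → d :* con (+ 0) :- d :* d := C :* d :- d :* (d :+ C)) refl d C))
    where
    0<d+C = +-positive 0<d 0≤C
    ε = d / (d + C)
    ε≤1 : ε ≤ 1#
    ε≤1 = x≤z*y⇒x/y≤z 0<d+C (≤-certificate 0≤C (solve 2 (λ d C → con (+ 1) :* (d :+ C) :- d := C) refl d C))

  arbitrarily-close : ∀ {x y C} → 0# ≤ C → (∀ ε → 0# < ε → ε ≤ 1# → x - y ◁ C * ε) → x ≈ y
  arbitrarily-close {x} {y} 0≤C close = ≤-antisym
    (≤-certificate (x≤0⇒0≤-x (arbitrarily-small 0≤C (λ ε 0<ε ε≤1 → proj₂ (close ε 0<ε ε≤1))))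
      (solve 2 (λ x y → y :- x := :- (x :- y)) refl x y))
    (≤-certificate (x≤0⇒0≤-x (arbitrarily-small 0≤C (λ ε 0<ε ε≤1 → proj₂ (◁-neg (close ε 0<ε ε≤1)))))
      (solve 2 (λ x y → x :- y := :- (:- (x :- y))) refl x y))

  limit-≥ : ∀ {a l c} M → (∀ m → M ℕ.≤ m → c ≤ a m) → a ConvergesTo l → c ≤ l
  limit-≥ {a} {l} {c} M c≤a a→l = ≤-certificate (x≤0⇒0≤-x (arbitrarily-small 0≤1 small)) (solve 2 (λ l c → l :- c :=
      :- (c :- l)) refl l c)
    where
    small : ∀ ε → 0# < ε → ε ≤ 1# → c - l ≤ 1# * ε
    small ε 0<ε _ = ≤-respʳ (sym (*-identityˡ ε)) (≤-trans (+-mono-≤ (c≤a (M ℕ.+ N) (ℕ.m≤m+n M N)) ≤-refl)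
        (proj₂ (abs≤⇒◁ (proj₂ (a→l ε 0<ε) (M ℕ.+ N) (ℕ.m≤n+m N M)))))
      where N = proj₁ (a→l ε 0<ε)

  limit-≤ : ∀ {a l c} → (∀ m → a m ≤ c) → a ConvergesTo l → l ≤ c
  limit-≤ {a} {l} {c} a≤c a→l = ≤-certificate (x≤0⇒0≤-x (arbitrarily-small 0≤1 small)) (solve 2 (λ l c → c :- l :=
      :- (l :- c)) refl l c)
    where
    small : ∀ ε → 0# < ε → ε ≤ 1# → l - c ≤ 1# * ε
    small ε 0<ε _ = ≤-respʳ (sym (*-identityˡ ε)) (≤-trans (≤-certificate (x≤y⇒0≤y-x (a≤c N)) (solve 3 (λ l c a → :- (a :- l) :- (l :- c) :=
        c :- a) refl l c (a N)))
        (proj₂ (◁-neg (abs≤⇒◁ (proj₂ (a→l ε 0<ε) N ℕ.≤-refl)))))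
      where N = proj₁ (a→l ε 0<ε)

  ⁻¹-unique : ∀ {x y} → ¬ (x ≈ 0#) → x * y ≈ 1# → y ≈ x ⁻¹
  ⁻¹-unique {x} {y} x≉0 xy≈1 = begin-equality
    y               ≈⟨ *-identityˡ y ⟨
    1# * y          ≈⟨ *-congʳ (⁻¹-inverseˡ x≉0) ⟨
    x ⁻¹ * x * y    ≈⟨ *-assoc _ _ _ ⟩
    x ⁻¹ * (x * y)  ≈⟨ *-congˡ xy≈1 ⟩
    x ⁻¹ * 1#       ≈⟨ *-identityʳ _ ⟩
    x ⁻¹            ∎

  term : Carrier → ℕ → Carrier
  term x i = x ^ i / fromℕ (i !)

  0<n! : ∀ n → 0# < fromℕ (n !)
  0<n! n = fromℕ-positive (ℕ.1≤n! n)

  term-suc : ∀ x i → fromℕ (suc i) * term x (suc i) ≈ x * term x i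
  term-suc x i = begin-equality
    s * (x * x ^ i * (fromℕ (suc i !)) ⁻¹)
      ≈⟨ solve 4 (λ s x p j → s :* (x :* p :* j) := x :* (p :* (s :* j))) refl s x (x ^ i) _ ⟩
    x * (x ^ i * (s * (fromℕ (suc i !)) ⁻¹))  ≈⟨ *-congˡ (*-congˡ (⁻¹-unique (0<x⇒x≉0 (0<n! i)) inverse)) ⟩
    x * term x i                              ∎
    where
    s = fromℕ (suc i)
    inverse : fromℕ (i !) * (s * (fromℕ (suc i !)) ⁻¹) ≈ 1#
    inverse = begin-equality
      fromℕ (i !) * (s * (fromℕ (suc i !)) ⁻¹)  ≈⟨ solve 3 (λ f s j → f :* (s :* j) := s :* f :* j) refl (fromℕ (i !)) s _ ⟩
      s * fromℕ (i !) * (fromℕ (suc i !)) ⁻¹    ≈⟨ *-congʳ (fromℕ-* (suc i) (i !)) ⟨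
      fromℕ (suc i !) * (fromℕ (suc i !)) ⁻¹    ≈⟨ ⁻¹-inverseʳ (0<x⇒x≉0 (0<n! (suc i))) ⟩
      1#                                        ∎

  term-zero : ∀ x → term x 0 ≈ 1#
  term-zero x = trans (*-congʳ (sym (+-identityʳ 1#))) (⁻¹-inverseʳ (0<x⇒x≉0 (0<n! 0)))

  term-nonNegative : ∀ {x} i → 0# ≤ x → 0# ≤ term x i
  term-nonNegative i 0≤x = *-nonNegative (^-nonNegative i 0≤x) (⁻¹-nonNegative (0<n! i))

  ^-◁ : ∀ {x X} i → x ◁ X → x ^ i ◁ X ^ i
  ^-◁ zero    x◁X = ◁-refl 0≤1
  ^-◁ (suc i) x◁X = ◁-* x◁X (^-◁ i x◁X)

  term-◁ : ∀ {x X} i → x ◁ X → term x i ◁ term X i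
  term-◁ i x◁X = ◁-* (^-◁ i x◁X) (◁-refl (⁻¹-nonNegative (0<n! i)))

  convolution : (x y : Carrier) → ℕ → Carrier
  convolution x y m = partial (λ i → term x i * term y (m ∸ i)) (suc m)

  -- The binomial theorem without binomial coefficients. Splitting `m + 1 = i + (m + 1 - i)` lets
  -- each factor absorb its own index by `term-suc`; the result is the recurrence satisfied by the
  -- terms of `x + y`.
  convolution-suc : ∀ x y m → fromℕ (suc m) * convolution x y (suc m) ≈ (x + y) * convolution x y m
  convolution-suc x y m = begin-equality
    fromℕ (suc m) * partial f (suc (suc m))
      ≈⟨ partial-*ˡ (fromℕ (suc m)) f (suc (suc m)) ⟨
    partial (λ i → fromℕ (suc m) * f i) (suc (suc m))
      ≈⟨ partial-cong (suc (suc m)) (λ i i<m+2 → split i (ℕ.≤-pred i<m+2)) ⟩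
    partial (λ i → g i + h i) (suc (suc m))
      ≈⟨ partial-+ g h (suc (suc m)) ⟩
    partial g (suc (suc m)) + partial h (suc (suc m))
      ≈⟨ +-cong (partial-suc g (suc m)) (+-congˡ h-last) ⟩
    g 0 + partial (g ∘ suc) (suc m) + (partial h (suc m) + 0#)
      ≈⟨ +-cong (+-cong (trans (*-congʳ (zeroˡ _)) (zeroˡ _)) (partial-cong (suc m) (λ i _ → trans (*-congʳ (term-suc x i)) (*-assoc _ _ _))))
           (trans (+-identityʳ _) (partial-cong (suc m) (λ i i<m+1 → h-shift i (ℕ.≤-pred i<m+1)))) ⟩
    0# + partial (λ i → x * c i) (suc m) + partial (λ i → y * c i) (suc m)
      ≈⟨ +-cong (trans (+-identityˡ _) (partial-*ˡ x c (suc m))) (partial-*ˡ y c (suc m)) ⟩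
    x * convolution x y m + y * convolution x y m
      ≈⟨ distribʳ _ _ _ ⟨
    (x + y) * convolution x y m ∎
    where
    c f g h : ℕ → Carrier
    c i = term x i * term y (m ∸ i)
    f i = term x i * term y (suc m ∸ i)
    g i = fromℕ i * term x i * term y (suc m ∸ i)
    h i = term x i * (fromℕ (suc m ∸ i) * term y (suc m ∸ i))
    split : ∀ i → i ℕ.≤ suc m → fromℕ (suc m) * f i ≈ g i + h i
    split i i≤m+1 = trans (*-congʳ (trans (reflexive (≡.cong fromℕ (≡.sym (ℕ.m+[n∸m]≡n i≤m+1)))) (fromℕ-+ i (suc m ∸ i))))
      (solve 4 (λ i j a b → (i :+ j) :* (a :* b) :=
          i :* a :* b :+ a :* (j :* b)) refl (fromℕ i) (fromℕ (suc m ∸ i)) (term x i) (term y (suc m ∸ i)))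
    h-last : h (suc m) ≈ 0#
    h-last = trans (*-congˡ (trans (*-congʳ (reflexive (≡.cong fromℕ (ℕ.n∸n≡0 m)))) (zeroˡ _))) (zeroʳ _)
    h-shift : ∀ i → i ℕ.≤ m → h i ≈ y * c i
    h-shift i i≤m = trans (*-congˡ (trans (reflexive (≡.cong (λ k → fromℕ k * term y k) (ℕ.+-∸-assoc 1 i≤m))) (term-suc y (m ∸ i))))
      (solve 3 (λ a y b → a :* (y :* b) := y :* (a :* b)) refl (term x i) y (term y (m ∸ i)))

  term-+ : ∀ x y m → term (x + y) m ≈ convolution x y m
  term-+ x y zero = trans (term-zero (x + y))
    (sym (trans (+-identityˡ _) (trans (*-cong (term-zero x) (term-zero y)) (*-identityˡ 1#))))
  term-+ x y (suc m) = begin-equality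
    term (x + y) (suc m)                         ≈⟨ cancel _ ⟨
    s ⁻¹ * (s * term (x + y) (suc m))            ≈⟨ *-congˡ (term-suc (x + y) m) ⟩
    s ⁻¹ * ((x + y) * term (x + y) m)            ≈⟨ *-congˡ (*-congˡ (term-+ x y m)) ⟩
    s ⁻¹ * ((x + y) * convolution x y m)         ≈⟨ *-congˡ (convolution-suc x y m) ⟨
    s ⁻¹ * (s * convolution x y (suc m))         ≈⟨ cancel _ ⟩
    convolution x y (suc m)                      ∎
    where
    s = fromℕ (suc m)
    cancel : ∀ z → s ⁻¹ * (s * z) ≈ z
    cancel z = trans (sym (*-assoc _ _ _)) (trans (*-congʳ (⁻¹-inverseˡ (0<x⇒x≉0 (fromℕ-suc-positive m)))) (*-identityˡ z))

  expSum : Carrier → ℕ → Carrier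
  expSum x = partial (term x)

  -- The sum of `term x i * term y j` over the triangle `i + j < m`, arranged by `i` instead of by
  -- `i + j`.
  expSum-+ : ∀ x y m → expSum (x + y) m ≈ partial (λ i → term x i * expSum y (m ∸ i)) m
  expSum-+ x y zero = refl
  expSum-+ x y (suc m) = begin-equality
    expSum (x + y) m + term (x + y) m
      ≈⟨ +-cong (expSum-+ x y m) (term-+ x y m) ⟩
    partial f m + convolution x y m
      ≈⟨ +-congʳ (+-identityʳ _) ⟨
    partial f m + 0# + convolution x y m
      ≈⟨ +-congʳ (+-congˡ (trans (*-congˡ (reflexive (≡.cong (expSum y) (ℕ.n∸n≡0 m)))) (zeroʳ _))) ⟨
    partial f (suc m) + convolution x y m
      ≈⟨ partial-+ f _ (suc m) ⟨
    partial (λ i → f i + term x i * term y (m ∸ i)) (suc m)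
      ≈⟨ partial-cong (suc m) (λ i i<m+1 → sym (trans (reflexive (≡.cong (λ k → term x i * expSum y k) (ℕ.+-∸-assoc 1 (ℕ.≤-pred i<m+1)))) (distribˡ _ _ _))) ⟩
    partial (λ i → term x i * expSum y (suc m ∸ i)) (suc m) ∎
    where
    f : ℕ → Carrier
    f i = term x i * expSum y (m ∸ i)

  expSum-product : ∀ x y m →
    expSum x m * expSum y m - expSum (x + y) m ≈ partial (λ i → term x i * (expSum y m - expSum y (m ∸ i))) m
  expSum-product x y m = begin-equality
    expSum x m * expSum y m - expSum (x + y) m
      ≈⟨ +-cong (sym (partial-*ʳ (expSum y m) (term x) m)) (trans (-‿cong (expSum-+ x y m))
           (trans (solve 1 (λ p → :- p := (:- con (+ 1)) :* p) refl _) (sym (partial-*ˡ (- 1#) _ m)))) ⟩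
    partial (λ i → term x i * expSum y m) m + partial (λ i → - 1# * (term x i * expSum y (m ∸ i))) m
      ≈⟨ partial-+ _ _ m ⟨
    partial (λ i → term x i * expSum y m + - 1# * (term x i * expSum y (m ∸ i))) m
      ≈⟨ partial-cong m (λ i _ → solve 3 (λ a p q → a :* p :+ (:- con (+ 1)) :* (a :* q) :=
          a :* (p :- q)) refl (term x i) (expSum y m) (expSum y (m ∸ i))) ⟩
    partial (λ i → term x i * (expSum y m - expSum y (m ∸ i))) m ∎

  expSum-difference-◁ : ∀ {y Y} → y ◁ Y → ∀ j m → expSum y (j ℕ.+ m) - expSum y m ◁ expSum Y (j ℕ.+ m) - expSum Y m
  expSum-difference-◁ {y} {Y} y◁Y zero m = ◁-respˡ (sym (-‿inverseʳ _)) (◁-trans-≤ (◁-refl ≤-refl) (≤-reflexive (sym (-‿inverseʳ _))))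
  expSum-difference-◁ {y} {Y} y◁Y (suc j) m =
    ◁-respˡ (solve 3 (λ p t q → p :- q :+ t := p :+ t :- q) refl (expSum y (j ℕ.+ m)) (term y (j ℕ.+ m)) (expSum y m))
      (◁-trans-≤ (◁-+ (expSum-difference-◁ y◁Y j m) (term-◁ (j ℕ.+ m) y◁Y))
        (≤-reflexive (solve 3 (λ p t q → p :- q :+ t := p :+ t :- q) refl (expSum Y (j ℕ.+ m)) (term Y (j ℕ.+ m)) (expSum Y m))))

  -- The difference is the sum over the square `i, j < m` outside the triangle `i + j < m`, so it is
  -- majorised term by term.
  expSum-product-◁ : ∀ {x y X Y} → x ◁ X → y ◁ Y → ∀ m →
    expSum x m * expSum y m - expSum (x + y) m ◁ expSum X m * expSum Y m - expSum (X + Y) m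
  expSum-product-◁ {x} {y} {X} {Y} x◁X y◁Y m =
    ◁-respˡ (sym (expSum-product x y m)) (◁-trans-≤ (partial-◁ m step) (≤-reflexive (sym (expSum-product X Y m))))
    where
    step : ∀ i → i ℕ.< m → term x i * (expSum y m - expSum y (m ∸ i)) ◁ term X i * (expSum Y m - expSum Y (m ∸ i))
    step i i<m = ◁-* (term-◁ i x◁X)
      (≡.subst (λ k → expSum y k - expSum y (m ∸ i) ◁ expSum Y k - expSum Y (m ∸ i)) (ℕ.m+[n∸m]≡n (ℕ.<⇒≤ i<m)) (expSum-difference-◁ y◁Y i (m ∸ i)))

  -- The square `i, j < m` lies inside the triangle `i + j < 2 m`.
  expSum-product-≤ : ∀ {X Y} → 0# ≤ X → 0# ≤ Y → ∀ m → expSum X m * expSum Y m ≤ expSum (X + Y) (m ℕ.+ m)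
  expSum-product-≤ {X} {Y} 0≤X 0≤Y m = begin
    expSum X m * expSum Y m                                           ≈⟨ partial-*ʳ (expSum Y m) (term X) m ⟨
    partial (λ i → term X i * expSum Y m) m
      ≤⟨ partial-mono-≤ m (λ i i<m → *-monoˡ-≤ _ (term-nonNegative i 0≤X)
                                                                           (partial-monoʳ-≤ (λ j → term-nonNegative j 0≤Y) (enough i i<m))) ⟩
    partial (λ i → term X i * expSum Y (m ℕ.+ m ∸ i)) m
      ≤⟨ partial-monoʳ-≤ (λ i → *-nonNegative (term-nonNegative i 0≤X) (partial-nonNegative (m ℕ.+ m ∸ i) (λ j → term-nonNegative j 0≤Y))) (ℕ.m≤m+n m m) ⟩
    partial (λ i → term X i * expSum Y (m ℕ.+ m ∸ i)) (m ℕ.+ m)       ≈⟨ expSum-+ X Y (m ℕ.+ m) ⟨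
    expSum (X + Y) (m ℕ.+ m)                                          ∎
    where
    enough : ∀ i → i ℕ.< m → m ℕ.≤ m ℕ.+ m ∸ i
    enough i i<m = ℕ.≤-trans (ℕ.m≤m+n m (m ∸ i)) (ℕ.≤-reflexive (≡.sym (ℕ.+-∸-assoc m (ℕ.<⇒≤ i<m))))

-- The exponential function: addition law, tangent inequality, monotonicity.

module Exponential (𝓡 : RealNumbers) where
  open RealNumbers 𝓡 hiding (zero)
  open OrderedField completeOrderedField
  open Series completeOrderedField
  open ≤-Reasoning

  exp-limit : ∀ x ε → 0# < ε → ∃[ N ] (∀ m → N ℕ.≤ m → expSum x m - exp x ◁ ε)
  exp-limit x ε 0<ε = proj₁ (exp-series x ε 0<ε) ,
    λ m N≤m → ◁-respˡ (+-congʳ (sum≈partial (term x) m)) (abs≤⇒◁ (proj₂ (exp-series x ε 0<ε) m N≤m))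

  -- Equality is a setoid equality and `exp` a bare function, so congruence has to come from
  -- uniqueness of the limit.
  exp-cong : ∀ {x y} → x ≈ y → exp x ≈ exp y
  exp-cong {x} {y} x≈y = arbitrarily-close (fromℕ-nonNegative 2) close
    where
    close : ∀ ε → 0# < ε → ε ≤ 1# → exp x - exp y ◁ fromℕ 2 * ε
    close ε 0<ε _ = ◁-respˡ
      (trans (+-congˡ (+-congʳ (partial-cong m (λ i _ → *-congʳ (^-congˡ i (sym x≈y))))))
        (solve 3 (λ p q s → :- (s :- p) :+ (s :- q) := p :- q) refl (exp x) (exp y) (expSum x m)))
      (◁-trans-≤ (◁-+ (◁-neg (proj₂ limˣ m (ℕ.m≤m+n _ _))) (proj₂ limʸ m (ℕ.m≤n+m _ _)))
        (≤-reflexive (solve 1 (λ e → e :+ e := con (+ 2) :* e) refl ε)))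
      where
      limˣ = exp-limit x ε 0<ε
      limʸ = exp-limit y ε 0<ε
      m = proj₁ limˣ ℕ.+ proj₁ limʸ

  product-close : ∀ {a b l k ε} → ε ≤ 1# → a - l ◁ ε → b - k ◁ ε → a * b - l * k ◁ (1# + abs l + abs k) * ε
  product-close {a} {b} {l} {k} {ε} ε≤1 a≈l b≈k = ◁-respˡ
    (solve 4 (λ a b l k → (a :- l) :* (b :- k) :+ (l :* (b :- k) :+ k :* (a :- l)) := a :* b :- l :* k) refl a b l k)
    (◁-trans-≤ (◁-+ (◁-* a≈l b≈k) (◁-+ (◁-* (◁-abs l) b≈k) (◁-* (◁-abs k) a≈l)))
      (≤-certificate (*-nonNegative (◁-0≤ a≈l) (x≤y⇒0≤y-x ε≤1))
        (solve 3 (λ e l k → (con (+ 1) :+ l :+ k) :* e :- (e :* e :+ (l :* e :+ k :* e)) :=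
            e :* (con (+ 1) :- e)) refl ε (abs l) (abs k))))

  -- The error of the truncated product is at most that for the absolute values `X`, `Y`, which lies
  -- below the difference of two partial sums of `exp (X + Y)`, at `2 m` and at `m`. Convergence
  -- makes this small.
  exp-+ : ∀ x y → exp (x + y) ≈ exp x * exp y
  exp-+ x y = sym (arbitrarily-close 0≤C close)
    where
    X = abs x
    Y = abs y
    C₀ = 1# + abs (exp x) + abs (exp y)
    C = C₀ + fromℕ 3
    0≤X = ◁-0≤ (◁-abs x)
    0≤Y = ◁-0≤ (◁-abs y)
    0≤C : 0# ≤ C
    0≤C = +-nonNegative (+-nonNegative (+-nonNegative 0≤1 (◁-0≤ (◁-abs (exp x)))) (◁-0≤ (◁-abs (exp y)))) (fromℕ-nonNegative 3)
    close : ∀ ε → 0# < ε → ε ≤ 1# → exp x * exp y - exp (x + y) ◁ C * ε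
    close ε 0<ε ε≤1 = ◁-respˡ
      (solve 4 (λ p q s t → :- (s :- p) :+ ((s :- t) :+ (t :- q)) := p :- q) refl
        (exp x * exp y) (exp (x + y)) (expSum x m * expSum y m) (expSum (x + y) m))
      (◁-trans-≤ (◁-+ (◁-neg (product-close ε≤1 (proj₂ limˣ m m≥₁) (proj₂ limʸ m m≥₂))) (◁-+ middle (proj₂ limˢ m m≥₃)))
        (≤-reflexive (solve 2 (λ c e → c :* e :+ (con (+ 2) :* e :+ e) := (c :+ con (+ 3)) :* e) refl C₀ ε)))
      where
      limˣ = exp-limit x ε 0<ε
      limʸ = exp-limit y ε 0<ε
      limˢ = exp-limit (x + y) ε 0<ε
      limᴬ = exp-limit (X + Y) ε 0<ε
      N₁ = proj₁ limˣ
      N₂ = proj₁ limʸ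
      N₃ = proj₁ limˢ
      N₄ = proj₁ limᴬ
      m = (N₁ ℕ.+ N₂) ℕ.+ (N₃ ℕ.+ N₄)
      m≥₁ = ℕ.≤-trans (ℕ.m≤m+n N₁ N₂) (ℕ.m≤m+n _ (N₃ ℕ.+ N₄))
      m≥₂ = ℕ.≤-trans (ℕ.m≤n+m N₂ N₁) (ℕ.m≤m+n _ (N₃ ℕ.+ N₄))
      m≥₃ = ℕ.≤-trans (ℕ.m≤m+n N₃ N₄) (ℕ.m≤n+m _ (N₁ ℕ.+ N₂))
      m≥₄ = ℕ.≤-trans (ℕ.m≤n+m N₄ N₃) (ℕ.m≤n+m _ (N₁ ℕ.+ N₂))
      middle : expSum x m * expSum y m - expSum (x + y) m ◁ fromℕ 2 * ε
      middle = ◁-trans-≤ (expSum-product-◁ (◁-abs x) (◁-abs y) m) (begin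
        expSum X m * expSum Y m - expSum (X + Y) m                ≤⟨ +-mono-≤ (expSum-product-≤ 0≤X 0≤Y m) ≤-refl ⟩
        expSum (X + Y) (m ℕ.+ m) - expSum (X + Y) m
          ≈⟨ solve 3 (λ p q e → p :- q :=
              (p :- e) :+ (:- (q :- e))) refl (expSum (X + Y) (m ℕ.+ m)) (expSum (X + Y) m) (exp (X + Y)) ⟩
        (expSum (X + Y) (m ℕ.+ m) - exp (X + Y)) + - (expSum (X + Y) m - exp (X + Y))
          ≤⟨ +-mono-≤ (proj₂ (proj₂ limᴬ (m ℕ.+ m) (ℕ.≤-trans m≥₄ (ℕ.m≤m+n m m)))) (proj₂ (◁-neg (proj₂ limᴬ m m≥₄))) ⟩
        ε + ε                                                     ≈⟨ solve 1 (λ e → e :+ e := con (+ 2) :* e) refl ε ⟩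
        fromℕ 2 * ε                                               ∎)

  1+x≤exp-nonNegative : ∀ {x} → 0# ≤ x → 1# + x ≤ exp x
  1+x≤exp-nonNegative {x} 0≤x = limit-≥ 2 bound (exp-series x)
    where
    bound : ∀ m → 2 ℕ.≤ m → 1# + x ≤ expPartialSum x m
    bound m 2≤m = ≤-respʳ (sym (sum≈partial (term x) m)) (≤-trans
      (≤-reflexive (sym (+-cong (trans (+-identityˡ _) (term-zero x)) (begin-equality
        term x 1                 ≈⟨ *-identityˡ _ ⟨
        1# * term x 1            ≈⟨ *-congʳ (+-identityʳ 1#) ⟨
        fromℕ 1 * term x 1       ≈⟨ term-suc x 0 ⟩
        x * term x 0             ≈⟨ trans (*-congˡ (term-zero x)) (*-identityʳ x) ⟩
        x                        ∎))))
      (partial-monoʳ-≤ (λ i → term-nonNegative i 0≤x) 2≤m))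

  -- The addition law makes `exp 0` idempotent, and it is at least `1`, hence nonzero.
  exp0≈1 : exp 0# ≈ 1#
  exp0≈1 = begin-equality
    e               ≈⟨ solve 1 (λ e → e := (e :- con (+ 1)) :+ con (+ 1)) refl e ⟩
    (e - 1#) + 1#   ≈⟨ +-congʳ (*-cancelˡ-≈0 e≉0 (begin-equality
      e * (e - 1#)    ≈⟨ solve 1 (λ e → e :* (e :- con (+ 1)) := e :* e :- e) refl e ⟩
      e * e - e       ≈⟨ +-congʳ (exp-+ 0# 0#) ⟨
      exp (0# + 0#) - e ≈⟨ +-congʳ (exp-cong (+-identityˡ 0#)) ⟩
      e - e           ≈⟨ -‿inverseʳ e ⟩
      0#              ∎)) ⟩
    0# + 1#         ≈⟨ +-identityˡ 1# ⟩
    1#              ∎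
    where
    e = exp 0#
    e≉0 : ¬ (e ≈ 0#)
    e≉0 = 0<x⇒x≉0 (<-≤-trans 0<1 (≤-respˡ (+-identityʳ 1#) (1+x≤exp-nonNegative ≤-refl)))

  exp-neg : ∀ x → exp x * exp (- x) ≈ 1#
  exp-neg x = trans (sym (exp-+ x (- x))) (trans (exp-cong (-‿inverseʳ x)) exp0≈1)

  exp-nonNegative : ∀ x → 0# ≤ exp x
  exp-nonNegative x = ≤-respʳ (trans (sym (exp-+ h h)) (exp-cong (begin-equality
    h + h           ≈⟨ solve 1 (λ h → h :+ h := h :* con (+ 2)) refl h ⟩
    h * fromℕ 2     ≈⟨ x/y*y≈x x (0<x⇒x≉0 (fromℕ-suc-positive 1)) ⟩
    x               ∎))) (x*x-nonNegative (exp h))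
    where h = x / fromℕ 2

  exp-positive : ∀ x → 0# < exp x
  exp-positive x = 0≤x∧x≉0⇒0<x (exp-nonNegative x)
    (λ e≈0 → 1≉0 (trans (sym (exp-neg x)) (trans (*-congʳ e≈0) (zeroˡ _))))

  1-u^m : ∀ u m → partial (u ^_) m * (1# - u) ≈ 1# - u ^ m
  1-u^m u zero = solve 1 (λ u → con (+ 0) :* (con (+ 1) :- u) := con (+ 1) :- con (+ 1)) refl u
  1-u^m u (suc m) = trans (distribʳ _ _ _) (trans (+-congʳ (1-u^m u m))
    (solve 2 (λ u p → con (+ 1) :- p :+ p :* (con (+ 1) :- u) := con (+ 1) :- u :* p) refl u (u ^ m)))

  term≤^ : ∀ {u} i → 0# ≤ u → term u i ≤ u ^ i
  term≤^ {u} i 0≤u = x≤z*y⇒x/y≤z (0<n! i) (≤-respˡ (*-identityʳ _) (*-monoˡ-≤ (u ^ i) (^-nonNegative i 0≤u)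
    (≤-respˡ (+-identityʳ 1#) (fromℕ-mono-≤ (ℕ.1≤n! i)))))

  -- For 0 ≤ u ≤ 1 the exponential series is dominated by the geometric one.
  exp*[1-u]≤1 : ∀ {u} → 0# ≤ u → u ≤ 1# → exp u * (1# - u) ≤ 1#
  exp*[1-u]≤1 {u} 0≤u u≤1 with u ≟ 1#
  ... | yes u≈1 = ≤-trans (≤-reflexive (trans (*-congˡ (trans (+-congˡ (-‿cong u≈1)) (-‿inverseʳ 1#))) (zeroʳ _))) 0≤1
  ... | no  u≉1 = ≤-trans (*-monoʳ-≤ (1# - u) 0≤1-u (limit-≤ bound (exp-series u)))
      (≤-reflexive (trans (*-assoc _ _ _) (trans (*-congˡ (⁻¹-inverseˡ 1-u≉0)) (*-identityʳ 1#))))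
    where
    0≤1-u = x≤y⇒0≤y-x u≤1
    1-u≉0 : ¬ (1# - u ≈ 0#)
    1-u≉0 1-u≈0 = u≉1 (trans (solve 1 (λ u → u := con (+ 1) :- (con (+ 1) :- u)) refl u)
      (trans (+-congˡ (-‿cong 1-u≈0)) (solve 0 (con (+ 1) :- con (+ 0) := con (+ 1)) refl)))
    bound : ∀ m → expPartialSum u m ≤ 1# / (1# - u)
    bound m = ≤-respˡ (sym (sum≈partial (term u) m)) (z*y≤x⇒z≤x/y (0≤x∧x≉0⇒0<x 0≤1-u 1-u≉0) (begin
      expSum u m * (1# - u)         ≤⟨ *-monoʳ-≤ _ 0≤1-u (partial-mono-≤ m (λ i _ → term≤^ i 0≤u)) ⟩
      partial (u ^_) m * (1# - u)   ≈⟨ 1-u^m u m ⟩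
      1# - u ^ m
        ≤⟨ ≤-certificate (^-nonNegative m 0≤u) (solve 1 (λ p → con (+ 1) :- (con (+ 1) :- p) := p) refl (u ^ m)) ⟩
      1#                            ∎))

  -- For `x ≥ 0` by the first two terms of the series, for `x ≤ -1` because the left side is not
  -- positive, and in between by comparing `exp (- x)` with the geometric series.
  1+x≤exp : ∀ x → 1# + x ≤ exp x
  1+x≤exp x with ≤-total 0# x
  ... | inj₁ 0≤x = 1+x≤exp-nonNegative 0≤x
  ... | inj₂ x≤0 with ≤-total (- x) 1#
  ...   | inj₂ 1≤-x = ≤-trans (≤-certificate (x≤y⇒0≤y-x 1≤-x) (solve 1 (λ x → con (+ 0) :- (con (+ 1) :+ x) :=
      :- x :- con (+ 1)) refl x)) (exp-nonNegative x)
  ...   | inj₁ -x≤1 = begin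
    1# + x                                  ≈⟨ solve 1 (λ x → con (+ 1) :+ x := con (+ 1) :* (con (+ 1) :- (:- x))) refl x ⟩
    1# * (1# - - x)                         ≈⟨ *-congʳ (exp-neg x) ⟨
    exp x * exp (- x) * (1# - - x)          ≈⟨ *-assoc _ _ _ ⟩
    exp x * (exp (- x) * (1# - - x))        ≤⟨ *-monoˡ-≤ (exp x) (exp-nonNegative x) (exp*[1-u]≤1 (x≤0⇒0≤-x x≤0) -x≤1) ⟩
    exp x * 1#                              ≈⟨ *-identityʳ _ ⟩
    exp x                                   ∎

  -- The tangent at `x` lies below the graph. Monotonicity and its converse both follow.
  exp-difference : ∀ x y → exp x * (1# + (y - x)) ≤ exp y
  exp-difference x y = ≤-respʳ (trans (sym (exp-+ x (y - x))) (exp-cong (solve 2 (λ x y → x :+ (y :- x) := y) refl x y)))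
    (*-monoˡ-≤ (exp x) (exp-nonNegative x) (1+x≤exp (y - x)))

  exp-mono-≤ : ∀ {x y} → x ≤ y → exp x ≤ exp y
  exp-mono-≤ {x} {y} x≤y = ≤-trans
    (≤-certificate (*-nonNegative (exp-nonNegative x) (x≤y⇒0≤y-x x≤y))
      (solve 2 (λ e d → e :* (con (+ 1) :+ d) :- e := e :* d) refl (exp x) (y - x)))
    (exp-difference x y)

  -- Serves as monotonicity of `log`, which is characterised by `exp-log` alone.
  exp-cancel-≤ : ∀ {x y} → exp x ≤ exp y → x ≤ y
  exp-cancel-≤ {x} {y} ex≤ey with x ≤? y
  ... | yes x≤y = x≤y
  ... | no  y<x = contradiction (begin
      exp y * (x - y)            ≈⟨ solve 2 (λ e d → e :* d := e :* (con (+ 1) :+ d) :- e) refl (exp y) (x - y) ⟩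
      exp y * (1# + (x - y)) - exp y ≤⟨ +-mono-≤ (≤-trans (exp-difference y x) ex≤ey) ≤-refl ⟩
      exp y - exp y              ≈⟨ -‿inverseʳ _ ⟩
      0#                         ∎) (*-positive (exp-positive y) 0<x-y)
    where
    0<x-y : 0# < x - y
    0<x-y x-y≤0 = y<x (≤-certificate (x≤0⇒0≤-x x-y≤0) (solve 2 (λ x y → y :- x := :- (x :- y)) refl x y))

  exp-^ : ∀ n x → exp (fromℕ n * x) ≈ exp x ^ n
  exp-^ zero    x = trans (exp-cong (zeroˡ x)) exp0≈1
  exp-^ (suc n) x = trans (exp-cong (solve 2 (λ n x → (con (+ 1) :+ n) :* x := x :+ n :* x) refl (fromℕ n) x))
    (trans (exp-+ x (fromℕ n * x)) (*-congˡ (exp-^ n x)))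

-- Independent entries in a sequence of pairs of vertices.

infixl 6 _∖N[_]_

_∖N[_]_ : ∀ {n} → (Fin n → Bool) → Graph n → Fin n → Fin n → Bool
(S ∖N[ G ] a) v = S v ∧ not (Graph.adj G a v)

-- Some k entries (a₁ , b₁), …, (aₖ , bₖ) of the sequence, in this order, have all bᵢ in S
-- and no edge aᵢ bⱼ of G with i < j.
hasIndependent : ∀ {n N} → Graph n → ℕ → (Fin n → Bool) → Vec (Fin n × Fin n) N → Bool
hasIndependent G zero    S es             = true
hasIndependent G (suc k) S []             = false
hasIndependent G (suc k) S ((a , b) ∷ es) =
  hasIndependent G (suc k) S es ∨ (S b ∧ hasIndependent G k (S ∖N[ G ] a) es)

-- From the eigenvalue hypothesis on a regular graph to its mixing lemma.

module GraphSpectrum (𝓡 : RealNumbers) where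
  open RealNumbers 𝓡 hiding (zero)
  open OrderedField completeOrderedField
  open QuadraticForms completeOrderedField
  open RayleighQuotient completeOrderedField
  open Mixing completeOrderedField
  open Spectral 𝓡
  open Graph
  open ≤-Reasoning

  indicator : Bool → Carrier
  indicator b = if b then 1# else 0#

  indicator-nonNegative : ∀ b → 0# ≤ indicator b
  indicator-nonNegative true  = 0≤1
  indicator-nonNegative false = ≤-refl

  indicator≤1 : ∀ b → indicator b ≤ 1#
  indicator≤1 true  = ≤-refl
  indicator≤1 false = 0≤1

  ∑-indicator : ∀ {n} (f : Fin n → Bool) → ∑ (λ v → indicator (f v)) ≈ fromℕ ∣ tabulate f ∣
  ∑-indicator {zero}  f = ∑-zero _
  ∑-indicator {suc n} f = trans (∑-suc _) (trans (+-congˡ (∑-indicator (f ∘ suc))) (head (f zero)))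
    where
    head : ∀ b → indicator b + fromℕ ∣ tabulate (f ∘ suc) ∣ ≈ fromℕ ∣ b ∷ tabulate (f ∘ suc) ∣
    head true  = refl
    head false = +-identityˡ _

  adjacency-symmetric : ∀ {n} (G : Graph n) → Symmetric (adjacencyMatrix G)
  adjacency-symmetric G u v = reflexive (≡.cong indicator (adj-sym G u v))

  adjacency-rows : ∀ {n d} (G : Graph n) → Regular G d → ∀ u → ∑ (adjacencyMatrix G u) ≈ fromℕ d
  adjacency-rows G regular u = trans (∑-indicator (adj G u)) (reflexive (≡.cong fromℕ (regular u)))

  in-eigenspace : ∀ {n} (A : SquareMatrix n) μ x → (∀ u → apply A x u ≈ μ * x u) → InEigenspace A μ x
  in-eigenspace A μ x eigen u = trans (sym (∑≈sum _)) (eigen u)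

  independent₁ : ∀ {n} (x : Vector n) → NonZeroVector x → LinearlyIndependent {1} (λ _ → x)
  independent₁ x (u , x≉0) c relation zero = *-cancelˡ-≈0 x≉0 (trans (*-comm _ _) (trans (sym (+-identityʳ _)) (relation u)))

  pair : ∀ {n} → Vector n → Vector n → Fin 2 → Vector n
  pair x y zero    = x
  pair x y (suc _) = y

  -- Summing the relation over all coordinates eliminates `x` and leaves `(n + 1) * c₁ = 0`.
  independent₂ : ∀ {n} (x : Vector (suc n)) → NonZeroVector x → ∑ x ≈ 0# → LinearlyIndependent (pair x (λ _ → 1#))
  independent₂ {n} x (u , x≉0) ∑x≈0 c relation = λ { zero → c₀≈0 ; (suc zero) → c₁≈0 }
    where
    c₀ = c zero
    c₁ = c (suc zero)
    c₁≈0 : c₁ ≈ 0#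
    c₁≈0 = *-cancelˡ-≈0 (0<x⇒x≉0 (fromℕ-suc-positive n)) (begin-equality
      fromℕ (suc n) * c₁                              ≈⟨ ∑-const (suc n) c₁ ⟨
      ∑ {suc n} (λ _ → c₁)                            ≈⟨ +-identityˡ _ ⟨
      0# + ∑ {suc n} (λ _ → c₁)                       ≈⟨ +-congʳ (trans (∑-*ˡ c₀ x) (trans (*-congˡ ∑x≈0) (zeroʳ c₀))) ⟨
      ∑ (λ u → c₀ * x u) + ∑ (λ _ → c₁)               ≈⟨ ∑-+ _ _ ⟨
      ∑ (λ u → c₀ * x u + c₁)
        ≈⟨ ∑-cong (λ u → trans (solve 2 (λ p c → p :+ c := p :+ (c :* con (+ 1) :+ con (+ 0))) refl (c₀ * x u) c₁) (relation u)) ⟩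
      ∑ {suc n} (λ _ → 0#)                            ≈⟨ ∑-0 ⟩
      0#                                              ∎)
    c₀≈0 : c₀ ≈ 0#
    c₀≈0 = *-cancelˡ-≈0 x≉0 (begin-equality
      x u * c₀
        ≈⟨ solve 2 (λ x c → x :* c := c :* x :+ (con (+ 0) :* con (+ 1) :+ con (+ 0))) refl (x u) c₀ ⟩
      c₀ * x u + (0# * 1# + 0#)                       ≈⟨ +-congˡ (+-congʳ (*-congʳ c₁≈0)) ⟨
      c₀ * x u + (c₁ * 1# + 0#)                       ≈⟨ relation u ⟩
      0#                                              ∎)

  -- When `μ` happens to equal the degree, `x` and the constant vector together show that its
  -- multiplicity is at least two, so removing one copy leaves `μ` in the spectrum.
  eigenvalue-other-than : ∀ {n} (A : SquareMatrix (suc n)) ρ → (∀ u → ∑ (A u) ≈ ρ) →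
    ∀ μ x → Eigenvector A μ x → ∑ x ≈ 0# → EigenvalueOtherThan A ρ μ
  eigenvalue-other-than A ρ rows μ x (x≉0 , eigen) ∑x≈0 with μ ≟ ρ
  ... | no  μ≉ρ = inj₁ (μ≉ρ , (λ _ → x) , independent₁ x x≉0 , λ _ → in-eigenspace A μ x eigen)
  ... | yes μ≈ρ = inj₂ (μ≈ρ , pair x (λ _ → 1#) , independent₂ x x≉0 ∑x≈0 ,
    λ { zero → in-eigenspace A μ x eigen
      ; (suc _) → in-eigenspace A μ (λ _ → 1#) (λ u → trans (∑-cong (λ v → *-identityʳ _)) (trans (rows u) (trans (sym μ≈ρ) (sym (*-identityʳ μ))))) })

  module _ {m d : ℕ} {λ′ : Carrier} (G : Graph (suc (suc m))) (isNDΛ : IsNDΛGraph d λ′ G) where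
    open IsNDΛGraph isNDΛ

    private
      n : ℕ
      n = suc (suc m)

      A : SquareMatrix n
      A = adjacencyMatrix G

      0≤A : ∀ u v → 0# ≤ A u v
      0≤A u v = indicator-nonNegative (adj G u v)

      A≤1 : ∀ u v → A u v ≤ 1#
      A≤1 u v = indicator≤1 (adj G u v)

      -A : SquareMatrix n
      -A u v = - A u v

      apply-neg : ∀ x u → apply -A x u ≈ - apply A x u
      apply-neg x u = trans (∑-cong (λ v → solve 2 (λ a x → (:- a) :* x := :- (a :* x)) refl (A u v) (x v))) (∑-neg _)

      form-neg : ∀ x → form -A x ≈ - form A x
      form-neg x = trans (∑-cong (λ u → trans (*-congˡ (apply-neg x u)) (solve 2 (λ x a → x :* (:- a) :=
          :- (x :* a)) refl (x u) (apply A x u)))) (∑-neg _)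

      rows : ∀ u → ∑ (A u) ≈ fromℕ d
      rows = adjacency-rows G regular

      ∣eigenvalue∣≤ : ∀ μ x → Eigenvector A μ x → ∑ x ≈ 0# → abs μ ≤ λ′
      ∣eigenvalue∣≤ μ x eigen ∑x≈0 = eigenvalues μ (eigenvalue-other-than A (fromℕ d) rows μ x eigen ∑x≈0)

      form≤ : ∀ y → ∑ y ≈ 0# → form A y ≤ λ′ * normSq y
      form≤ = form≤-on-sum-zero A (adjacency-symmetric G) rows
        (≤-certificate
          (+-nonNegative (+-nonNegative (0≤A zero zero) (0≤A (suc zero) (suc zero))) (*-nonNegative (fromℕ-nonNegative 2) (x≤y⇒0≤y-x (A≤1 zero (suc zero)))))
          (solve 3 (λ a b c → a :+ b :- con (+ 2) :* c :- (:- con (+ 2)) :=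
              a :+ b :+ con (+ 2) :* (con (+ 1) :- c)) refl (A zero zero) (A (suc zero) (suc zero)) (A zero (suc zero))))
        (λ μ x eigen ∑x≈0 → ≤-trans (x≤abs μ) (∣eigenvalue∣≤ μ x eigen ∑x≈0))

      -form≤ : ∀ y → ∑ y ≈ 0# → - form A y ≤ λ′ * normSq y
      -form≤ y ∑y≈0 = ≤-respˡ (form-neg y) (form≤-on-sum-zero -A (λ u v → -‿cong (adjacency-symmetric G u v)) (λ u → trans (∑-neg _) (-‿cong (rows u)))
        -- Loops may put ones on the diagonal, so for `-A` the value `-2` can be attained: two loops
        -- and no edge between the two vertices.
        (≤-certificate
          (+-nonNegative (+-nonNegative (x≤y⇒0≤y-x (A≤1 zero zero)) (x≤y⇒0≤y-x (A≤1 (suc zero) (suc zero)))) (*-nonNegative (fromℕ-nonNegative 2) (0≤A zero (suc zero))))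
          (solve 3 (λ a b c → (:- a) :+ (:- b) :- con (+ 2) :* (:- c) :- (:- con (+ 2)) :=
              (con (+ 1) :- a) :+ (con (+ 1) :- b) :+ con (+ 2) :* c)
                  refl (A zero zero) (A (suc zero) (suc zero)) (A zero (suc zero))))
        (λ μ x eigen ∑x≈0 → ≤-trans (≤-respˡ (solve 1 (λ μ → :- (:- μ) :=
            μ) refl μ) (-x≤abs (- μ))) (∣eigenvalue∣≤ (- μ) x (eigen-neg μ x eigen) ∑x≈0))
        y ∑y≈0)
        where
        eigen-neg : ∀ μ x → Eigenvector -A μ x → Eigenvector A (- μ) x
        eigen-neg μ x (x≉0 , eigen) = x≉0 , λ u → begin-equality
          apply A x u            ≈⟨ solve 1 (λ a → a := :- (:- a)) refl (apply A x u) ⟩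
          - - apply A x u        ≈⟨ -‿cong (trans (sym (apply-neg x u)) (eigen u)) ⟩
          - (μ * x u)            ≈⟨ solve 2 (λ μ x → :- (μ :* x) := (:- μ) :* x) refl μ (x u) ⟩
          - μ * x u              ∎

    -- Add the upper and the lower bound on the form at one nonzero vector of sum zero.
    λ-nonNegative : 0# ≤ λ′
    λ-nonNegative = *-cancelˡ-≤ (fromℕ 2 * N) (*-positive (fromℕ-suc-positive 1) (normSq-positive e₀-e₁ zero 1≉0))
      (≤-certificate (+-nonNegative (x≤y⇒0≤y-x (form≤ e₀-e₁ ∑-e₀-e₁)) (x≤y⇒0≤y-x (-form≤ e₀-e₁ ∑-e₀-e₁)))
        (solve 3 (λ N l f → con (+ 2) :* N :* l :- con (+ 2) :* N :* con (+ 0) :=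
            (l :* N :- f) :+ (l :* N :- (:- f))) refl N λ′ (form A e₀-e₁)))
      where N = normSq (e₀-e₁ {m})

    graph-mixing : ∀ c → c * fromℕ n ≈ fromℕ d → ∀ x y →
      let p = dot x (apply A y) - c * (∑ x * ∑ y) in p * p ≤ λ′ * λ′ * (normSq x * normSq y)
    graph-mixing c cn≈d = mixing A (adjacency-symmetric G) rows cn≈d (⁻¹-inverseˡ (0<x⇒x≉0 0<n)) (⁻¹-nonNegative 0<n)
      λ-nonNegative form≤ -form≤
      where
      0<n : 0# < fromℕ n
      0<n = fromℕ-suc-positive (suc m)

-- Few edges of `F` run between a set and its sparse vertices.

module EdgeCounts (𝓡 : RealNumbers) where
  open RealNumbers 𝓡 hiding (zero)
  open OrderedField completeOrderedField
  open QuadraticForms completeOrderedField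
  open Spectral 𝓡
  open GraphSpectrum 𝓡
  open Graph
  open ≤-Reasoning

  x²≤y²⇒x≤y : ∀ {x y} → 0# ≤ y → x * x ≤ y * y → x ≤ y
  x²≤y²⇒x≤y {x} {y} 0≤y x²≤y² with x ≤? y
  ... | yes x≤y = x≤y
  ... | no  y<x = *-cancelˡ-≤ (x + y) (<-≤-trans (≤-<-trans 0≤y y<x) (≤-certificate 0≤y (solve 2 (λ x y → x :+ y :- x :=
      y) refl x y)))
    (≤-certificate (x≤y⇒0≤y-x x²≤y²) (solve 2 (λ x y → (x :+ y) :* y :- (x :+ y) :* x := y :* y :- x :* x) refl x y))

  -- With Z = |A||B|, c = d / n and e the edge counts between A and B, this combines the lower bound for G
  -- with the upper bound for F that the mixing lemma gives.
  edges≤6ηdn : ∀ {n dF dG cF cG λF λG η Z eF eG} →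
    0# < n → 0# < dF → 0# < dG → 0# ≤ λF → 0# ≤ λG → 0# ≤ η → 0# ≤ Z →
    cF * n ≈ dF → cG * n ≈ dG →
    λG * λG ≤ η * (dG * dG) → λF * λG ≤ η * (dF * dG) →
    (eG - cG * Z) * (eG - cG * Z) ≤ λG * λG * Z →
    (eF - cF * Z) * (eF - cF * Z) ≤ λF * λF * Z →
    fromℕ 2 * eG ≤ cG * Z →
    eF ≤ fromℕ 6 * η * (n * dF)
  edges≤6ηdn {n} {dF} {dG} {cF} {cG} {λF} {λG} {η} {Z} {eF} {eG} 0<n 0<dF 0<dG 0≤λF 0≤λG 0≤η 0≤Z cFn cGn hG hFG mixG mixF few = begin
    eF                                              ≈⟨ solve 2 (λ e z → e := z :+ (e :- z)) refl eF (cF * Z) ⟩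
    -- The constant is `6 = 4 + 2`: the main term is at most `4 * η * n * dF`, the deviation at most
    -- `2 * η * n * dF`.
    cF * Z + (eF - cF * Z)                          ≤⟨ +-mono-≤ (*-monoˡ-≤ cF 0≤cF Z≤) deviation≤ ⟩
    cF * (fromℕ 4 * (η * (n * n))) + fromℕ 2 * (η * (n * dF))
      ≈⟨ +-congʳ (solve 3 (λ c η n → c :* (con (+ 4) :* (η :* (n :* n))) := con (+ 4) :* (η :* (n :* (c :* n)))) refl cF η n) ⟩
    fromℕ 4 * (η * (n * (cF * n))) + fromℕ 2 * (η * (n * dF)) ≈⟨ +-congʳ (*-congˡ (*-congˡ (*-congˡ cFn))) ⟩
    fromℕ 4 * (η * (n * dF)) + fromℕ 2 * (η * (n * dF))
      ≈⟨ solve 2 (λ η m → con (+ 4) :* (η :* m) :+ con (+ 2) :* (η :* m) := con (+ 6) :* η :* m) refl η (n * dF) ⟩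
    fromℕ 6 * η * (n * dF)                          ∎
    where
    quotient-positive : ∀ {c d} → 0# < d → c * n ≈ d → 0# < c
    quotient-positive {c} 0<d cn≈d c≤0 = 0<d (≤-respˡ cn≈d (≤-respʳ (zeroˡ n) (*-monoʳ-≤ n (<⇒≤ 0<n) c≤0)))
    0<cG = quotient-positive 0<dG cGn
    0≤cF = <⇒≤ (quotient-positive 0<dF cFn)
    0<cGcG = *-positive 0<cG 0<cG

    -- The deviation of eG is at least half of the main term.
    [cGZ]²≤ : (cG * Z) * (cG * Z) ≤ fromℕ 4 * (λG * λG * Z)
    [cGZ]²≤ = begin
      x * x
        ≤⟨ ≤-certificate (*-nonNegative 0≤x-2e (+-nonNegative 0≤x-2e (+-nonNegative 0≤x 0≤x)))
                                                           (solve 2 (λ e x → con (+ 4) :* ((e :- x) :* (e :- x)) :- x :* x :=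
                                                               (x :- con (+ 2) :* e) :* ((x :- con (+ 2) :* e) :+ (x :+ x)))
                                                                   refl eG x) ⟩
      fromℕ 4 * ((eG - x) * (eG - x))                 ≤⟨ *-monoˡ-≤ _ (fromℕ-nonNegative 4) mixG ⟩
      fromℕ 4 * (λG * λG * Z)                         ∎
      where
      x = cG * Z
      0≤x = *-nonNegative (<⇒≤ 0<cG) 0≤Z
      0≤x-2e = x≤y⇒0≤y-x few

    cG²Z≤ : cG * cG * Z ≤ fromℕ 4 * (λG * λG)
    cG²Z≤ with Z ≤? 0#
    ... | yes Z≤0 = ≤-trans (≤-reflexive (trans (*-congˡ (≤-antisym Z≤0 0≤Z)) (zeroʳ _))) (*-nonNegative (fromℕ-nonNegative 4) (x*x-nonNegative λG))
    ... | no  0<Z = *-cancelˡ-≤ Z 0<Z (≤-respˡ (solve 2 (λ c Z → c :* Z :* (c :* Z) := Z :* (c :* c :* Z)) refl cG Z)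
                      (≤-respʳ (solve 2 (λ l Z → con (+ 4) :* (l :* l :* Z) := Z :* (con (+ 4) :* (l :* l))) refl λG Z) [cGZ]²≤))

    Z≤ : Z ≤ fromℕ 4 * (η * (n * n))
    Z≤ = *-cancelˡ-≤ (cG * cG) 0<cGcG (begin
      cG * cG * Z                                     ≤⟨ cG²Z≤ ⟩
      fromℕ 4 * (λG * λG)                             ≤⟨ *-monoˡ-≤ _ (fromℕ-nonNegative 4) hG ⟩
      fromℕ 4 * (η * (dG * dG))                       ≈⟨ *-congˡ (*-congˡ (*-cong cGn cGn)) ⟨
      fromℕ 4 * (η * (cG * n * (cG * n)))
        ≈⟨ solve 3 (λ η c n → con (+ 4) :* (η :* (c :* n :* (c :* n))) := c :* c :* (con (+ 4) :* (η :* (n :* n)))) refl η cG n ⟩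
      cG * cG * (fromℕ 4 * (η * (n * n)))             ∎)

    -- The factor `Z` in the mixing bound for `F` is traded for `λG²` by `cG²Z≤`, so that the
    -- product `λF * λG` appears. This is where the second term of the maximum `η` enters.
    deviation≤ : eF - cF * Z ≤ fromℕ 2 * (η * (n * dF))
    deviation≤ = x²≤y²⇒x≤y (*-nonNegative (fromℕ-nonNegative 2) (*-nonNegative 0≤η (*-nonNegative (<⇒≤ 0<n) (<⇒≤ 0<dF))))
      (*-cancelˡ-≤ (cG * cG) 0<cGcG (begin
        cG * cG * ((eF - cF * Z) * (eF - cF * Z))     ≤⟨ *-monoˡ-≤ _ (<⇒≤ 0<cGcG) mixF ⟩
        cG * cG * (λF * λF * Z)
          ≈⟨ solve 3 (λ c l Z → c :* c :* (l :* l :* Z) := l :* l :* (c :* c :* Z)) refl cG λF Z ⟩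
        λF * λF * (cG * cG * Z)                       ≤⟨ *-monoˡ-≤ _ (x*x-nonNegative λF) cG²Z≤ ⟩
        λF * λF * (fromℕ 4 * (λG * λG))
          ≈⟨ solve 2 (λ f g → f :* f :* (con (+ 4) :* (g :* g)) := con (+ 4) :* (f :* g :* (f :* g))) refl λF λG ⟩
        fromℕ 4 * (λF * λG * (λF * λG))               ≤⟨ *-monoˡ-≤ _ (fromℕ-nonNegative 4) (*-mono-≤ 0≤λFλG hFG 0≤λFλG hFG) ⟩
        fromℕ 4 * (η * (dF * dG) * (η * (dF * dG)))   ≈⟨ *-congˡ (*-cong (*-congˡ (*-congˡ cGn)) (*-congˡ (*-congˡ cGn))) ⟨
        fromℕ 4 * (η * (dF * (cG * n)) * (η * (dF * (cG * n))))
          ≈⟨ solve 4 (λ η d c n → con (+ 4) :* (η :* (d :* (c :* n)) :* (η :* (d :* (c :* n)))) :=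
               c :* c :* (con (+ 2) :* (η :* (n :* d)) :* (con (+ 2) :* (η :* (n :* d))))) refl η dF cG n ⟩
        cG * cG * (fromℕ 2 * (η * (n * dF)) * (fromℕ 2 * (η * (n * dF)))) ∎))
      where 0≤λFλG = *-nonNegative 0≤λF 0≤λG

  characteristicVector : ∀ {n} → (Fin n → Bool) → Vector n
  characteristicVector S u = indicator (S u)

  size : ∀ {n} → (Fin n → Bool) → Carrier
  size S = ∑ (characteristicVector S)

  indicator² : ∀ b → indicator b * indicator b ≈ indicator b
  indicator² true  = *-identityˡ 1#
  indicator² false = zeroˡ 0#

  normSq-characteristic : ∀ {n} (S : Fin n → Bool) → normSq (characteristicVector S) ≈ size S
  normSq-characteristic S = ∑-cong (λ u → indicator² (S u))

  size-nonNegative : ∀ {n} (S : Fin n → Bool) → 0# ≤ size S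
  size-nonNegative S = ∑-nonNegative (λ u → indicator-nonNegative (S u))

  degreeInto : ∀ {n} → Graph n → (Fin n → Bool) → Fin n → Carrier
  degreeInto G S a = apply (adjacencyMatrix G) (characteristicVector S) a

  size-∖N : ∀ {n} (G : Graph n) S a → size (S ∖N[ G ] a) ≈ size S - degreeInto G S a
  size-∖N G S a = trans (∑-cong (λ v → pointwise (S v) (adj G a v))) (trans (∑-+ _ _) (+-congˡ (∑-neg _)))
    where
    pointwise : ∀ s g → indicator (s ∧ not g) ≈ indicator s - indicator g * indicator s
    pointwise true  true  = solve 0 (con (+ 0) := con (+ 1) :- con (+ 1) :* con (+ 1)) refl
    pointwise true  false = solve 0 (con (+ 1) := con (+ 1) :- con (+ 0) :* con (+ 1)) refl
    pointwise false true  = solve 0 (con (+ 0) := con (+ 0) :- con (+ 1) :* con (+ 0)) refl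
    pointwise false false = solve 0 (con (+ 0) := con (+ 0) :- con (+ 0) :* con (+ 0)) refl

  module _ {n : ℕ} (G : Graph n) (c : Carrier) where

    -- Vertices with at most half of the expected number c |S| of neighbours in S.
    sparse : (Fin n → Bool) → Fin n → Bool
    sparse S a = does (fromℕ 2 * degreeInto G S a ≤? c * size S)

    sparse-edges : ∀ S → fromℕ 2 * dot (characteristicVector (sparse S)) (degreeInto G S) ≤ c * (size (sparse S) * size S)
    sparse-edges S = begin
      fromℕ 2 * dot x (degreeInto G S)                ≈⟨ ∑-*ˡ (fromℕ 2) _ ⟨
      ∑ (λ a → fromℕ 2 * (x a * degreeInto G S a))    ≤⟨ ∑-mono-≤ pointwise ⟩
      ∑ (λ a → x a * (c * size S))                    ≈⟨ ∑-*ʳ (c * size S) x ⟩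
      size (sparse S) * (c * size S)
        ≈⟨ solve 3 (λ a c s → a :* (c :* s) := c :* (a :* s)) refl (size (sparse S)) c (size S) ⟩
      c * (size (sparse S) * size S)                  ∎
      where
      x = characteristicVector (sparse S)
      pointwise : ∀ a → fromℕ 2 * (x a * degreeInto G S a) ≤ x a * (c * size S)
      pointwise a with fromℕ 2 * degreeInto G S a ≤? c * size S
      ... | yes few = ≤-respˡ (*-congˡ (sym (*-identityˡ _))) (≤-respʳ (sym (*-identityˡ _)) few)
      ... | no  _   = ≤-reflexive (trans (*-congˡ (zeroˡ _)) (trans (zeroʳ _) (sym (zeroˡ _))))

    size-∖N-dense : ∀ S a → sparse S a ≡ false → fromℕ 2 * size (S ∖N[ G ] a) ≤ (fromℕ 2 - c) * size S
    size-∖N-dense S a dense with fromℕ 2 * degreeInto G S a ≤? c * size S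
    ... | no  many = ≤-respˡ (*-congˡ (sym (size-∖N G S a))) (≤-certificate (x≤y⇒0≤y-x (<⇒≤ many))
      (solve 3 (λ c s e → (con (+ 2) :- c) :* s :- con (+ 2) :* (s :- e) :=
          con (+ 2) :* e :- c :* s) refl c (size S) (degreeInto G S a)))

  sparse-edges-other : ∀ {m dF dG λF λG η} (F G : Graph (suc (suc m))) → IsNDΛGraph dF λF F → IsNDΛGraph dG λG G →
    0# < fromℕ dF → 0# < fromℕ dG → 0# ≤ η →
    λG * λG ≤ η * (fromℕ dG * fromℕ dG) → λF * λG ≤ η * (fromℕ dF * fromℕ dG) →
    let n = fromℕ (suc (suc m)) in
    ∀ cF cG → cF * n ≈ fromℕ dF → cG * n ≈ fromℕ dG → ∀ S →
    dot (characteristicVector (sparse G cG S)) (degreeInto F S) ≤ fromℕ 6 * η * (n * fromℕ dF)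
  sparse-edges-other {m} F G isF isG 0<dF 0<dG 0≤η hG hFG cF cG cFn cGn S =
    edges≤6ηdn (fromℕ-suc-positive (suc m)) 0<dF 0<dG (λ-nonNegative F isF) (λ-nonNegative G isG) 0≤η
      (*-nonNegative (size-nonNegative A) (size-nonNegative S)) cFn cGn hG hFG
      (≤-respʳ (*-congˡ norms) (graph-mixing G isG cG cGn (characteristicVector A) (characteristicVector S)))
      (≤-respʳ (*-congˡ norms) (graph-mixing F isF cF cFn (characteristicVector A) (characteristicVector S)))
      (sparse-edges G cG S)
    where
    A = sparse G cG S
    norms = *-cong (normSq-characteristic A) (normSq-characteristic S)

-- Independent random draws and the probability of an independent subsequence.

module RandomSequence (𝓡 : RealNumbers) where
  open RealNumbers 𝓡 hiding (zero)
  open OrderedField completeOrderedField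
  open GraphSpectrum 𝓡
  open EdgeCounts 𝓡
  open ≤-Reasoning

  -- Two terms of the binomial expansion. At `x = N` this is the form of Pascal's rule that lets
  -- `N ^ k` stand for `k!` times the number of `k`-subsets of `N` positions.
  [x+1]^[1+k] : ∀ {x} k → 0# ≤ x → x ^ suc k + fromℕ (suc k) * x ^ k ≤ (1# + x) ^ suc k
  [x+1]^[1+k] {x} zero 0≤x = ≤-reflexive (solve 1 (λ x → x :* con (+ 1) :+ (con (+ 1) :+ con (+ 0)) :* con (+ 1) :=
      (con (+ 1) :+ x) :* con (+ 1)) refl x)
  [x+1]^[1+k] {x} (suc k) 0≤x = ≤-trans
    (≤-certificate (*-nonNegative (fromℕ-nonNegative (suc k)) (^-nonNegative k 0≤x))
      (solve 3 (λ x n p → (con (+ 1) :+ x) :* (x :* p :+ n :* p) :- (x :* (x :* p) :+ (con (+ 1) :+ n) :* (x :* p)) :=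
          n :* p) refl x (fromℕ (suc k)) (x ^ k)))
    (*-monoˡ-≤ (1# + x) (+-nonNegative 0≤1 0≤x) ([x+1]^[1+k] k 0≤x))

  size-positive : ∀ {n} (S : Fin n → Bool) b → S b ≡ true → 1# ≤ size S
  size-positive {suc n} S zero Sb = ≤-respʳ (sym (∑-suc _)) (≤-respˡ (+-identityʳ 1#) (+-mono-≤ (≤-reflexive (reflexive (≡.cong indicator (≡.sym Sb))))
    (∑-nonNegative (λ u → indicator-nonNegative (S (suc u))))))
  size-positive {suc n} S (suc b) Sb = ≤-respʳ (sym (∑-suc _)) (≤-respˡ (+-identityˡ 1#) (+-mono-≤ (indicator-nonNegative (S zero))
    (size-positive (S ∘ suc) b Sb)))

  module Probability {n : ℕ} (p : Fin n → Fin n → Carrier) (0≤p : ∀ a b → 0# ≤ p a b) (∑p≈1 : ∑ (λ a → ∑ (λ b → p a b)) ≈ 1#) where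

    expectation : (Fin n → Fin n → Carrier) → Carrier
    expectation f = ∑ (λ a → ∑ (λ b → p a b * f a b))

    expectation-cong : ∀ {f g} → (∀ a b → f a b ≈ g a b) → expectation f ≈ expectation g
    expectation-cong f≈g = ∑-cong (λ a → ∑-cong (λ b → *-congˡ (f≈g a b)))

    expectation-mono-≤ : ∀ {f g} → (∀ a b → f a b ≤ g a b) → expectation f ≤ expectation g
    expectation-mono-≤ f≤g = ∑-mono-≤ (λ a → ∑-mono-≤ (λ b → *-monoˡ-≤ (p a b) (0≤p a b) (f≤g a b)))

    expectation-+ : ∀ f g → expectation (λ a b → f a b + g a b) ≈ expectation f + expectation g
    expectation-+ f g = trans (∑-cong (λ a → trans (∑-cong (λ b → distribˡ _ _ _)) (∑-+ _ _))) (∑-+ _ _)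

    expectation-*ʳ : ∀ f c → expectation (λ a b → f a b * c) ≈ expectation f * c
    expectation-*ʳ f c = trans (∑-cong (λ a → trans (∑-cong (λ b → sym (*-assoc _ _ _))) (∑-*ʳ c _))) (∑-*ʳ c _)

    expectation-*ˡ : ∀ c f → expectation (λ a b → c * f a b) ≈ c * expectation f
    expectation-*ˡ c f = trans (expectation-cong (λ a b → *-comm _ _)) (trans (expectation-*ʳ f c) (*-comm _ _))

    expectation-const : ∀ c → expectation (λ _ _ → c) ≈ c
    expectation-const c = trans (∑-cong (λ a → ∑-*ʳ c _)) (trans (∑-*ʳ c _) (trans (*-congʳ ∑p≈1) (*-identityˡ c)))

    -- The product measure of `N` draws, integrated one draw at a time.
    probability : ∀ N → (Vec (Fin n × Fin n) N → Bool) → Carrier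
    probability zero    P = indicator (P [])
    probability (suc N) P = expectation (λ a b → probability N (λ es → P ((a , b) ∷ es)))

    probability-true : ∀ N → probability N (λ _ → true) ≈ 1#
    probability-true zero    = refl
    probability-true (suc N) = trans (expectation-cong (λ _ _ → probability-true N)) (expectation-const 1#)

    probability-false : ∀ N → probability N (λ _ → false) ≈ 0#
    probability-false zero    = refl
    probability-false (suc N) = trans (expectation-cong (λ _ _ → probability-false N)) (expectation-const 0#)

    probability-∨ : ∀ N P Q → probability N (λ es → P es ∨ Q es) ≤ probability N P + probability N Q
    probability-∨ zero P Q = indicator-∨ (P []) (Q [])
      where
      indicator-∨ : ∀ b c → indicator (b ∨ c) ≤ indicator b + indicator c
      indicator-∨ true  c = ≤-respˡ (+-identityʳ 1#) (+-mono-≤ ≤-refl (indicator-nonNegative c))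
      indicator-∨ false c = ≤-reflexive (sym (+-identityˡ _))
    probability-∨ (suc N) P Q = ≤-respʳ (expectation-+ _ _) (expectation-mono-≤ (λ a b → probability-∨ N _ _))

    probability-∧ : ∀ N c Q → probability N (λ es → c ∧ Q es) ≈ indicator c * probability N Q
    probability-∧ N true  Q = sym (*-identityˡ _)
    probability-∧ N false Q = trans (probability-false N) (sym (zeroˡ _))

    Possible : Fin n × Fin n → Set
    Possible (a , b) = 0# < p a b

    -- An average below `1` has a term of positive weight below `1`; descend along it. Recording
    -- positive weights is what later confines the sequence to edges of `F`.
    possible : ∀ N P → probability N P < 1# → ∃[ es ] (All Possible es × P es ≡ false)
    possible zero P Pr<1 = [] , [] , refute (P []) Pr<1
      where
      refute : ∀ b → indicator b < 1# → b ≡ false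
      refute true  1<1 = contradiction ≤-refl 1<1
      refute false _   = ≡.refl
    possible (suc N) P Pr<1 = search (Fin.any? (λ a → Fin.any? (λ b → ¬? (p a b ≤? 0#) ×-dec ¬? (1# ≤? rest a b))))
      where
      rest : Fin n → Fin n → Carrier
      rest a b = probability N (λ es → P ((a , b) ∷ es))
      Candidate : Fin n → Fin n → Set
      Candidate a b = 0# < p a b × rest a b < 1#
      search : Dec (∃[ a ] ∃[ b ] Candidate a b) → ∃[ es ] (All Possible es × P es ≡ false)
      search (yes (a , b , 0<p , rest<1)) with possible N _ rest<1
      ... | es , all , Pes = (a , b) ∷ es , 0<p ∷ all , Pes
      search (no none) = contradiction (begin
          1#                                     ≈⟨ ∑p≈1 ⟨
          ∑ (λ a → ∑ (λ b → p a b))              ≤⟨ ∑-mono-≤ (λ a → ∑-mono-≤ (λ b → p≤ a b)) ⟩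
          expectation rest                       ∎) Pr<1
        where
        p≤ : ∀ a b → p a b ≤ p a b * rest a b
        p≤ a b with p a b ≤? 0# | 1# ≤? rest a b
        ... | yes p≤0 | _       = ≤-reflexive (trans p≈0 (sym (trans (*-congʳ p≈0) (zeroˡ _))))
          where p≈0 = ≤-antisym p≤0 (0≤p a b)
        ... | no  _   | yes 1≤r = ≤-respˡ (*-identityʳ _) (*-monoˡ-≤ (p a b) (0≤p a b) 1≤r)
        ... | no  0<p | no  r<1 = contradiction (a , b , 0<p , r<1) none

    module _ (G : Graph n) (sparseFor : (Fin n → Bool) → Fin n → Bool) (q η y : Carrier)
             (0≤q : 0# ≤ q) (0≤η : 0# ≤ η) (1≤y : 1# ≤ y) (ηy≈1 : η * y ≈ 1#)
             (sparse≤ : ∀ S → expectation (λ a b → indicator (S b) * indicator (sparseFor S a)) ≤ fromℕ 6 * η)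
             (shrink : ∀ S a → sparseFor S a ≡ false → size (S ∖N[ G ] a) ≤ q * size S)
             (shrink≤ : ∀ S a → size (S ∖N[ G ] a) ≤ size S) where

      private
        R : Carrier
        R = fromℕ 7 * η

        0≤R : 0# ≤ R
        0≤R = *-nonNegative (fromℕ-nonNegative 7) 0≤η

        0≤y : 0# ≤ y
        0≤y = ≤-trans 0≤1 1≤y

        -- `N ^ k` accounts for the positions, each entry costs `R`, and each dense choice still
        -- allowed is refunded by one factor `y`, the inverse of `η`.
        bound : ℕ → ℕ → ℕ → Carrier
        bound N k t = fromℕ N ^ k * (R ^ k * y ^ t)

        bound-nonNegative : ∀ N k t → 0# ≤ bound N k t
        bound-nonNegative N k t = *-nonNegative (^-nonNegative k (fromℕ-nonNegative N)) (*-nonNegative (^-nonNegative k 0≤R) (^-nonNegative t 0≤y))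

        1≤y^ : ∀ t → 1# ≤ y ^ t
        1≤y^ t = ≤-respˡ (1^n≈1 t) (^-monoˡ-≤ t 0≤1 1≤y)

      -- t bounds the number of dense choices: each multiplies |S| by at most q, so none is left once |S| qᵗ < 1.
      independent-unlikely : ∀ N k t S → size S * q ^ t < 1# →
        fromℕ (k !) * probability N (hasIndependent G k S) ≤ fromℕ N ^ k * ((fromℕ 7 * η) ^ k * y ^ t)
      independent-unlikely N zero t S _ = begin
        fromℕ 1 * probability N (λ _ → true)    ≈⟨ *-cong (+-identityʳ 1#) (probability-true N) ⟩
        1# * 1#                                 ≤⟨ *-monoˡ-≤ 1# 0≤1 (1≤y^ t) ⟩
        1# * y ^ t                              ≈⟨ *-congˡ (*-identityˡ _) ⟨
        1# * (1# * y ^ t)                       ∎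
      independent-unlikely zero (suc k) t S _ =
        ≤-trans (≤-reflexive (zeroʳ _)) (bound-nonNegative zero (suc k) t)
      independent-unlikely (suc N) (suc k) t S small = begin
        fromℕ (suc k !) * probability (suc N) (hasIndependent G (suc k) S)
          ≤⟨ *-monoˡ-≤ _ (fromℕ-nonNegative (suc k !)) (≤-trans
               (expectation-mono-≤ (λ a b → ≤-trans (probability-∨ N (hasIndependent G (suc k) S) (λ es → S b ∧ hasIndependent G k (S ∖N[ G ] a) es)) (+-mono-≤ ≤-refl (≤-reflexive (probability-∧ N (S b) _)))))
               (≤-reflexive (trans (expectation-+ _ _) (+-congʳ (expectation-const _))))) ⟩
        fromℕ (suc k !) * (later + first)
          ≈⟨ trans (distribˡ _ _ _) (+-congˡ (trans (*-congʳ (fromℕ-* (suc k) (k !))) (*-assoc _ _ _))) ⟩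
        fromℕ (suc k !) * later + fromℕ (suc k) * (fromℕ (k !) * first)
          ≤⟨ +-mono-≤ (independent-unlikely N (suc k) t S small) (*-monoˡ-≤ _ (fromℕ-nonNegative (suc k)) first≤) ⟩
        bound N (suc k) t + fromℕ (suc k) * (R * bound N k t)
          ≈⟨ solve 6 (λ x r p q z s → x :* p :* (r :* q :* z) :+ s :* (r :* (p :* (q :* z))) :=
              (x :* p :+ s :* p) :* (r :* q :* z))
               refl (fromℕ N) R (fromℕ N ^ k) (R ^ k) (y ^ t) (fromℕ (suc k)) ⟩
        (fromℕ N ^ suc k + fromℕ (suc k) * fromℕ N ^ k) * (R ^ suc k * y ^ t)
          ≤⟨ *-monoʳ-≤ _ (*-nonNegative (^-nonNegative (suc k) 0≤R) (^-nonNegative t 0≤y)) ([x+1]^[1+k] k (fromℕ-nonNegative N)) ⟩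
        bound (suc N) (suc k) t ∎
        where
        later = probability N (hasIndependent G (suc k) S)
        after : Fin n → Carrier
        after a = probability N (hasIndependent G k (S ∖N[ G ] a))
        first = expectation (λ a b → indicator (S b) * after a)

        small-later : ∀ a → size (S ∖N[ G ] a) * q ^ t < 1#
        small-later a = ≤-<-trans (*-monoʳ-≤ (q ^ t) (^-nonNegative t 0≤q) (shrink≤ S a)) small

        -- The right side is shaped for averaging: its first summand has mean at most `6 * η`, and
        -- the flat `η` pays for dense choices, where `η * y = 1` makes up for the step from `t` to
        -- `t′`.
        choice≤ : ∀ a b s d → S b ≡ s → sparseFor S a ≡ d →
          fromℕ (k !) * (indicator s * after a) ≤ (indicator s * indicator d + η) * bound N k t
        choice≤ a b false d _ _ = ≤-trans (≤-reflexive (trans (*-congˡ (zeroˡ _)) (zeroʳ _)))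
          (*-nonNegative (+-nonNegative (*-nonNegative ≤-refl (indicator-nonNegative d)) 0≤η) (bound-nonNegative N k t))
        choice≤ a b true true _ _ = begin
          fromℕ (k !) * (1# * after a)        ≈⟨ *-congˡ (*-identityˡ _) ⟩
          fromℕ (k !) * after a               ≤⟨ independent-unlikely N k t (S ∖N[ G ] a) (small-later a) ⟩
          bound N k t                         ≤⟨ ≤-certificate (*-nonNegative 0≤η (bound-nonNegative N k t))
                                                   (solve 2 (λ e b → (con (+ 1) :* con (+ 1) :+ e) :* b :- b :=
                                                       e :* b) refl η (bound N k t)) ⟩
          (1# * 1# + η) * bound N k t         ∎
        choice≤ a b true false Sb dense = dense≤ t ≡.refl
          where
          dense≤ : ∀ t′ → t ≡ t′ → fromℕ (k !) * (1# * after a) ≤ (1# * 0# + η) * bound N k t′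
          -- With `t = 0` the hypothesis reads `size S < 1`, yet `b` lies in `S`.
          dense≤ zero t≡0 = contradiction (≤-respʳ (sym (trans (*-congˡ (^-congʳ q t≡0)) (*-identityʳ _))) (size-positive S b Sb)) small
          dense≤ (suc t′) t≡1+t′ = begin
            fromℕ (k !) * (1# * after a)                 ≈⟨ *-congˡ (*-identityˡ _) ⟩
            fromℕ (k !) * after a                        ≤⟨ independent-unlikely N k t′ (S ∖N[ G ] a) smaller ⟩
            bound N k t′                                 ≈⟨ *-identityˡ _ ⟨
            1# * bound N k t′                            ≈⟨ *-congʳ ηy≈1 ⟨
            η * y * bound N k t′
              ≈⟨ solve 5 (λ e y p r z → e :* y :* (p :* (r :* z)) := (con (+ 1) :* con (+ 0) :+ e) :* (p :* (r :* (y :* z))))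
                                                              refl η y (fromℕ N ^ k) (R ^ k) (y ^ t′) ⟩
            (1# * 0# + η) * bound N k (suc t′)           ∎
            where
            smaller : size (S ∖N[ G ] a) * q ^ t′ < 1#
            smaller = ≤-<-trans (≤-trans (*-monoʳ-≤ (q ^ t′) (^-nonNegative t′ 0≤q) (shrink S a dense))
              (≤-reflexive (trans (solve 3 (λ q s p → q :* s :* p :=
                  s :* (q :* p)) refl q (size S) (q ^ t′)) (*-congˡ (^-congʳ q (≡.sym t≡1+t′)))))) small

        first≤ : fromℕ (k !) * first ≤ R * bound N k t
        first≤ = begin
          fromℕ (k !) * first
            ≈⟨ expectation-*ˡ (fromℕ (k !)) _ ⟨
          expectation (λ a b → fromℕ (k !) * (indicator (S b) * after a))
            ≤⟨ expectation-mono-≤ (λ a b → choice≤ a b (S b) (sparseFor S a) ≡.refl ≡.refl) ⟩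
          expectation (λ a b → (indicator (S b) * indicator (sparseFor S a) + η) * bound N k t)
            ≈⟨ trans (expectation-*ʳ _ _) (*-congʳ (trans (expectation-+ _ _) (+-congˡ (expectation-const η)))) ⟩
          (expectation (λ a b → indicator (S b) * indicator (sparseFor S a)) + η) * bound N k t
            ≤⟨ *-monoʳ-≤ _ (bound-nonNegative N k t) (+-mono-≤ (sparse≤ S) ≤-refl) ⟩
          (fromℕ 6 * η + η) * bound N k t
            ≈⟨ *-congʳ (solve 1 (λ e → con (+ 6) :* e :+ e := con (+ 7) :* e) refl η) ⟩
          R * bound N k t ∎

-- Increasing rearrangement of injections.

Increasing : ∀ {k N} → (Fin k → Fin N) → Set
Increasing g = ∀ i j → i Fin.< j → g i Fin.< g j

lower : ∀ {k N} (f : Fin k → Fin (suc N)) → (∀ i → f i ≢ zero) → ∃[ f′ ] (∀ i → f i ≡ suc {N} (f′ i))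
lower {k} {N} f f≢0 = (λ i → proj₁ (step (f i) (f≢0 i))) , λ i → proj₂ (step (f i) (f≢0 i))
  where
  step : (x : Fin (suc N)) → x ≢ zero → ∃[ y ] (x ≡ suc y)
  step zero    x≢0 = contradiction ≡.refl x≢0
  step (suc x) _   = x , ≡.refl

-- Induction on the codomain: if `zero` is a value, its preimage is punched out and `zero` put in
-- front; otherwise all values are lowered by one.
sort : ∀ {k N} (f : Fin k → Fin N) → Injective _≡_ _≡_ f → ∃[ g ] (Increasing g × (∀ i → ∃[ j ] (g i ≡ f j)))
sort {zero} f _ = f , (λ ()) , λ ()
sort {suc k} {zero} f _ = contradiction (f zero) λ ()
sort {suc k} {suc N} f f-inj = split (Fin.any? (λ j → f j Fin.≟ zero))
  where
  split : Dec (∃[ j ] (f j ≡ zero)) → ∃[ g ] (Increasing g × (∀ i → ∃[ j ] (g i ≡ f j)))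
  split (no none) = recurse (lower f (λ i fi≡0 → none (i , fi≡0)))
    where
    recurse : ∃[ f′ ] (∀ i → f i ≡ suc (f′ i)) → ∃[ g ] (Increasing g × (∀ i → ∃[ j ] (g i ≡ f j)))
    recurse (f′ , f≡) with sort f′ (λ {i} {j} eq → f-inj (≡.trans (f≡ i) (≡.trans (≡.cong suc eq) (≡.sym (f≡ j)))))
    ... | g , g-inc , g∈f = suc ∘ g , (λ i j i<j → s≤s (g-inc i j i<j)) ,
      λ i → proj₁ (g∈f i) , ≡.trans (≡.cong suc (proj₂ (g∈f i))) (≡.sym (f≡ _))
  split (yes (j₀ , fj₀≡0)) = recurse (lower (f ∘ punchIn j₀) avoid)
    where
    avoid : ∀ i → f (punchIn j₀ i) ≢ zero
    avoid i eq = Fin.punchInᵢ≢i j₀ i (f-inj (≡.trans eq (≡.sym fj₀≡0)))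
    recurse : ∃[ f′ ] (∀ i → f (punchIn j₀ i) ≡ suc (f′ i)) → ∃[ g ] (Increasing g × (∀ i → ∃[ j ] (g i ≡ f j)))
    recurse (f′ , f≡) with sort f′ (λ {i} {j} eq → Fin.punchIn-injective j₀ i j (f-inj (≡.trans (f≡ i) (≡.trans (≡.cong suc eq) (≡.sym (f≡ j))))))
    ... | g , g-inc , g∈f = h , h-inc , h∈f
      where
      h : Fin (suc k) → Fin (suc N)
      h zero    = zero
      h (suc i) = suc (g i)
      h-inc : Increasing h
      h-inc zero    (suc j) _         = s≤s z≤n
      h-inc (suc i) (suc j) (s≤s i<j) = s≤s (g-inc i j i<j)
      h∈f : ∀ i → ∃[ j ] (h i ≡ f j)
      h∈f zero    = j₀ , ≡.sym fj₀≡0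
      h∈f (suc i) = punchIn j₀ (proj₁ (g∈f i)) , ≡.trans (≡.cong suc (proj₂ (g∈f i))) (≡.sym (f≡ _))

increasing⇒injective : ∀ {k N} {g : Fin k → Fin N} → Increasing g → ∀ i j → i Fin.< j → g i ≢ g j
increasing⇒injective g-inc i j i<j gi≡gj = ℕ.<⇒≢ (g-inc i j i<j) (≡.cong toℕ gi≡gj)

-- The graph on the positions of a sequence of edges.

module SequenceGraph {n : ℕ} (G : Graph n) where
  open Graph

  _⇝_ : Fin n × Fin n → Fin n × Fin n → Bool
  e ⇝ e′ = adj G (proj₁ e) (proj₂ e′)

  module _ {r : ℕ} (es : Vec (Fin n × Fin n) r) where

    forward : Fin r → Fin r → Bool
    forward i j = does (i Fin.<? j) ∧ (lookup es i ⇝ lookup es j)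

    sequenceGraph : Graph r
    sequenceGraph = record
      { adj     = λ i j → forward i j ∨ forward j i
      ; adj-sym = λ i j → ∨-comm (forward i j) (forward j i)
      }

    forward-< : ∀ {i j} → i Fin.< j → forward i j ≡ (lookup es i ⇝ lookup es j)
    forward-< {i} {j} i<j = ≡.cong (_∧ (lookup es i ⇝ lookup es j)) (dec-true (i Fin.<? j) i<j)

    forward-≮ : ∀ {i j} → ¬ (i Fin.< j) → forward i j ≡ false
    forward-≮ {i} {j} i≮j = ≡.cong (_∧ (lookup es i ⇝ lookup es j)) (dec-false (i Fin.<? j) i≮j)

    sequenceGraph-loopless : Loopless sequenceGraph
    sequenceGraph-loopless i edge rewrite forward-≮ (ℕ.<-irrefl {toℕ i} ≡.refl) = edge

    edge⇒⇝ : ∀ {i j} → i Fin.< j → Edge sequenceGraph i j → T (lookup es i ⇝ lookup es j)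
    edge⇒⇝ {i} {j} i<j edge = Sum.[ ≡.subst T (forward-< i<j) , (λ e → ⊥-elim (≡.subst T (forward-≮ (ℕ.<-asym i<j)) e)) ]
      (Equivalence.to (T-∨ {forward i j}) edge)

    ⇝⇒edge : ∀ {i j} → i Fin.< j → T (lookup es i ⇝ lookup es j) → Edge sequenceGraph i j
    ⇝⇒edge {i} {j} i<j e = Equivalence.from (T-∨ {forward i j}) (inj₁ (≡.subst T (≡.sym (forward-< i<j)) e))

    -- Read in the order of the sequence, the entries of a clique are a tuple excluded by `HFree`:
    -- being edges of `F` gives its diagonal, adjacency of positions gives its edges of `G`.
    clique⇒⊥ : ∀ {s} (F : Graph n) → HFree s F G → All (λ e → Edge F (proj₁ e) (proj₂ e)) es → ¬ HasClique s sequenceGraph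
    clique⇒⊥ {s} F free edges (f , f-inj , clique) = fromSorted (sort f f-inj)
      where
      fromSorted : ∃[ g ] (Increasing g × (∀ i → ∃[ j ] (g i ≡ f j))) → ⊥
      fromSorted (g , g-inc , g∈f) = free
        ( (λ i → proj₁ (lookup es (g i))) , (λ i → proj₂ (lookup es (g i)))
        , (λ i → All.lookup⁺ edges (g i))
        , λ i j i<j → edge⇒⇝ (g-inc i j i<j) (≡.subst₂ (Edge sequenceGraph) (≡.sym (proj₂ (g∈f i))) (≡.sym (proj₂ (g∈f j)))
            (clique (proj₁ (g∈f i)) (proj₁ (g∈f j)) (λ eq → increasing⇒injective g-inc i j i<j
              (≡.trans (proj₂ (g∈f i)) (≡.trans (≡.cong f eq) (≡.sym (proj₂ (g∈f j)))))))) )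

    independent⇒sorted : ∀ {k} → HasIndependentSet k sequenceGraph →
      ∃[ g ] (Increasing {k} g × (∀ i j → i Fin.< j → ¬ T (lookup es (g i) ⇝ lookup es (g j))))
    independent⇒sorted (f , f-inj , independent) with sort f f-inj
    ... | g , g-inc , g∈f = g , g-inc , λ i j i<j e →
      independent (proj₁ (g∈f i)) (proj₁ (g∈f j))
        (λ eq → increasing⇒injective g-inc i j i<j (≡.trans (proj₂ (g∈f i)) (≡.trans (≡.cong f eq) (≡.sym (proj₂ (g∈f j))))))
        (≡.subst₂ (Edge sequenceGraph) (proj₂ (g∈f i)) (proj₂ (g∈f j)) (⇝⇒edge (g-inc i j i<j) e))

  -- The head is taken exactly when `g` starts at position zero; independence then keeps all later
  -- second vertices outside the neighbourhood that is removed from `S`.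
  sorted⇒hasIndependent : ∀ {r} k (es : Vec (Fin n × Fin n) r) S (g : Fin k → Fin r) → Increasing g →
    (∀ i → T (S (proj₂ (lookup es (g i))))) → (∀ i j → i Fin.< j → ¬ T (lookup es (g i) ⇝ lookup es (g j))) →
    T (hasIndependent G k S es)
  sorted⇒hasIndependent zero es S g _ _ _ = tt
  sorted⇒hasIndependent (suc k) [] S g _ _ _ = contradiction (g zero) λ ()
  sorted⇒hasIndependent {suc r} (suc k) ((a , b) ∷ es) S g g-inc g∈S g-ind = split (g zero) ≡.refl
    where
    es⁺ : Vec (Fin n × Fin n) (suc r)
    es⁺ = (a , b) ∷ es
    0<⇒≢0 : ∀ {x : Fin (suc r)} {m} → m ℕ.< toℕ x → x ≢ zero
    0<⇒≢0 () ≡.refl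
    split : ∀ x → g zero ≡ x → T (hasIndependent G (suc k) S es ∨ (S b ∧ hasIndependent G k (S ∖N[ G ] a) es))
    split zero g0≡0 = Equivalence.from (T-∨ {hasIndependent G (suc k) S es}) (inj₂ (Equivalence.from T-∧
      (≡.subst (λ x → T (S (proj₂ (lookup es⁺ x)))) g0≡0 (g∈S zero) , recurse (lower (g ∘ suc) (λ i → 0<⇒≢0 (g-inc zero (suc i) (s≤s z≤n)))))))
      where
      recurse : ∃[ g′ ] (∀ i → g (suc i) ≡ suc (g′ i)) → T (hasIndependent G k (S ∖N[ G ] a) es)
      recurse (g′ , g≡) = sorted⇒hasIndependent k es (S ∖N[ G ] a) g′
        (λ i j i<j → ℕ.≤-pred (≡.subst₂ Fin._<_ (g≡ i) (g≡ j) (g-inc (suc i) (suc j) (s≤s i<j))))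
        (λ i → Equivalence.from T-∧ (≡.subst (λ x → T (S (proj₂ (lookup es⁺ x)))) (g≡ i) (g∈S (suc i)) ,
          T-not (≡.subst₂ (λ x y → ¬ T (lookup es⁺ x ⇝ lookup es⁺ y)) g0≡0 (g≡ i) (g-ind zero (suc i) (s≤s z≤n)))))
        (λ i j i<j → ≡.subst₂ (λ x y → ¬ T (lookup es⁺ x ⇝ lookup es⁺ y)) (g≡ i) (g≡ j) (g-ind (suc i) (suc j) (s≤s i<j)))
        where
        T-not : ∀ {b} → ¬ T b → T (not b)
        T-not {true}  ¬Tb = ¬Tb tt
        T-not {false} _   = tt
    split (suc x) g0≡1+x = Equivalence.from (T-∨ {hasIndependent G (suc k) S es}) (inj₁ (recurse (lower g g≢0)))
      where
      g≢0 : ∀ i → g i ≢ zero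
      g≢0 zero    g0≡0 = contradiction (≡.trans (≡.sym g0≡1+x) g0≡0) λ ()
      g≢0 (suc i) = 0<⇒≢0 (g-inc zero (suc i) (s≤s z≤n))
      recurse : ∃[ g′ ] (∀ i → g i ≡ suc (g′ i)) → T (hasIndependent G (suc k) S es)
      recurse (g′ , g≡) = sorted⇒hasIndependent (suc k) es S g′
        (λ i j i<j → ℕ.≤-pred (≡.subst₂ Fin._<_ (g≡ i) (g≡ j) (g-inc i j i<j)))
        (λ i → ≡.subst (λ x → T (S (proj₂ (lookup es⁺ x)))) (g≡ i) (g∈S i))
        (λ i j i<j → ≡.subst₂ (λ x y → ¬ T (lookup es⁺ x ⇝ lookup es⁺ y)) (g≡ i) (g≡ j) (g-ind i j i<j))

  sequence-not-Ramsey : ∀ {r s k} (F : Graph n) (es : Vec (Fin n × Fin n) r) → HFree s F G →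
    All (λ e → Edge F (proj₁ e) (proj₂ e)) es → hasIndependent G k (λ _ → true) es ≡ false → ¬ RamseyProperty s k r
  sequence-not-Ramsey {r} {s} {k} F es free edges none ramsey =
    Sum.[ clique⇒⊥ es F free edges , no-independent ∘ independent⇒sorted es ] (ramsey (sequenceGraph es) (sequenceGraph-loopless es))
    where
    no-independent : ¬ (∃[ g ] (Increasing {k} g × (∀ i j → i Fin.< j → ¬ T (lookup es (g i) ⇝ lookup es (g j)))))
    no-independent (g , g-inc , g-ind) = ≡.subst T none (sorted⇒hasIndependent k es (λ _ → true) g g-inc (λ _ → tt) g-ind)

-- Trivial lower bound and the case of a single vertex.

-- The edgeless graph has no clique of size two.
Ramsey⇒k≤r : ∀ {s k r} → 2 ℕ.≤ s → RamseyProperty s k r → k ℕ.≤ r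
Ramsey⇒k≤r (s≤s (s≤s _)) ramsey = Sum.[ (λ { (f , _ , clique) → ⊥-elim (clique zero (suc zero) λ ()) }) , (λ { (f , f-inj , _) → Fin.injective⇒≤ f-inj }) ]
  (ramsey (record { adj = λ _ _ → false ; adj-sym = λ _ _ → ≡.refl }) (λ _ ()))

adj-of-degree-one : ∀ {d} (G : Graph 1) → Regular G d → 1 ℕ.≤ d → T (Graph.adj G zero zero)
adj-of-degree-one G regular 1≤d = nonempty (Graph.adj G zero zero) (≡.subst (1 ℕ.≤_) (≡.sym (regular zero)) 1≤d)
  where
  nonempty : ∀ b → 1 ℕ.≤ ∣ b ∷ [] ∣ → T b
  nonempty true _ = tt

-- A positive degree on one vertex means a loop, and loops in both graphs make the constant tuple a
-- forbidden one.
not-HFree-on-one-vertex : ∀ {s dF dG} (F G : Graph 1) → Regular F dF → Regular G dG → 1 ℕ.≤ dF → 1 ℕ.≤ dG → ¬ HFree s F G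
not-HFree-on-one-vertex F G regF regG 1≤dF 1≤dG free = free
  ((λ _ → zero) , (λ _ → zero) , (λ _ → adj-of-degree-one F regF 1≤dF) , λ _ _ _ → adj-of-degree-one G regG 1≤dG)

-- The counting inequality implied by the Ramsey property.

module RamseyCounting (𝓡 : RealNumbers) where
  open RealNumbers 𝓡 hiding (zero)
  open OrderedField completeOrderedField
  open QuadraticForms completeOrderedField
  open Spectral 𝓡
  open GraphSpectrum 𝓡
  open EdgeCounts 𝓡
  open RandomSequence 𝓡
  open Graph
  open ≤-Reasoning

  degree≤n : ∀ {n d} (G : Graph (suc n)) → Regular G d → d ℕ.≤ suc n
  degree≤n G regular = ≡.subst (ℕ._≤ _) (regular zero) (∣p∣≤n (neighbourhood G zero))

  module _ {m s dF dG : ℕ} {λF λG : Carrier} (F G : Graph (suc (suc m)))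
           (isF : IsNDΛGraph dF λF F) (isG : IsNDΛGraph dG λG G) (free : HFree s F G)
           (1≤dF : 1 ℕ.≤ dF) (1≤dG : 1 ℕ.≤ dG) where

    private
      n M : Carrier
      n = fromℕ (suc (suc m))
      M = n * fromℕ dF

      0<n : 0# < n
      0<n = fromℕ-suc-positive (suc m)

      0<M : 0# < M
      0<M = *-positive 0<n (fromℕ-positive 1≤dF)

      -- Uniform on the `n * dF` ordered edges of `F`, a loop counting once.
      p : Fin (suc (suc m)) → Fin (suc (suc m)) → Carrier
      p a b = adjacencyMatrix F a b * M ⁻¹

      0≤p : ∀ a b → 0# ≤ p a b
      0≤p a b = *-nonNegative (indicator-nonNegative (adj F a b)) (⁻¹-nonNegative 0<M)

      ∑p≈1 : ∑ (λ a → ∑ (λ b → p a b)) ≈ 1#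
      ∑p≈1 = begin-equality
        ∑ (λ a → ∑ (λ b → p a b))
          ≈⟨ ∑-cong (λ a → trans (∑-*ʳ (M ⁻¹) _) (*-congʳ (adjacency-rows F (IsNDΛGraph.regular isF) a))) ⟩
        ∑ {suc (suc m)} (λ a → fromℕ dF * M ⁻¹)       ≈⟨ ∑-const (suc (suc m)) _ ⟩
        n * (fromℕ dF * M ⁻¹)                         ≈⟨ *-assoc _ _ _ ⟨
        M * M ⁻¹                                      ≈⟨ ⁻¹-inverseʳ (0<x⇒x≉0 0<M) ⟩
        1#                                            ∎

      open Probability p 0≤p ∑p≈1

      possible⇒edge : ∀ {e} → Possible e → Edge F (proj₁ e) (proj₂ e)
      possible⇒edge {a , b} = edge (adj F a b)
        where
        edge : ∀ x → 0# < indicator x * M ⁻¹ → T x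
        edge true  _   = tt
        edge false 0<0 = ⊥-elim (0<0 (≤-reflexive (zeroˡ _)))

      expectation-edges : ∀ (S A : Fin (suc (suc m)) → Bool) →
        expectation (λ a b → indicator (S b) * indicator (A a)) ≈ dot (characteristicVector A) (degreeInto F S) * M ⁻¹
      expectation-edges S A = trans (∑-cong (λ a → begin-equality
        ∑ (λ b → p a b * (indicator (S b) * indicator (A a)))
          ≈⟨ ∑-cong (λ b → solve 4 (λ f i s c → f :* i :* (s :* c) :=
              c :* i :* (f :* s)) refl (adjacencyMatrix F a b) (M ⁻¹) (indicator (S b)) (indicator (A a))) ⟩
        ∑ (λ b → indicator (A a) * M ⁻¹ * (adjacencyMatrix F a b * indicator (S b)))
          ≈⟨ ∑-*ˡ _ _ ⟩
        indicator (A a) * M ⁻¹ * degreeInto F S a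
          ≈⟨ solve 3 (λ c i d → c :* i :* d := c :* d :* i) refl (indicator (A a)) (M ⁻¹) (degreeInto F S a) ⟩
        indicator (A a) * degreeInto F S a * M ⁻¹ ∎)) (∑-*ʳ (M ⁻¹) _)

    -- If the inequality failed, independent `k`-sets would have probability below `1`, and some
    -- sequence of edges of `F` would contradict the Ramsey property. Here `h` is half the density
    -- of `G`, the share of `S` lost at each dense choice.
    factorial≤ : ∀ {η y h} → 0# ≤ η → 1# ≤ y → η * y ≈ 1# →
      λG * λG ≤ η * (fromℕ dG * fromℕ dG) → λF * λG ≤ η * (fromℕ dF * fromℕ dG) →
      fromℕ 2 * h * n ≈ fromℕ dG →
      ∀ {r k} t → n * (1# - h) ^ t < 1# → RamseyProperty s k r →
      fromℕ (k !) ≤ fromℕ r ^ k * ((fromℕ 7 * η) ^ k * y ^ t)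
    factorial≤ {η} {y} {h} 0≤η 1≤y ηy≈1 hG hFG 2hn≈dG {r} {k} t small ramsey
      with fromℕ (k !) ≤? fromℕ r ^ k * ((fromℕ 7 * η) ^ k * y ^ t)
    ... | yes bounded = bounded
    ... | no  unbounded = ⊥-elim (refute (possible r (hasIndependent G k (λ _ → true)) Pr<1))
      where
      cF : Carrier
      cF = fromℕ dF / n

      0≤1-h : 0# ≤ 1# - h
      0≤1-h = x≤y⇒0≤y-x (*-cancelˡ-≤ (fromℕ 2 * n) (*-positive (fromℕ-suc-positive 1) 0<n) (begin
        fromℕ 2 * n * h      ≈⟨ solve 2 (λ n h → con (+ 2) :* n :* h := con (+ 2) :* h :* n) refl n h ⟩
        fromℕ 2 * h * n      ≈⟨ 2hn≈dG ⟩
        fromℕ dG             ≤⟨ fromℕ-mono-≤ (degree≤n G (IsNDΛGraph.regular isG)) ⟩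
        n                    ≤⟨ ≤-certificate (<⇒≤ 0<n) (solve 1 (λ n → con (+ 2) :* n :* con (+ 1) :- n := n) refl n) ⟩
        fromℕ 2 * n * 1#     ∎))

      sparse≤ : ∀ S → expectation (λ a b → indicator (S b) * indicator (sparse G (fromℕ 2 * h) S a)) ≤ fromℕ 6 * η
      sparse≤ S = ≤-respˡ (sym (expectation-edges S (sparse G (fromℕ 2 * h) S))) (x≤z*y⇒x/y≤z 0<M
        (sparse-edges-other F G isF isG (fromℕ-positive 1≤dF) (fromℕ-positive 1≤dG) 0≤η hG hFG cF (fromℕ 2 * h)
          (x/y*y≈x (fromℕ dF) (0<x⇒x≉0 0<n)) 2hn≈dG S))

      shrink : ∀ S a → sparse G (fromℕ 2 * h) S a ≡ false → size (S ∖N[ G ] a) ≤ (1# - h) * size S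
      shrink S a dense = *-cancelˡ-≤ (fromℕ 2) (fromℕ-suc-positive 1) (≤-respʳ
        (solve 2 (λ h s → (con (+ 2) :- con (+ 2) :* h) :* s := con (+ 2) :* ((con (+ 1) :- h) :* s)) refl h (size S))
        (size-∖N-dense G (fromℕ 2 * h) S a dense))

      shrink≤ : ∀ S a → size (S ∖N[ G ] a) ≤ size S
      shrink≤ S a = ≤-respˡ (sym (size-∖N G S a)) (≤-certificate
        (∑-nonNegative (λ v → *-nonNegative (indicator-nonNegative (adj G a v)) (indicator-nonNegative (S v))))
        (solve 2 (λ s e → s :- (s :- e) := e) refl (size S) (degreeInto G S a)))

      Pr<1 : probability r (hasIndependent G k (λ _ → true)) < 1#
      Pr<1 1≤Pr = unbounded (begin
        fromℕ (k !)                                                     ≈⟨ *-identityʳ _ ⟨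
        fromℕ (k !) * 1#                                                ≤⟨ *-monoˡ-≤ _ (fromℕ-nonNegative (k !)) 1≤Pr ⟩
        fromℕ (k !) * probability r (hasIndependent G k (λ _ → true))
          ≤⟨ independent-unlikely G (sparse G (fromℕ 2 * h)) (1# - h) η y 0≤1-h 0≤η 1≤y ηy≈1
                                                                             sparse≤ shrink shrink≤ r k t (λ _ → true) full-small ⟩
        fromℕ r ^ k * ((fromℕ 7 * η) ^ k * y ^ t)                       ∎)
        where
        full-small : size {suc (suc m)} (λ _ → true) * (1# - h) ^ t < 1#
        full-small = ≤-<-trans (≤-reflexive (*-congʳ (trans (∑-const (suc (suc m)) 1#) (*-identityʳ n)))) small

      refute : ¬ (∃[ es ] (All.All Possible es × hasIndependent {N = r} G k (λ _ → true) es ≡ false))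
      refute (es , all-possible , none) = SequenceGraph.sequence-not-Ramsey G F es free (All.map possible⇒edge all-possible) none ramsey

-- Numerical estimates and the two lower bounds.

module Bounds (𝓡 : RealNumbers) where
  open RealNumbers 𝓡 hiding (zero)
  open OrderedField completeOrderedField
  open Series completeOrderedField
  open Exponential 𝓡
  open Spectral 𝓡
  open RamseyCounting 𝓡
  open ≤-Reasoning

  -- Rounding up by descent from a natural number already known to exceed `x`.
  natural-above : ∀ k {x} → 0# ≤ x → x < fromℕ k → ∃[ t ] (x < fromℕ t × fromℕ t ≤ x + 1#)
  natural-above zero 0≤x x<0 = contradiction 0≤x x<0
  natural-above (suc k) {x} 0≤x x<1+k with fromℕ k ≤? x
  ... | yes k≤x = suc k , x<1+k , ≤-respʳ (+-comm 1# x) (+-monoʳ-≤ 1# k≤x)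
  ... | no  x<k = natural-above k 0≤x x<k

  -- Square the estimate `exp (1/2) ≤ 2`, which is the geometric comparison at `u = 1/2`.
  exp1≤4 : exp 1# ≤ fromℕ 4
  exp1≤4 = begin
    exp 1#                    ≈⟨ exp-cong h+h≈1 ⟨
    exp (h + h)               ≈⟨ exp-+ h h ⟩
    exp h * exp h             ≤⟨ *-mono-≤ (exp-nonNegative h) exp-h≤2 (exp-nonNegative h) exp-h≤2 ⟩
    fromℕ 2 * fromℕ 2         ≈⟨ fromℕ-* 2 2 ⟨
    fromℕ 4                   ∎
    where
    h = fromℕ 2 ⁻¹
    2≉0 = 0<x⇒x≉0 (fromℕ-suc-positive 1)
    0≤h = ⁻¹-nonNegative (fromℕ-suc-positive 1)
    h+h≈1 : h + h ≈ 1#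
    h+h≈1 = trans (solve 1 (λ h → h :+ h := con (+ 2) :* h) refl h) (⁻¹-inverseʳ 2≉0)
    exp-h≤2 : exp h ≤ fromℕ 2
    exp-h≤2 = begin
      exp h                             ≈⟨ *-identityʳ _ ⟨
      exp h * 1#                        ≈⟨ *-congˡ h+h≈1 ⟨
      exp h * (h + h)                   ≈⟨ solve 2 (λ e h → e :* (h :+ h) := con (+ 2) :* (e :* ((h :+ h) :- h))) refl (exp h) h ⟩
      fromℕ 2 * (exp h * (h + h - h))   ≈⟨ *-congˡ (*-congˡ (+-congʳ h+h≈1)) ⟩
      fromℕ 2 * (exp h * (1# - h))      ≤⟨ *-monoˡ-≤ _ (fromℕ-nonNegative 2) (exp*[1-u]≤1 0≤h h≤1) ⟩
      fromℕ 2 * 1#                      ≈⟨ *-identityʳ _ ⟩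
      fromℕ 2                           ∎
      where
      h≤1 : h ≤ 1#
      h≤1 = ≤-certificate 0≤h (trans (+-congʳ (sym h+h≈1)) (solve 1 (λ h → h :+ h :- h := h) refl h))

  -- kᵏ / k! is a term of the series of exp k.
  k^k≤4^k*k! : ∀ k → fromℕ k ^ k ≤ fromℕ 4 ^ k * fromℕ (k !)
  k^k≤4^k*k! k = ≤-trans (x/y≤z⇒x≤z*y (0<n! k) term≤exp) (*-monoʳ-≤ _ (fromℕ-nonNegative (k !)) (begin
    exp (fromℕ k)          ≈⟨ exp-cong (*-identityʳ _) ⟨
    exp (fromℕ k * 1#)     ≈⟨ exp-^ k 1# ⟩
    exp 1# ^ k             ≤⟨ ^-monoˡ-≤ k (exp-nonNegative 1#) exp1≤4 ⟩
    fromℕ 4 ^ k            ∎))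
    where
    0≤k = fromℕ-nonNegative k
    term≤exp : term (fromℕ k) k ≤ exp (fromℕ k)
    term≤exp = limit-≥ (suc k) (λ m k<m → ≤-respʳ (sym (sum≈partial (term (fromℕ k)) m)) (≤-trans
      (≤-respˡ (+-identityˡ _) (+-mono-≤ (partial-nonNegative k (λ i → term-nonNegative i 0≤k)) ≤-refl))
      (partial-monoʳ-≤ (λ i → term-nonNegative i 0≤k) k<m))) (exp-series (fromℕ k))

  -- Multiply `1 - L ≤ exp (- L)` by `n = exp L` and use `2 ≤ n`. For `L ≥ 1` there is nothing to
  -- do.
  1≤2L : ∀ {n L} → fromℕ 2 ≤ n → exp L ≈ n → 1# ≤ fromℕ 2 * L
  1≤2L {n} {L} 2≤n exp-L with ≤-total 1# L
  ... | inj₁ 1≤L = ≤-certificate (+-nonNegative (+-nonNegative (x≤y⇒0≤y-x 1≤L) (x≤y⇒0≤y-x 1≤L)) 0≤1)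
    (solve 1 (λ L → con (+ 2) :* L :- con (+ 1) := (L :- con (+ 1)) :+ (L :- con (+ 1)) :+ con (+ 1)) refl L)
  ... | inj₂ L≤1 = ≤-certificate (x≤y⇒0≤y-x 2[1-L]≤1) (solve 1 (λ L → con (+ 2) :* L :- con (+ 1) :=
      con (+ 1) :- con (+ 2) :* (con (+ 1) :+ (:- L))) refl L)
    where
    2[1-L]≤1 : fromℕ 2 * (1# + - L) ≤ 1#
    2[1-L]≤1 = begin
      fromℕ 2 * (1# + - L)    ≤⟨ *-monoʳ-≤ _ (x≤y⇒0≤y-x L≤1) 2≤n ⟩
      n * (1# + - L)          ≈⟨ *-congʳ exp-L ⟨
      exp L * (1# + - L)      ≤⟨ *-monoˡ-≤ _ (exp-nonNegative L) (1+x≤exp (- L)) ⟩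
      exp L * exp (- L)       ≈⟨ exp-neg L ⟩
      1#                      ∎

  -- Since `(1 - h) ^ t ≤ exp (- t h)`, the product is below `1` as soon as `t > L / h`, and
  -- `L / h = 2 n L / d` is half of `w`.
  few-dense-steps : ∀ {n L d w h} → 0# < n → 0# < d → exp L ≈ n → w * d ≈ fromℕ 4 * n * L → fromℕ 2 * h * n ≈ d → 0# ≤ 1# - h →
    ∀ t → w < fromℕ 2 * fromℕ t → n * (1# - h) ^ t < 1#
  few-dense-steps {n} {L} {d} {w} {h} 0<n 0<d exp-L wd≈ 2hn≈d 0≤1-h t w<2t 1≤ = w<2t
    (*-cancelˡ-≤ d 0<d (begin
      d * (fromℕ 2 * fromℕ t)                   ≈⟨ *-congʳ 2hn≈d ⟨
      fromℕ 2 * h * n * (fromℕ 2 * fromℕ t)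
        ≈⟨ solve 3 (λ h n t → con (+ 2) :* h :* n :* (con (+ 2) :* t) := con (+ 4) :* n :* (t :* h)) refl h n (fromℕ t) ⟩
      fromℕ 4 * n * (fromℕ t * h)               ≤⟨ *-monoˡ-≤ _ (*-nonNegative (fromℕ-nonNegative 4) (<⇒≤ 0<n)) th≤L ⟩
      fromℕ 4 * n * L                           ≈⟨ wd≈ ⟨
      w * d                                     ≈⟨ *-comm _ _ ⟩
      d * w                                     ∎))
    where
    th≤L : fromℕ t * h ≤ L
    th≤L = ≤-certificate (exp-cancel-≤ (begin
      exp 0#                                    ≈⟨ exp0≈1 ⟩
      1#                                        ≤⟨ 1≤ ⟩
      n * (1# - h) ^ t                          ≤⟨ *-monoˡ-≤ n (<⇒≤ 0<n) (^-monoˡ-≤ t 0≤1-h (1+x≤exp (- h))) ⟩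
      n * exp (- h) ^ t                         ≈⟨ *-cong exp-L (exp-^ t (- h)) ⟨
      exp L * exp (fromℕ t * - h)               ≈⟨ exp-+ L _ ⟨
      exp (L + fromℕ t * - h)                   ∎)) (solve 3 (λ L t h → L :- t :* h := L :+ t :* (:- h)) refl L (fromℕ t) h)

  module _ {m s dF dG : ℕ} {λF λG : Carrier} (F G : Graph (suc (suc m))) (2≤s : 2 ℕ.≤ s)
           (isF : IsNDΛGraph dF λF F) (isG : IsNDΛGraph dG λG G) (free : HFree s F G)
           (1≤dF : 1 ℕ.≤ dF) (1≤dG : 1 ℕ.≤ dG) (η₀ : Carrier) (0<η : 0# < η₀)
           (hG : λG * λG ≤ η₀ * (fromℕ dG * fromℕ dG)) (hFG : λF * λG ≤ η₀ * (fromℕ dF * fromℕ dG)) where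

    private
      n d L ℓ W i₅₀ : Carrier
      n = fromℕ (suc (suc m))
      d = fromℕ dG
      L = log n
      ℓ = log η₀
      W = w (suc (suc m)) dG
      i₅₀ = 1# / fromℕ 50

      0<n : 0# < n
      0<n = fromℕ-suc-positive (suc m)

      0<d : 0# < d
      0<d = fromℕ-positive 1≤dG

      d≤n : d ≤ n
      d≤n = fromℕ-mono-≤ (degree≤n G (IsNDΛGraph.regular isG))

      exp-L : exp L ≈ n
      exp-L = exp-log n 0<n

      exp-ℓ : exp ℓ ≈ η₀
      exp-ℓ = exp-log η₀ 0<η

      Wd≈ : W * d ≈ fromℕ 4 * n * L
      Wd≈ = x/y*y≈x _ (0<x⇒x≉0 0<d)

      1≤2·L : 1# ≤ fromℕ 2 * L
      1≤2·L = 1≤2L (fromℕ-mono-≤ {2} {suc (suc m)} (s≤s (s≤s z≤n))) exp-L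

      0≤L : 0# ≤ L
      0≤L = *-cancelˡ-≤ (fromℕ 2) (fromℕ-suc-positive 1) (≤-trans (≤-reflexive (zeroʳ _)) (≤-trans 0≤1 1≤2·L))

      0≤W : 0# ≤ W
      0≤W = *-nonNegative (*-nonNegative (*-nonNegative (fromℕ-nonNegative 4) (<⇒≤ 0<n)) 0≤L) (⁻¹-nonNegative 0<d)

      2≤W : fromℕ 2 ≤ W
      2≤W = z*y≤x⇒z≤x/y 0<d (begin
        fromℕ 2 * d                 ≤⟨ *-monoˡ-≤ _ (fromℕ-nonNegative 2) d≤n ⟩
        fromℕ 2 * n                 ≈⟨ *-identityʳ _ ⟨
        fromℕ 2 * n * 1#            ≤⟨ *-monoˡ-≤ _ (*-nonNegative (fromℕ-nonNegative 2) (<⇒≤ 0<n)) 1≤2·L ⟩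
        fromℕ 2 * n * (fromℕ 2 * L) ≈⟨ solve 2 (λ n L → con (+ 2) :* n :* (con (+ 2) :* L) := con (+ 4) :* n :* L) refl n L ⟩
        fromℕ 4 * n * L             ∎)

      h : Carrier
      h = d / (fromℕ 2 * n)

      2hn≈d : fromℕ 2 * h * n ≈ d
      2hn≈d = trans (solve 2 (λ h n → con (+ 2) :* h :* n := h :* (con (+ 2) :* n)) refl h n)
        (x/y*y≈x d (0<x⇒x≉0 (*-positive (fromℕ-suc-positive 1) 0<n)))

      0≤1-h : 0# ≤ 1# - h
      0≤1-h = x≤y⇒0≤y-x (x≤z*y⇒x/y≤z (*-positive (fromℕ-suc-positive 1) 0<n)
        (≤-trans d≤n (≤-certificate (<⇒≤ 0<n) (solve 1 (λ n → con (+ 1) :* (con (+ 2) :* n) :- n := n) refl n))))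

      -- Rounding `W / 2` up costs at most `1`, which the other half of `W` absorbs because `W ≥ 2`.
      -- The bound `k` only starts the search.
      steps : ∀ {k} → W ≤ fromℕ k → ∃[ t ] (W < fromℕ 2 * fromℕ t × fromℕ t ≤ W)
      steps {k} W≤k = fromNatural (natural-above (suc k) (*-nonNegative 0≤W (⁻¹-nonNegative 0<2)) x<1+k)
        where
        0<2 : 0# < fromℕ 2
        0<2 = fromℕ-suc-positive 1
        x : Carrier
        x = W / fromℕ 2
        x*2≈W : x * fromℕ 2 ≈ W
        x*2≈W = x/y*y≈x W (0<x⇒x≉0 0<2)
        x≤W : x ≤ W
        x≤W = x≤z*y⇒x/y≤z 0<2 (≤-certificate 0≤W (solve 1 (λ W → W :* con (+ 2) :- W := W) refl W))
        x<1+k : x < fromℕ (suc k)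
        x<1+k 1+k≤x = 0<1 (≤-certificate (x≤y⇒0≤y-x (≤-trans 1+k≤x (≤-trans x≤W W≤k)))
          (solve 1 (λ k → con (+ 0) :- con (+ 1) := k :- (con (+ 1) :+ k)) refl (fromℕ k)))
        1≤x : 1# ≤ x
        1≤x = z*y≤x⇒z≤x/y 0<2 (≤-respˡ (sym (*-identityˡ _)) 2≤W)
        fromNatural : ∃[ t ] (x < fromℕ t × fromℕ t ≤ x + 1#) → ∃[ t ] (W < fromℕ 2 * fromℕ t × fromℕ t ≤ W)
        fromNatural (t , x<t , t≤x+1) = t ,
          (λ 2t≤W → x<t (z*y≤x⇒z≤x/y 0<2 (≤-respˡ (*-comm _ _) 2t≤W))) ,
          ≤-trans t≤x+1 (≤-trans (+-monoʳ-≤ x 1≤x) (≤-reflexive (trans (solve 1 (λ x → x :+ x := x :* con (+ 2)) refl x) x*2≈W)))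

    lower-bound : ℕ → Carrier
    lower-bound k = i₅₀ * fromℕ k * (η₀ ^ʳ ((W - fromℕ k) / fromℕ k))

    private
      i₅₀*50≈1 : i₅₀ * fromℕ 50 ≈ 1#
      i₅₀*50≈1 = x/y*y≈x 1# (0<x⇒x≉0 (fromℕ-suc-positive 49))

      0≤i₅₀ : 0# ≤ i₅₀
      0≤i₅₀ = *-nonNegative 0≤1 (⁻¹-nonNegative (fromℕ-suc-positive 49))

      i₅₀≤1 : i₅₀ ≤ 1#
      i₅₀≤1 = x≤z*y⇒x/y≤z (fromℕ-suc-positive 49) (≤-respʳ (sym (*-identityˡ _)) (≤-respˡ (+-identityʳ 1#) (fromℕ-mono-≤ {1} {50} (s≤s z≤n))))

      -- The exponent is not positive, so the power of a base at least `1` is at most `1`.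
      large-η : ∀ {k} → 1 ℕ.≤ k → W ≤ fromℕ k → 1# ≤ η₀ → lower-bound k ≤ fromℕ k
      large-η {k} 1≤k W≤k 1≤η = begin
        i₅₀ * fromℕ k * exp e
          ≤⟨ *-mono-≤ (*-nonNegative 0≤i₅₀ 0≤k) (*-monoʳ-≤ (fromℕ k) 0≤k i₅₀≤1) (exp-nonNegative e) exp-e≤1 ⟩
        1# * fromℕ k * 1#          ≈⟨ trans (*-identityʳ _) (*-identityˡ _) ⟩
        fromℕ k                    ∎
        where
        e : Carrier
        e = (W - fromℕ k) / fromℕ k * ℓ
        0≤k = fromℕ-nonNegative k
        0≤ℓ : 0# ≤ ℓ
        0≤ℓ = exp-cancel-≤ (≤-respˡ (sym exp0≈1) (≤-respʳ (sym exp-ℓ) 1≤η))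
        exp-e≤1 : exp e ≤ 1#
        exp-e≤1 = ≤-respʳ exp0≈1 (exp-mono-≤ (≤-certificate
          (*-nonNegative (*-nonNegative (x≤y⇒0≤y-x W≤k) (⁻¹-nonNegative (fromℕ-positive 1≤k))) 0≤ℓ)
          (solve 4 (λ W k i l → con (+ 0) :- (W :- k) :* i :* l := (k :- W) :* i :* l) refl W (fromℕ k) (fromℕ k ⁻¹) ℓ)))

      -- The exponents add up to (W - t) log η ≤ 0.
      powers≤1 : ∀ {k} t → 1 ℕ.≤ k → fromℕ t ≤ W → η₀ ≤ 1# →
        (η₀ ^ʳ ((W - fromℕ k) / fromℕ k)) ^ k * (η₀ ^ k * exp (- ℓ) ^ t) ≤ 1#
      powers≤1 {k} t 1≤k t≤W η≤1 = begin
        exp ((W - K) / K * ℓ) ^ k * (η₀ ^ k * exp (- ℓ) ^ t)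
          ≈⟨ *-cong (sym (exp-^ k _)) (*-cong (trans (^-congˡ k (sym exp-ℓ)) (sym (exp-^ k ℓ))) (sym (exp-^ t (- ℓ)))) ⟩
        exp (K * ((W - K) / K * ℓ)) * (exp (K * ℓ) * exp (fromℕ t * - ℓ))
          ≈⟨ trans (*-congˡ (sym (exp-+ _ _))) (sym (exp-+ _ _)) ⟩
        exp (K * ((W - K) / K * ℓ) + (K * ℓ + fromℕ t * - ℓ))
          ≈⟨ exp-cong (begin-equality
               K * ((W - K) / K * ℓ) + (K * ℓ + fromℕ t * - ℓ)
                 ≈⟨ solve 5 (λ K W i l t → K :* ((W :- K) :* i :* l) :+ (K :* l :+ t :* (:- l)) :=
                     (W :- K) :* i :* K :* l :+ (K :* l :+ t :* (:- l))) refl K W (K ⁻¹) ℓ (fromℕ t) ⟩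
               (W - K) / K * K * ℓ + (K * ℓ + fromℕ t * - ℓ)
                 ≈⟨ +-congʳ (*-congʳ (x/y*y≈x (W - K) (0<x⇒x≉0 (fromℕ-positive 1≤k)))) ⟩
               (W - K) * ℓ + (K * ℓ + fromℕ t * - ℓ)
                 ≈⟨ solve 4 (λ K W l t → (W :- K) :* l :+ (K :* l :+ t :* (:- l)) :=
                     :- ((W :- t) :* (:- l))) refl K W ℓ (fromℕ t) ⟩
               - ((W - fromℕ t) * - ℓ) ∎) ⟩
        exp (- ((W - fromℕ t) * - ℓ))
          ≤⟨ exp-mono-≤ (≤-respʳ (solve 0 (:- con (+ 0) :=
              con (+ 0)) refl) (neg-mono-≤ (*-nonNegative (x≤y⇒0≤y-x t≤W) (x≤0⇒0≤-x ℓ≤0)))) ⟩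
        exp 0#
          ≈⟨ exp0≈1 ⟩
        1# ∎
        where
        K : Carrier
        K = fromℕ k
        ℓ≤0 : ℓ ≤ 0#
        ℓ≤0 = exp-cancel-≤ (≤-respˡ (sym exp-ℓ) (≤-respʳ (sym exp0≈1) η≤1))

      -- Substituting a smaller `r` into `factorial≤` makes all powers of `η₀` collapse to at most
      -- `1`, leaving `k! * 50 ^ k ≤ k ^ k * 7 ^ k ≤ k! * 28 ^ k`, which is false for `k ≥ 1`.
      small-η : ∀ {k r} → 1 ℕ.≤ k → W ≤ fromℕ k → η₀ ≤ 1# → RamseyProperty s k r → lower-bound k ≤ fromℕ r
      small-η {k} {r} 1≤k W≤k η≤1 ramsey with lower-bound k ≤? fromℕ r
      ... | yes bounded = bounded
      ... | no  r<X = ⊥-elim (withSteps (steps {k} W≤k))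
        where
        K E : Carrier
        K = fromℕ k
        E = η₀ ^ʳ ((W - K) / K)
        1≤y : 1# ≤ exp (- ℓ)
        1≤y = ≤-respˡ exp0≈1 (exp-mono-≤ (x≤0⇒0≤-x (exp-cancel-≤ (≤-respˡ (sym exp-ℓ) (≤-respʳ (sym exp0≈1) η≤1)))))
        withSteps : ∃[ t ] (W < fromℕ 2 * fromℕ t × fromℕ t ≤ W) → ⊥
        withSteps (t , W<2t , t≤W) = ℕ.<⇒≱ (power-< k 1≤k) (fromℕ-cancel-≤ (≤-respˡ (sym (fromℕ-^ 50 k)) (≤-respʳ (sym (fromℕ-^ 28 k))
          (*-cancelˡ-≤ (fromℕ (k !)) (0<n! k) 50^k≤28^k))))
          where
          power-< : ∀ k → 1 ℕ.≤ k → 28 ℕ.^ k ℕ.< 50 ℕ.^ k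
          power-< (suc k) _ = ℕ.^-monoˡ-< (suc k) (ℕ.≤ᵇ⇒≤ 29 50 _)
          y = exp (- ℓ)
          50^k≤28^k : fromℕ (k !) * fromℕ 50 ^ k ≤ fromℕ (k !) * fromℕ 28 ^ k
          50^k≤28^k = begin
            fromℕ (k !) * fromℕ 50 ^ k
              ≤⟨ *-monoʳ-≤ _ (^-nonNegative k (fromℕ-nonNegative 50)) (factorial≤ F G isF isG free 1≤dF 1≤dG (<⇒≤ 0<η) 1≤y
                   (trans (*-congʳ (sym exp-ℓ)) (exp-neg ℓ)) hG hFG 2hn≈d t
                   (few-dense-steps 0<n 0<d exp-L Wd≈ 2hn≈d 0≤1-h t W<2t) ramsey) ⟩
            fromℕ r ^ k * ((fromℕ 7 * η₀) ^ k * y ^ t) * fromℕ 50 ^ k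
              ≤⟨ *-monoʳ-≤ _ (^-nonNegative k (fromℕ-nonNegative 50)) (*-monoʳ-≤ _
                   (*-nonNegative (^-nonNegative k (*-nonNegative (fromℕ-nonNegative 7) (<⇒≤ 0<η))) (^-nonNegative t (≤-trans 0≤1 1≤y)))
                   (^-monoˡ-≤ k (fromℕ-nonNegative r) (<⇒≤ r<X))) ⟩
            (i₅₀ * K * E) ^ k * ((fromℕ 7 * η₀) ^ k * y ^ t) * fromℕ 50 ^ k
              ≈⟨ *-congʳ (*-cong (trans (^-distrib-* _ _ k) (*-congʳ (^-distrib-* _ _ k))) (*-congʳ (^-distrib-* _ _ k))) ⟩
            i₅₀ ^ k * K ^ k * E ^ k * (fromℕ 7 ^ k * η₀ ^ k * y ^ t) * fromℕ 50 ^ k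
              ≈⟨ solve 7 (λ i K E s e y f → i :* K :* E :* (s :* e :* y) :* f := (i :* f) :* (K :* s) :* (E :* (e :* y))) refl
                   (i₅₀ ^ k) (K ^ k) (E ^ k) (fromℕ 7 ^ k) (η₀ ^ k) (y ^ t) (fromℕ 50 ^ k) ⟩
            (i₅₀ ^ k * fromℕ 50 ^ k) * (K ^ k * fromℕ 7 ^ k) * (E ^ k * (η₀ ^ k * y ^ t))
              ≈⟨ *-congʳ (trans (*-congʳ (trans (sym (^-distrib-* _ _ k)) (trans (^-congˡ k i₅₀*50≈1) (1^n≈1 k)))) (*-identityˡ _)) ⟩
            K ^ k * fromℕ 7 ^ k * (E ^ k * (η₀ ^ k * y ^ t))
              ≤⟨ *-monoˡ-≤ _ (*-nonNegative (^-nonNegative k (fromℕ-nonNegative k)) (^-nonNegative k (fromℕ-nonNegative 7))) (powers≤1 t 1≤k t≤W η≤1) ⟩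
            K ^ k * fromℕ 7 ^ k * 1#
              ≈⟨ *-identityʳ _ ⟩
            K ^ k * fromℕ 7 ^ k
              ≤⟨ *-monoʳ-≤ _ (^-nonNegative k (fromℕ-nonNegative 7)) (k^k≤4^k*k! k) ⟩
            fromℕ 4 ^ k * fromℕ (k !) * fromℕ 7 ^ k
              ≈⟨ solve 3 (λ a b c → a :* b :* c := b :* (a :* c)) refl (fromℕ 4 ^ k) (fromℕ (k !)) (fromℕ 7 ^ k) ⟩
            fromℕ (k !) * (fromℕ 4 ^ k * fromℕ 7 ^ k)
              ≈⟨ *-congˡ (trans (sym (^-distrib-* _ _ k)) (^-congˡ k (sym (fromℕ-* 4 7)))) ⟩
            fromℕ (k !) * fromℕ 28 ^ k ∎

    lower-bound≤r : ∀ {k r} → 1 ℕ.≤ k → W ≤ fromℕ k → RamseyProperty s k r → lower-bound k ≤ fromℕ r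
    lower-bound≤r {k} {r} 1≤k W≤k ramsey with ≤-total η₀ 1#
    ... | inj₁ η≤1 = small-η 1≤k W≤k η≤1 ramsey
    ... | inj₂ 1≤η = ≤-trans (large-η 1≤k W≤k 1≤η) (fromℕ-mono-≤ (Ramsey⇒k≤r 2≤s ramsey))

    module _ {k : ℕ} (1≤k : 1 ℕ.≤ k) (large : (fromℕ 100 * n * L ^ 2) / d ≤ fromℕ k) (k≤ : fromℕ k ≤ η₀ * fromℕ dF * n) where

      private
        K i z u : Carrier
        K = fromℕ k
        i = K ⁻¹
        z = W * i * ℓ
        u = W * i * L

        0<K : 0# < K
        0<K = fromℕ-positive 1≤k

        0≤Wi : 0# ≤ W * i
        0≤Wi = *-nonNegative 0≤W (⁻¹-nonNegative 0<K)

        -- One factor `4 n L / d` of `100 n L² / d` is `W`.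
        25WL≤K : fromℕ 25 * (W * L) ≤ K
        25WL≤K = ≤-respˡ (begin-equality
          fromℕ 100 * n * L ^ 2 * d ⁻¹              ≈⟨ *-congʳ (*-congʳ (*-congʳ (fromℕ-* 25 4))) ⟩
          fromℕ 25 * fromℕ 4 * n * L ^ 2 * d ⁻¹
            ≈⟨ solve 5 (λ a b n L j → a :* b :* n :* (L :* (L :* con (+ 1))) :* j :=
                a :* (b :* n :* L :* j :* L)) refl (fromℕ 25) (fromℕ 4) n L (d ⁻¹) ⟩
          fromℕ 25 * (W * L)                        ∎) large

        25u≤1 : fromℕ 25 * u ≤ 1#
        25u≤1 = begin
          fromℕ 25 * u                ≈⟨ solve 4 (λ a W i L → a :* (W :* i :* L) := a :* (W :* L) :* i) refl (fromℕ 25) W i L ⟩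
          fromℕ 25 * (W * L) * i      ≤⟨ *-monoʳ-≤ i (⁻¹-nonNegative 0<K) 25WL≤K ⟩
          K * i                       ≈⟨ ⁻¹-inverseʳ (0<x⇒x≉0 0<K) ⟩
          1#                          ∎

        4u≤1 : fromℕ 4 * u ≤ 1#
        4u≤1 = ≤-trans (*-monoʳ-≤ u (*-nonNegative 0≤Wi 0≤L) (fromℕ-mono-≤ {4} {25} (ℕ.≤ᵇ⇒≤ 4 25 _))) 25u≤1

        -- Recovers the hypothesis of the first bound, using that `L` is at least one half.
        W≤K : W ≤ K
        W≤K = begin
          W                           ≈⟨ *-identityʳ _ ⟨
          W * 1#                      ≤⟨ *-monoˡ-≤ W 0≤W 1≤2·L ⟩
          W * (fromℕ 2 * L)           ≈⟨ solve 3 (λ W a L → W :* (a :* L) := a :* (W :* L)) refl W (fromℕ 2) L ⟩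
          fromℕ 2 * (W * L)           ≤⟨ *-monoʳ-≤ _ (*-nonNegative 0≤W 0≤L) (fromℕ-mono-≤ {2} {25} (s≤s (s≤s z≤n))) ⟩
          fromℕ 25 * (W * L)          ≤⟨ 25WL≤K ⟩
          K                           ∎

        -- That is, `η₀ ≥ n⁻²`: from `1 ≤ k ≤ η₀ * dF * n` and `dF ≤ n`. The logarithm of `η₀` is
        -- thus at most `2 L` below zero.
        -2L≤ℓ : - (L + L) ≤ ℓ
        -2L≤ℓ = ≤-certificate (exp-cancel-≤ (begin
          exp 0#                      ≈⟨ exp0≈1 ⟩
          1#                          ≈⟨ +-identityʳ 1# ⟨
          fromℕ 1                     ≤⟨ fromℕ-mono-≤ 1≤k ⟩
          K                           ≤⟨ k≤ ⟩
          η₀ * fromℕ dF * n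
            ≤⟨ *-monoʳ-≤ n (<⇒≤ 0<n) (*-monoˡ-≤ η₀ (<⇒≤ 0<η) (fromℕ-mono-≤ (degree≤n F (IsNDΛGraph.regular isF)))) ⟩
          η₀ * n * n                  ≈⟨ trans (*-cong exp-ℓ (trans (exp-+ L L) (*-cong exp-L exp-L))) (sym (*-assoc _ _ _)) ⟨
          exp ℓ * exp (L + L)         ≈⟨ exp-+ ℓ (L + L) ⟨
          exp (ℓ + (L + L))           ∎)) (solve 2 (λ l L → l :- (:- (L :+ L)) := l :+ (L :+ L)) refl ℓ L)

        -- By the two previous estimates `z ≥ - 2 u` and `4 u ≤ 1`, so `exp z ≥ 1 + z ≥ 1/2`. This
        -- factor turns `50` into `100`.
        1≤2exp-z : 1# ≤ fromℕ 2 * exp z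
        1≤2exp-z = ≤-trans (≤-certificate (+-nonNegative (x≤y⇒0≤y-x 4u≤1) (*-nonNegative (fromℕ-nonNegative 2) (*-nonNegative 0≤Wi (x≤y⇒0≤y-x -2L≤ℓ))))
          (solve 3 (λ v l L → con (+ 2) :* (con (+ 1) :+ v :* l) :- con (+ 1) :=
             (con (+ 1) :- con (+ 4) :* (v :* L)) :+ con (+ 2) :* (v :* (l :- (:- (L :+ L))))) refl (W * i) ℓ L))
          (*-monoˡ-≤ _ (fromℕ-nonNegative 2) (1+x≤exp z))

        η*power : (η₀ ^ʳ ((W - K) / K)) * η₀ ≈ exp z
        η*power = begin-equality
          exp ((W - K) / K * ℓ) * η₀          ≈⟨ *-congˡ exp-ℓ ⟨
          exp ((W - K) / K * ℓ) * exp ℓ       ≈⟨ exp-+ _ _ ⟨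
          exp ((W - K) / K * ℓ + ℓ)           ≈⟨ exp-cong (begin-equality
            (W - K) * i * ℓ + ℓ
              ≈⟨ solve 4 (λ W K i l → (W :- K) :* i :* l :+ l := W :* i :* l :+ (con (+ 1) :- K :* i) :* l) refl W K i ℓ ⟩
            z + (1# - K * i) * ℓ                ≈⟨ +-congˡ (*-congʳ (+-congˡ (-‿cong (⁻¹-inverseʳ (0<x⇒x≉0 0<K))))) ⟩
            z + (1# - 1#) * ℓ                   ≈⟨ solve 2 (λ z l → z :+ (con (+ 1) :- con (+ 1)) :* l := z) refl z ℓ ⟩
            z                                   ∎) ⟩
          exp z                               ∎

      k/100η≤lower-bound : K / (fromℕ 100 * η₀) ≤ lower-bound k
      k/100η≤lower-bound = x≤z*y⇒x/y≤z (*-positive (fromℕ-suc-positive 99) 0<η) (begin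
        K                                                      ≈⟨ *-identityʳ _ ⟨
        K * 1#                                                 ≤⟨ *-monoˡ-≤ K (<⇒≤ 0<K) 1≤2exp-z ⟩
        K * (fromℕ 2 * exp z)
          ≈⟨ *-congˡ (*-cong (trans (sym (*-identityˡ _)) (*-congʳ (sym i₅₀*50≈1))) (sym η*power)) ⟩
        K * (i₅₀ * fromℕ 50 * fromℕ 2 * (E * η₀))
          ≈⟨ solve 6 (λ K i a b E e → K :* (i :* a :* b :* (E :* e)) :=
              i :* K :* E :* (a :* b :* e)) refl K i₅₀ (fromℕ 50) (fromℕ 2) E η₀ ⟩
        i₅₀ * K * E * (fromℕ 50 * fromℕ 2 * η₀)                ≈⟨ *-congˡ (*-congʳ (fromℕ-* 50 2)) ⟨
        i₅₀ * K * E * (fromℕ 100 * η₀)                         ∎)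
        where
        E : Carrier
        E = η₀ ^ʳ ((W - K) / K)

      k/100η≤r : ∀ {r} → RamseyProperty s k r → K / (fromℕ 100 * η₀) ≤ fromℕ r
      k/100η≤r ramsey = ≤-trans k/100η≤lower-bound (lower-bound≤r 1≤k W≤K ramsey)

-- The quantity `η` and the exclusion of degenerate parameters.

module Eta (𝓡 : RealNumbers) where
  open RealNumbers 𝓡 hiding (zero)
  open OrderedField completeOrderedField
  open Spectral 𝓡

  x/y≈0 : ∀ x {y} → y ≈ 0# → x / y ≈ 0#
  x/y≈0 x y≈0 = trans (*-congˡ (trans (⁻¹-cong y≈0) 0⁻¹≈0)) (zeroʳ x)

  -- By the convention x / 0 = 0.
  η-edgeless : ∀ dF λF λG → η dF 0 λF λG ≤ 0#
  η-edgeless dF λF λG = ⊔-lub (≤-reflexive (x/y≈0 _ (zeroˡ _))) (≤-reflexive (x/y≈0 _ (zeroʳ _)))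

  λGλG≤ : ∀ dF dG λF λG → 1 ℕ.≤ dG → λG * λG ≤ η dF dG λF λG * (fromℕ dG * fromℕ dG)
  λGλG≤ dF dG λF λG 1≤dG = ≤-respˡ (solve 1 (λ l → l :* (l :* con (+ 1)) := l :* l) refl λG)
    (≤-respʳ (*-congˡ (*-congˡ (*-identityʳ _))) (x/y≤z⇒x≤z*y (^-positive 2 (fromℕ-positive 1≤dG)) (x≤x⊔y _ _)))

  λFλG≤ : ∀ dF dG λF λG → 1 ℕ.≤ dF → 1 ℕ.≤ dG → λF * λG ≤ η dF dG λF λG * (fromℕ dF * fromℕ dG)
  λFλG≤ dF dG λF λG 1≤dF 1≤dG = x/y≤z⇒x≤z*y (*-positive (fromℕ-positive 1≤dF) (fromℕ-positive 1≤dG)) (x≤y⊔x _ _)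

  -- The upper bound on `k` is what excludes degenerate parameters: a product at least `1` has no
  -- vanishing factor, and its natural factors being nonnegative, `η₀` is positive.
  product-positive : ∀ {η₀} k dF n → 1 ℕ.≤ k → fromℕ k ≤ η₀ * fromℕ dF * fromℕ n → 0# < η₀ × 1 ℕ.≤ dF × 1 ℕ.≤ n
  product-positive {η₀} k dF n 1≤k k≤ = 0<η , positive dF dF≢0 , positive n n≢0
    where
    0<product : 0# < η₀ * fromℕ dF * fromℕ n
    0<product = <-≤-trans (fromℕ-positive 1≤k) k≤
    0<η : 0# < η₀
    0<η η≤0 = 0<product (≤-respʳ (zeroˡ _) (*-monoʳ-≤ (fromℕ n) (fromℕ-nonNegative n)
      (≤-respʳ (zeroˡ _) (*-monoʳ-≤ (fromℕ dF) (fromℕ-nonNegative dF) η≤0))))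
    positive : ∀ m → ¬ (fromℕ m ≈ 0#) → 1 ℕ.≤ m
    positive zero    0≉0 = contradiction refl 0≉0
    positive (suc m) _   = s≤s z≤n
    dF≢0 : ¬ (fromℕ dF ≈ 0#)
    dF≢0 dF≈0 = 0<product (≤-reflexive (trans (*-congʳ (trans (*-congˡ dF≈0) (zeroʳ _))) (zeroˡ _)))
    n≢0 : ¬ (fromℕ n ≈ 0#)
    n≢0 n≈0 = 0<product (≤-reflexive (trans (*-congˡ n≈0) (zeroʳ _)))

  x≤y⇒x-1≤y : ∀ {x y} → x ≤ y → x - 1# ≤ y
  x≤y⇒x-1≤y {x} {y} x≤y = ≤-certificate (+-nonNegative (x≤y⇒0≤y-x x≤y) 0≤1) (solve 2 (λ x y → y :- (x :- con (+ 1)) :=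
      (y :- x) :+ con (+ 1)) refl x y)

theorem2p9 : (𝓡 : RealNumbers) →
    let open RealNumbers 𝓡
        open Spectral 𝓡
    in
    (s n dF dG : ℕ) (λF λG : Carrier) (F G : Graph n) →
    3 ℕ.≤ s →
    IsNDΛGraph dF λF F →
    IsNDΛGraph dG λG G →
    HFree s F G →
    let η₀ = η dF dG λF λG
        w₀ = w n dG
    in
    ((k : ℕ) → 1 ℕ.≤ k →
      w₀ ≤ fromℕ k →
      fromℕ k ≤ η₀ * fromℕ dF * fromℕ n →
      (r : ℕ) → IsRamseyNumber s k r →
      (1# / fromℕ 50) * fromℕ k * (η₀ ^ʳ ((w₀ - fromℕ k) / fromℕ k)) - 1# ≤ fromℕ r)
    ×
    ((k : ℕ) → 1 ℕ.≤ k →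
      (fromℕ 100 * fromℕ n * log (fromℕ n) ^ 2) / fromℕ dG ≤ fromℕ k →
      fromℕ k ≤ η₀ * fromℕ dF * fromℕ n →
      (r : ℕ) → IsRamseyNumber s k r →
      fromℕ k / (fromℕ 100 * η₀) - 1# ≤ fromℕ r)
-- No vertices and an edgeless `G` both contradict `1 ≤ k ≤ η * dF * n`; a single vertex contradicts
-- freeness, as both degrees are then positive. What remains has two vertices, as the spectral part
-- requires.
theorem2p9 𝓡 s zero dF dG λF λG F G 3≤s isF isG free =
  (λ k 1≤k _ k≤ → contradiction (proj₂ (proj₂ (product-positive k dF 0 1≤k k≤))) λ ()) ,
  (λ k 1≤k _ k≤ → contradiction (proj₂ (proj₂ (product-positive k dF 0 1≤k k≤))) λ ())
  where open Eta 𝓡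
theorem2p9 𝓡 s (suc n) dF zero λF λG F G 3≤s isF isG free =
  (λ k 1≤k _ k≤ → contradiction (η-edgeless dF λF λG) (proj₁ (product-positive k dF (suc n) 1≤k k≤))) ,
  (λ k 1≤k _ k≤ → contradiction (η-edgeless dF λF λG) (proj₁ (product-positive k dF (suc n) 1≤k k≤)))
  where open Eta 𝓡
theorem2p9 𝓡 s 1 dF (suc dG) λF λG F G 3≤s isF isG free =
  (λ k 1≤k _ k≤ → contradiction free (not-free (proj₁ (proj₂ (product-positive k dF 1 1≤k k≤))))) ,
  (λ k 1≤k _ k≤ → contradiction free (not-free (proj₁ (proj₂ (product-positive k dF 1 1≤k k≤)))))
  where
  open Eta 𝓡
  open Spectral.IsNDΛGraph
  not-free : 1 ℕ.≤ dF → ¬ HFree s F G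
  not-free 1≤dF = not-HFree-on-one-vertex F G (regular isF) (regular isG) 1≤dF (s≤s z≤n)
theorem2p9 𝓡 s (suc (suc m)) dF (suc dG) λF λG F G 3≤s isF isG free =
  (λ k 1≤k w≤k k≤ r (ramsey , _) → first k 1≤k w≤k r ramsey (product-positive k dF (suc (suc m)) 1≤k k≤)) ,
  (λ k 1≤k large k≤ r (ramsey , _) → second k 1≤k large k≤ r ramsey (product-positive k dF (suc (suc m)) 1≤k k≤))
  where
  open Eta 𝓡
  open Bounds 𝓡
  open RealNumbers 𝓡 hiding (zero)
  open OrderedField completeOrderedField using (_<_)
  open Spectral 𝓡
  n : ℕ
  n = suc (suc m)
  η₀ w₀ : Carrier
  η₀ = η dF (suc dG) λF λG
  w₀ = w n (suc dG)
  2≤s : 2 ℕ.≤ s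
  2≤s = ℕ.≤-trans (s≤s (s≤s z≤n)) 3≤s
  first : ∀ k → 1 ℕ.≤ k → w₀ ≤ fromℕ k → ∀ r → RamseyProperty s k r → 0# < η₀ × 1 ℕ.≤ dF × 1 ℕ.≤ n →
    (1# / fromℕ 50) * fromℕ k * (η₀ ^ʳ ((w₀ - fromℕ k) / fromℕ k)) - 1# ≤ fromℕ r
  first k 1≤k w≤k r ramsey (0<η , 1≤dF , _) = x≤y⇒x-1≤y
    (lower-bound≤r F G 2≤s isF isG free 1≤dF (s≤s z≤n) η₀ 0<η (λGλG≤ dF (suc dG) λF λG (s≤s z≤n)) (λFλG≤ dF (suc dG) λF λG 1≤dF (s≤s z≤n)) 1≤k w≤k ramsey)
  second : ∀ k → 1 ℕ.≤ k → (fromℕ 100 * fromℕ n * log (fromℕ n) ^ 2) / fromℕ (suc dG) ≤ fromℕ k →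
    fromℕ k ≤ η₀ * fromℕ dF * fromℕ n → ∀ r → RamseyProperty s k r → 0# < η₀ × 1 ℕ.≤ dF × 1 ℕ.≤ n →
    fromℕ k / (fromℕ 100 * η₀) - 1# ≤ fromℕ r
  second k 1≤k large k≤ r ramsey (0<η , 1≤dF , _) = x≤y⇒x-1≤y
    (k/100η≤r F G 2≤s isF isG free 1≤dF (s≤s z≤n) η₀ 0<η (λGλG≤ dF (suc dG) λF λG (s≤s z≤n)) (λFλG≤ dF (suc dG) λF λG 1≤dF (s≤s z≤n)) 1≤k large k≤ ramsey)
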